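{- There exist an absolute constant $C>0$ and an $n_0$ such that for every $n\ge n_0$, every integer $k$ with $k\ge 2$ and $n\ge 2k$, and every transmission radius $r\in\mathbb{N}$ (possibly $0$) with $r\le \sqrt{n/(64e^6k)}$, the broadcast time $T_{\mathrm B}$ of a single rumor in the system of $k$ mobile agents on the $n$-node grid $\mathcal{G}_n$ satisfies, with probability at least $1-\max\{2^{ -(k-1)},\,2/n^2\}$, $$T_{\mathrm B}\ge C\,\frac{n}{\sqrt{k}\,\log^2 n},$$ that is, $T_{\mathrm B}=\Omega\!\left(\frac{n}{\sqrt k\log^2 n}\right)$.
   Context: $\mathcal{G}_n$ is the 2-dimensional $\sqrt n\times\sqrt n$ square grid graph with $n$ nodes ($n$ a perfect square). Distances between grid nodes are Manhattan distances, denoted $\|u-v\|$. A set $A$ of $k$ agents is placed at time $0$ uniformly and independently at random on the nodes of $\mathcal{G}_n$. Time is discrete and moves are synchronized; the agents perform independent random walks: at each step an agent on a node $v$ with $n_v\in\{2,3,4\}$ neighbors moves to each neighbor with probability $1/5$ and stays on $v$ with probability $1-n_v/5$. For a transmission radius $r\in\mathbb{N}$ (including $0$), the visibility graph $G_t(r)$ has vertex set $A$ and an edge between two agents iff they are within distance $r$ at time $t$. Let $M_a(t)$ be the set of rumors agent $a$ is informed of at time $t$. Within a connected component $C$ of $G_t(r)$ all rumors are exchanged instantaneously: $M_a(t)=\bigcup_{a'\in C}M_{a'}(t-1)$ for all $a\in C$. There is one rumor $m$ and one arbitrary (fixed) source agent $a$ with $M_a(0)=\{m\}$, while $M_{a'}(0)=\emptyset$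 for all $a'\ne a$. The broadcast time $T_{\mathrm B}$ is the first time at which every agent is informed of $m$. Here $\log$ is the natural logarithm. -}

module Defs where

open import Data.Bool using (Bool; true; false; T; if_then_else_)
open import Data.Fin using (Fin; toℕ)
open import Data.Integer using (+_)
import Data.Integer as ℤ
import Data.Integer.Properties as ℤ
open import Data.List using (List; []; _∷_; length; map; filter; filterᵇ; concatMap; foldr; allFin; cartesianProduct)
open import Data.Unit using (⊤; tt)
open import Data.Nat using (ℕ; zero; suc; _!; NonTrivial; ∣_-_∣)
import Data.Nat as ℕ
import Data.Nat.Properties as ℕ
open import Data.Product using (Σ; ∃; ∃-syntax; _×_; _,_; proj₁; proj₂)
open import Data.Rational hiding (∣_∣)
open import Data.Rational.Properties
open import Data.Rational.Solver using (module +-*-Solver)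
import Data.Rational.Unnormalised as ℚᵘ
import Data.Rational.Unnormalised.Properties as ℚᵘ
open import Data.Sum using (_⊎_; inj₁; inj₂)
open import Data.Vec as Vec using (Vec; []; _∷_; lookup; replicate; head)
open import Level using (0ℓ)
open import Relation.Binary using (Rel)
open import Relation.Binary.Construct.Closure.ReflexiveTransitive using (Star)
open import Relation.Binary.PropositionalEquality
  using (_≡_; refl; sym; trans; cong; cong₂; subst; module ≡-Reasoning)
open import Relation.Nullary using (¬_)
open import Relation.Unary using (Pred)

ι : ℕ → ℚ
ι n = + n / 1

ι-+ : ∀ m n → ι (m ℕ.+ n) ≡ ι m + ι n
ι-+ m n = toℚᵘ-injective (begin-equality
  toℚᵘ (ι (m ℕ.+ n))           ≃⟨ toℚᵘ-fromℚᵘ (ℚᵘ.mkℚᵘ (+ (m ℕ.+ n)) 0) ⟩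
  ℚᵘ.mkℚᵘ (+ (m ℕ.+ n)) 0      ≃⟨ ℚᵘ.*≡* (cong (ℤ._* + 1)
                                     (sym (cong₂ ℤ._+_ (ℤ.*-identityʳ (+ m)) (ℤ.*-identityʳ (+ n))))) ⟩
  ℚᵘ.mkℚᵘ (+ m) 0 ℚᵘ.+ ℚᵘ.mkℚᵘ (+ n) 0
    ≃⟨ ℚᵘ.+-cong (toℚᵘ-fromℚᵘ (ℚᵘ.mkℚᵘ (+ m) 0)) (toℚᵘ-fromℚᵘ (ℚᵘ.mkℚᵘ (+ n) 0)) ⟨
  toℚᵘ (ι m) ℚᵘ.+ toℚᵘ (ι n)   ≃⟨ toℚᵘ-homo-+ (ι m) (ι n) ⟨
  toℚᵘ (ι m + ι n)             ∎)
  where open ℚᵘ.≤-Reasoning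

ι-suc : ∀ n → ι (suc n) ≡ 1ℚ + ι n
ι-suc = ι-+ 1

ι-* : ∀ m n → ι (m ℕ.* n) ≡ ι m * ι n
ι-* zero    n = sym (*-zeroˡ (ι n))
ι-* (suc m) n = begin
  ι (n ℕ.+ m ℕ.* n)     ≡⟨ ι-+ n (m ℕ.* n) ⟩
  ι n + ι (m ℕ.* n)     ≡⟨ cong₂ _+_ (sym (*-identityˡ (ι n))) (ι-* m n) ⟩
  1ℚ * ι n + ι m * ι n  ≡⟨ *-distribʳ-+ (ι n) 1ℚ (ι m) ⟨
  (1ℚ + ι m) * ι n      ≡⟨ cong (_* ι n) (ι-suc m) ⟨
  ι (suc m) * ι n       ∎
  where open ≡-Reasoning

ι-nonNeg : ∀ n → NonNegative (ι n)
ι-nonNeg n = normalize-nonNeg n 1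

ι-pos : ∀ n → .{{ℕ.NonZero n}} → Positive (ι n)
ι-pos n = normalize-pos n 1

ι-mono : ∀ {m n} → m ℕ.≤ n → ι m ≤ ι n
ι-mono {m} {n} m≤n = begin
  ι m                   ≡⟨ +-identityʳ (ι m) ⟨
  ι m + 0ℚ              ≤⟨ +-monoʳ-≤ (ι m) (nonNegative⁻¹ _ {{ι-nonNeg (n ℕ.∸ m)}}) ⟩
  ι m + ι (n ℕ.∸ m)     ≡⟨ ι-+ m (n ℕ.∸ m) ⟨
  ι (m ℕ.+ (n ℕ.∸ m))   ≡⟨ cong ι (ℕ.m+[n∸m]≡n m≤n) ⟩
  ι n                   ∎
  where open ≤-Reasoning

/-ι : ∀ m d .{{_ : ℕ.NonZero d}} → (+ m / d) * ι d ≡ ι m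
/-ι m (suc d) = toℚᵘ-injective (begin-equality
  toℚᵘ ((+ m / suc d) * ι (suc d))
    ≃⟨ toℚᵘ-homo-* (+ m / suc d) (ι (suc d)) ⟩
  toℚᵘ (+ m / suc d) ℚᵘ.* toℚᵘ (ι (suc d))
    ≃⟨ ℚᵘ.*-cong (toℚᵘ-fromℚᵘ (ℚᵘ.mkℚᵘ (+ m) d)) (toℚᵘ-fromℚᵘ (ℚᵘ.mkℚᵘ (+ suc d) 0)) ⟩
  ℚᵘ.mkℚᵘ (+ m) d ℚᵘ.* ℚᵘ.mkℚᵘ (+ suc d) 0
    ≃⟨ ℚᵘ.*≡* (trans (ℤ.*-identityʳ _) (cong (λ e → + m ℤ.* + e) (sym (ℕ.*-identityʳ (suc d))))) ⟩
  ℚᵘ.mkℚᵘ (+ m) 0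
    ≃⟨ toℚᵘ-fromℚᵘ (ℚᵘ.mkℚᵘ (+ m) 0) ⟨
  toℚᵘ (ι m) ∎)
  where open ℚᵘ.≤-Reasoning

archimedean : ∀ p → ∃[ n ] p ≤ ι n
archimedean p = n , subst (_≤ ι n) (↥p/↧p≡p p) (toℚᵘ-cancel-≤ (begin
  toℚᵘ (↥ p / ↧ₙ p)  ≡⟨ cong toℚᵘ (↥p/↧p≡p p) ⟩
  toℚᵘ p             ≤⟨ bound p ⟩
  ℚᵘ.mkℚᵘ (+ n) 0    ≃⟨ toℚᵘ-fromℚᵘ (ℚᵘ.mkℚᵘ (+ n) 0) ⟨
  toℚᵘ (ι n)         ∎))
  where
  open ℚᵘ.≤-Reasoning
  n = ℤ.∣ ↥ p ∣
  bound : ∀ p → toℚᵘ p ℚᵘ.≤ ℚᵘ.mkℚᵘ (+ ℤ.∣ ↥ p ∣) 0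
  bound (mkℚ (+ a) d _) = ℚᵘ.*≤* (ℤ.*-monoˡ-≤-nonNeg (+ a) (ℤ.+≤+ (ℕ.s≤s ℕ.z≤n)))
  bound (mkℚ (ℤ.-[1+ a ]) d _) = ℚᵘ.*≤* ℤ.-≤+

½^_ : ℕ → ℚ
½^ zero  = 1ℚ
½^ suc n = ½ * ½^ n

½^-pos : ∀ n → 0ℚ < ½^ n
½^-pos zero    = positive⁻¹ 1ℚ
½^-pos (suc n) = positive⁻¹ _ {{pos*pos⇒pos ½ (½^ n) {{positive (½^-pos n)}}}}

½+½ : ∀ p → ½ * p + ½ * p ≡ p
½+½ p = trans (sym (*-distribʳ-+ p ½ ½)) (*-identityˡ p)

*-mono-≤-nonNeg : ∀ {p q r s} → 0ℚ ≤ p → 0ℚ ≤ s → p ≤ q → r ≤ s → p * r ≤ q * s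
*-mono-≤-nonNeg {p} {q} {r} {s} 0≤p 0≤s p≤q r≤s = ≤-trans
  (*-monoˡ-≤-nonNeg p {{nonNegative 0≤p}} r≤s) (*-monoʳ-≤-nonNeg s {{nonNegative 0≤s}} p≤q)

*-pos : ∀ {p q} → 0ℚ < p → 0ℚ < q → 0ℚ < p * q
*-pos {p} {q} 0<p 0<q = positive⁻¹ _ {{pos*pos⇒pos p {{positive 0<p}} q {{positive 0<q}}}}

*-nonNeg : ∀ {p q} → 0ℚ ≤ p → 0ℚ ≤ q → 0ℚ ≤ p * q
*-nonNeg {p} {q} 0≤p 0≤q =
  nonNegative⁻¹ _ {{nonNeg*nonNeg⇒nonNeg p {{nonNegative 0≤p}} q {{nonNegative 0≤q}}}}

≤-+ʳ : ∀ {p q} → 0ℚ ≤ q → p ≤ p + q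
≤-+ʳ {p} 0≤q = ≤-trans (≤-reflexive (sym (+-identityʳ p))) (+-monoʳ-≤ p 0≤q)

recip : (p : ℚ) → .(0ℚ < p) → ℚ
recip p 0<p = 1/_ p {{>-nonZero 0<p}}

recip-inverseʳ : ∀ p .(0<p : 0ℚ < p) → p * recip p 0<p ≡ 1ℚ
recip-inverseʳ p 0<p = *-inverseʳ p {{>-nonZero 0<p}}

recip-pos : ∀ p (0<p : 0ℚ < p) → 0ℚ < recip p 0<p
recip-pos p 0<p = positive⁻¹ _ {{1/pos⇒pos p {{positive 0<p}}}}

ι*½^≤1 : ∀ n → ι n * ½^ n ≤ 1ℚ
ι*½^≤1 zero    = ≤-trans (≤-reflexive (*-zeroˡ 1ℚ)) (nonNegative⁻¹ 1ℚ)
ι*½^≤1 (suc n) = begin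
  ι (suc n) * (½ * ½^ n)          ≡⟨ cong (_* (½ * ½^ n)) (ι-suc n) ⟩
  (1ℚ + ι n) * (½ * ½^ n)
    ≡⟨ solve 3 (λ a h x → (con 1ℚ :+ a) :* (h :* x) := h :* x :+ h :* (a :* x)) refl (ι n) ½ (½^ n) ⟩
  ½ * ½^ n + ½ * (ι n * ½^ n)
    ≤⟨ +-mono-≤ (*-monoˡ-≤-nonNeg ½ (½^≤1 n)) (*-monoˡ-≤-nonNeg ½ (ι*½^≤1 n)) ⟩
  ½ * 1ℚ + ½ * 1ℚ                 ≡⟨ ½+½ 1ℚ ⟩
  1ℚ                              ∎
  where
  open ≤-Reasoning
  open +-*-Solver
  ½^≤1 : ∀ n → ½^ n ≤ 1ℚ
  ½^≤1 zero    = ≤-refl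
  ½^≤1 (suc n) = ≤-trans (*-mono-≤-nonNeg {½} {1ℚ} (nonNegative⁻¹ ½) (nonNegative⁻¹ 1ℚ)
                   (≤ᵇ⇒≤ _) (½^≤1 n)) (≤-reflexive (*-identityˡ 1ℚ))

geometric→0 : ∀ K ε → 0ℚ < ε → ∃[ N ] (∀ i → N ℕ.≤ i → K * ½^ i ≤ ε)
geometric→0 K ε 0<ε with archimedean (K * recip ε 0<ε)
... | N , K/ε≤N = N , λ i N≤i → begin
  K * ½^ i                          ≡⟨ cong (_* ½^ i) (*-identityʳ K) ⟨
  (K * 1ℚ) * ½^ i                   ≡⟨ cong (λ p → (K * p) * ½^ i) (recip-inverseʳ ε 0<ε) ⟨
  (K * (ε * recip ε 0<ε)) * ½^ i
    ≡⟨ solve 4 (λ k e r h → (k :* (e :* r)) :* h := ((k :* r) :* h) :* e) refl K ε (recip ε 0<ε) (½^ i) ⟩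
  ((K * recip ε 0<ε) * ½^ i) * ε
    ≤⟨ *-monoʳ-≤-nonNeg ε {{0≤ε}} (*-monoʳ-≤-nonNeg (½^ i) {{nonNegative (<⇒≤ (½^-pos i))}}
         (≤-trans K/ε≤N (ι-mono N≤i))) ⟩
  (ι i * ½^ i) * ε                  ≤⟨ *-monoʳ-≤-nonNeg ε {{0≤ε}} (ι*½^≤1 i) ⟩
  1ℚ * ε                            ≡⟨ *-identityˡ ε ⟩
  ε                                 ∎
  where
  open ≤-Reasoning
  open +-*-Solver
  0≤ε = nonNegative (<⇒≤ 0<ε)

Seq : Set
Seq = ℕ → ℚ

-- Exchanging i and j turns the one-sided bound into ∣ x i - x j ∣ ≤ ε.
Cauchy : Seq → Set
Cauchy x = ∀ ε → 0ℚ < ε → ∃[ N ] (∀ i j → N ℕ.≤ i → N ℕ.≤ j → x i ≤ x j + ε)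

record ℝ : Set where
  field
    approx : Seq
    cauchy : Cauchy approx

open ℝ public

infix 4 _≤ᴿ_

_≤ᴿ_ : Rel ℝ 0ℓ
x ≤ᴿ y = ∀ ε → 0ℚ < ε → ∃[ N ] (∀ i → N ℕ.≤ i → approx x i ≤ approx y i + ε)

constant-cauchy : ∀ q → Cauchy (λ _ → q)
constant-cauchy q ε 0<ε = 0 , λ _ _ _ _ → ≤-+ʳ (<⇒≤ 0<ε)

fromℕ : ℕ → ℝ
fromℕ n = record { approx = λ _ → ι n ; cauchy = constant-cauchy (ι n) }

AwayFromZero : Seq → Set
AwayFromZero x = ∃[ δ ] (0ℚ < δ × (∀ i → δ ≤ x i))

-- Bounding every approximation, not only almost all of them, loses no positive
-- real and makes the operations below total and pointwise.
record ℝ⁺ : Set where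
  field
    real : ℝ
    away : AwayFromZero (approx real)

  positive-approx : ∀ i → 0ℚ < approx real i
  positive-approx i = <-≤-trans (proj₁ (proj₂ away)) (proj₂ (proj₂ away) i)

open ℝ⁺ public

bounded : ∀ x → Cauchy x → ∃[ B ] (0ℚ < B × (∀ i → x i ≤ B))
bounded x c with c 1ℚ (positive⁻¹ 1ℚ)
... | N , x≈ = B , 0<B , bound
  where
  open ≤-Reasoning
  max : ℕ → ℚ
  max zero    = 0ℚ ⊔ x 0
  max (suc n) = max n ⊔ x (suc n)

  0≤max : ∀ n → 0ℚ ≤ max n
  0≤max zero    = p≤p⊔q 0ℚ (x 0)
  0≤max (suc n) = ≤-trans (0≤max n) (p≤p⊔q (max n) (x (suc n)))

  x≤max : ∀ n i → i ℕ.≤ n → x i ≤ max n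
  x≤max zero    zero ℕ.z≤n = p≤q⊔p 0ℚ (x 0)
  x≤max (suc n) i i≤1+n with ℕ.m≤n⇒m<n∨m≡n i≤1+n
  ... | inj₁ (ℕ.s≤s i≤n) = ≤-trans (x≤max n i i≤n) (p≤p⊔q (max n) (x (suc n)))
  ... | inj₂ refl        = p≤q⊔p (max n) (x (suc n))

  B = max N + 1ℚ

  0<B : 0ℚ < B
  0<B = positive⁻¹ B {{nonNeg+pos⇒pos (max N) {{nonNegative (0≤max N)}} 1ℚ}}

  bound : ∀ i → x i ≤ B
  bound i with ℕ.≤-total i N
  ... | inj₁ i≤N = ≤-trans (x≤max N i i≤N) (≤-+ʳ (nonNegative⁻¹ 1ℚ))
  ... | inj₂ N≤i = ≤-trans (x≈ i N N≤i ℕ.≤-refl) (+-monoˡ-≤ 1ℚ (x≤max N N ℕ.≤-refl))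

squeeze-cauchy : ∀ (x gap : Seq) N₀ →
  (∀ i → 0ℚ ≤ gap i) →
  (∀ ε → 0ℚ < ε → ∃[ N ] (∀ i → N ℕ.≤ i → gap i ≤ ε)) →
  (∀ i → N₀ ℕ.≤ i → x i ≤ x (suc i)) →
  (∀ i → N₀ ℕ.≤ i → x (suc i) + gap (suc i) ≤ x i + gap i) →
  Cauchy x
squeeze-cauchy x gap N₀ 0≤gap gap→0 up down ε 0<ε with gap→0 ε 0<ε
... | N₁ , gap≤ε = N , λ i j N≤i N≤j → begin
  x i             ≤⟨ ≤-+ʳ (0≤gap i) ⟩
  x i + gap i     ≤⟨ mono (λ i → x i + gap i) _≥_ ≤-refl (λ p q → ≤-trans q p) down i N≤i ⟩
  x N + gap N     ≤⟨ +-mono-≤ (mono x _≤_ ≤-refl ≤-trans up j N≤j) (gap≤ε N (ℕ.m≤n⊔m N₀ N₁)) ⟩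
  x j + ε         ∎
  where
  open ≤-Reasoning
  N = N₀ ℕ.⊔ N₁
  mono : ∀ (f : Seq) (R : Rel ℚ 0ℓ) → (∀ {p} → R p p) → (∀ {p q r} → R p q → R q r → R p r) →
         (∀ i → N₀ ℕ.≤ i → R (f i) (f (suc i))) → ∀ i → N ℕ.≤ i → R (f N) (f i)
  mono f R rfl trns step i N≤i = go (ℕ.≤⇒≤′ N≤i)
    where
    go : ∀ {i} → N ℕ.≤′ i → R (f N) (f i)
    go (ℕ.≤′-reflexive refl) = rfl
    go (ℕ.≤′-step N≤′i) =
      trns (go N≤′i) (step _ (ℕ.≤-trans (ℕ.m≤m⊔n N₀ N₁) (ℕ.≤′⇒≤ N≤′i)))

fromℕ⁺ : (n : ℕ) → .{{ℕ.NonZero n}} → ℝ⁺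
fromℕ⁺ n = record
  { real = fromℕ n
  ; away = ι n , positive⁻¹ (ι n) {{ι-pos n}} , λ _ → ≤-refl
  }

infixl 7 _·_ _∕_
infix  8 _⁻¹

_·_ : ℝ⁺ → ℝ⁺ → ℝ⁺
x · y = record
  { real = record { approx = λ i → x̂ i * ŷ i ; cauchy = ·-cauchy }
  ; away = δ * γ , *-pos 0<δ 0<γ , λ i →
      *-mono-≤-nonNeg (<⇒≤ 0<δ) (<⇒≤ (positive-approx y i)) (δ≤x i) (γ≤y i)
  }
  where
  open ≤-Reasoning
  open +-*-Solver
  x̂ = approx (real x)
  ŷ = approx (real y)
  δ = proj₁ (away x) ; 0<δ = proj₁ (proj₂ (away x)) ; δ≤x = proj₂ (proj₂ (away x))
  γ = proj₁ (away y) ; 0<γ = proj₁ (proj₂ (away y)) ; γ≤y = proj₂ (proj₂ (away y))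

  share : ∀ ε B (0<B : 0ℚ < B) → (ε * recip B 0<B) * B ≡ ε
  share ε B 0<B = trans (*-assoc ε (recip B 0<B) B)
    (trans (cong (ε *_) (trans (*-comm (recip B 0<B) B) (recip-inverseʳ B 0<B))) (*-identityʳ ε))

  ·-cauchy : Cauchy (λ i → x̂ i * ŷ i)
  ·-cauchy ε 0<ε with bounded x̂ (cauchy (real x)) | bounded ŷ (cauchy (real y))
  ... | A , 0<A , x≤A | B , 0<B , y≤B
    with cauchy (real x) (½ * ε * recip B 0<B) (*-pos (*-pos (positive⁻¹ ½) 0<ε) (recip-pos B 0<B))
       | cauchy (real y) (½ * ε * recip A 0<A) (*-pos (*-pos (positive⁻¹ ½) 0<ε) (recip-pos A 0<A))
  ... | M , x≈ | N , y≈ = M ℕ.⊔ N , λ i j ≤i ≤j → begin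
    x̂ i * ŷ i
      ≤⟨ *-monoʳ-≤-nonNeg (ŷ i) {{nonNegative (<⇒≤ (positive-approx y i))}}
           (x≈ i j (ℕ.m⊔n≤o⇒m≤o M N ≤i) (ℕ.m⊔n≤o⇒m≤o M N ≤j)) ⟩
    (x̂ j + α) * ŷ i
      ≡⟨ *-distribʳ-+ (ŷ i) (x̂ j) α ⟩
    x̂ j * ŷ i + α * ŷ i
      ≤⟨ +-mono-≤
           (*-monoˡ-≤-nonNeg (x̂ j) {{nonNegative (<⇒≤ (positive-approx x j))}}
             (y≈ i j (ℕ.m⊔n≤o⇒n≤o M N ≤i) (ℕ.m⊔n≤o⇒n≤o M N ≤j)))
           (*-monoˡ-≤-nonNeg α {{nonNegative (<⇒≤ 0<α)}} (y≤B i)) ⟩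
    x̂ j * (ŷ j + β) + α * B
      ≡⟨ solve 5 (λ a b c d e → a :* (b :+ c) :+ d :* e := a :* b :+ (c :* a :+ d :* e))
           refl (x̂ j) (ŷ j) β α B ⟩
    x̂ j * ŷ j + (β * x̂ j + α * B)
      ≤⟨ +-monoʳ-≤ (x̂ j * ŷ j) (+-monoˡ-≤ (α * B) (*-monoˡ-≤-nonNeg β {{nonNegative (<⇒≤ 0<β)}} (x≤A j))) ⟩
    x̂ j * ŷ j + (β * A + α * B)
      ≡⟨ cong (λ p → x̂ j * ŷ j + p) (trans (cong₂ _+_ (share (½ * ε) A 0<A) (share (½ * ε) B 0<B)) (½+½ ε)) ⟩
    x̂ j * ŷ j + ε ∎
    where
    α = ½ * ε * recip B 0<B
    β = ½ * ε * recip A 0<A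
    0<α = *-pos (*-pos (positive⁻¹ ½) 0<ε) (recip-pos B 0<B)
    0<β = *-pos (*-pos (positive⁻¹ ½) 0<ε) (recip-pos A 0<A)

_⁻¹ : ℝ⁺ → ℝ⁺
y ⁻¹ = record
  { real = record { approx = r ; cauchy = ⁻¹-cauchy }
  ; away = recip B 0<B , recip-pos B 0<B , λ i → swap B 0<B (ŷ i) (positive-approx y i) 0ℚ
      (≤-trans (y≤B i) (≤-reflexive (solve 2 (λ b c → b := b :+ con 0ℚ :* (c :* b)) refl B (ŷ i))))
      |> λ ≤r+0 → ≤-trans ≤r+0 (≤-reflexive (+-identityʳ (r i)))
  }
  where
  open ≤-Reasoning
  open +-*-Solver
  open import Function using (_|>_)
  ŷ = approx (real y)
  δ = proj₁ (away y) ; 0<δ = proj₁ (proj₂ (away y)) ; δ≤y = proj₂ (proj₂ (away y))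

  r : Seq
  r i = recip (ŷ i) (positive-approx y i)

  B = proj₁ (bounded ŷ (cauchy (real y)))
  0<B = proj₁ (proj₂ (bounded ŷ (cauchy (real y))))
  y≤B = proj₂ (proj₂ (bounded ŷ (cauchy (real y))))

  swap : ∀ p (0<p : 0ℚ < p) q (0<q : 0ℚ < q) ε → q ≤ p + ε * (q * p) →
         recip p 0<p ≤ recip q 0<q + ε
  swap p 0<p q 0<q ε q≤ = *-cancelʳ-≤-pos (p * q) {{positive (*-pos 0<p 0<q)}} (begin
    recip p 0<p * (p * q)
      ≡⟨ solve 3 (λ a b c → a :* (b :* c) := (b :* a) :* c) refl (recip p 0<p) p q ⟩
    (p * recip p 0<p) * q
      ≡⟨ trans (cong (_* q) (recip-inverseʳ p 0<p)) (*-identityˡ q) ⟩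
    q
      ≤⟨ q≤ ⟩
    p + ε * (q * p)
      ≡⟨ cong (λ z → z + ε * (q * p)) (trans (cong (_* p) (recip-inverseʳ q 0<q)) (*-identityˡ p)) ⟨
    (q * recip q 0<q) * p + ε * (q * p)
      ≡⟨ solve 4 (λ q r p e → (q :* r) :* p :+ e :* (q :* p) := (r :+ e) :* (p :* q))
           refl q (recip q 0<q) p ε ⟩
    (recip q 0<q + ε) * (p * q) ∎)

  ⁻¹-cauchy : Cauchy r
  ⁻¹-cauchy ε 0<ε with cauchy (real y) (ε * (δ * δ)) (*-pos 0<ε (*-pos 0<δ 0<δ))
  ... | N , y≈ = N , λ i j N≤i N≤j →
    swap (ŷ i) (positive-approx y i) (ŷ j) (positive-approx y j) ε
      (≤-trans (y≈ j i N≤j N≤i) (+-monoʳ-≤ (ŷ i)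
        (*-monoˡ-≤-nonNeg ε {{nonNegative (<⇒≤ 0<ε)}}
          (*-mono-≤-nonNeg (<⇒≤ 0<δ) (<⇒≤ (positive-approx y i)) (δ≤y j) (δ≤y i)))))

_∕_ : ℝ⁺ → ℝ⁺ → ℝ⁺
x ∕ y = x · y ⁻¹

-- Bisection of [0 , q + 1]: the square root of q ≥ 0 lies between √lo q i and √hi q i.
width √lo √hi : ℚ → ℕ → ℚ
width q i     = (q + 1ℚ) * ½^ i
√lo q zero    = 0ℚ
√lo q (suc i) = let m = √lo q i + width q (suc i) in if m * m ≤ᵇ q then m else √lo q i
√hi q i       = √lo q i + width q i

sq-< : ∀ {p q} → 0ℚ ≤ p → p < q → p * p < q * q
sq-< {p} {q} 0≤p p<q = ≤-<-trans (*-monoˡ-≤-nonNeg p {{nonNegative 0≤p}} (<⇒≤ p<q))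
                                 (*-monoˡ-<-pos q {{positive (≤-<-trans 0≤p p<q)}} p<q)

width-half : ∀ q i → width q (suc i) + width q (suc i) ≡ width q i
width-half q i = trans
  (solve 3 (λ q h x → (q :+ con 1ℚ) :* (h :* x) :+ (q :+ con 1ℚ) :* (h :* x)
                   := h :* ((q :+ con 1ℚ) :* x) :+ h :* ((q :+ con 1ℚ) :* x)) refl q ½ (½^ i))
  (½+½ (width q i))
  where open +-*-Solver

width-nonNeg : ∀ {q} → 0ℚ ≤ q → ∀ i → 0ℚ ≤ width q i
width-nonNeg 0≤q i = *-nonNeg (≤-trans 0≤q (≤-+ʳ (nonNegative⁻¹ 1ℚ))) (<⇒≤ (½^-pos i))

√-bounds : ∀ {q} → 0ℚ ≤ q → ∀ i →
  0ℚ ≤ √lo q i × √lo q i * √lo q i ≤ q × q ≤ √hi q i * √hi q i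
√-bounds {q} 0≤q zero = ≤-refl , ≤-trans (≤-reflexive (*-zeroˡ 0ℚ)) 0≤q , (begin
  q                            ≤⟨ ≤-+ʳ (+-mono-≤ (+-mono-≤ 0≤q (*-nonNeg 0≤q 0≤q)) (nonNegative⁻¹ 1ℚ)) ⟩
  q + (q + q * q + 1ℚ)
    ≡⟨ solve 1 (λ q → q :+ (q :+ q :* q :+ con 1ℚ)
                   := (con 0ℚ :+ (q :+ con 1ℚ) :* con 1ℚ) :* (con 0ℚ :+ (q :+ con 1ℚ) :* con 1ℚ)) refl q ⟩
  √hi q 0 * √hi q 0            ∎)
  where
  open ≤-Reasoning
  open +-*-Solver
√-bounds {q} 0≤q (suc i) with √-bounds 0≤q i
... | 0≤lo , lo²≤q , q≤hi²
  with (√lo q i + width q (suc i)) * (√lo q i + width q (suc i)) ≤ᵇ q in eq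
... | true  = +-mono-≤ 0≤lo (width-nonNeg 0≤q (suc i)) , ≤ᵇ⇒≤ (subst T (sym eq) _)
            , subst (λ h → q ≤ h * h) (sym (trans (+-assoc (√lo q i) _ _)
                (cong (λ w → √lo q i + w) (width-half q i)))) q≤hi²
... | false = 0≤lo , lo²≤q , <⇒≤ (≰⇒> λ m²≤q → subst T eq (≤⇒≤ᵇ m²≤q))

<⇒≱ : ∀ {p q} → p < q → ¬ (q ≤ p)
<⇒≱ p<q q≤p = <-irrefl refl (<-≤-trans p<q q≤p)

root-cauchy : ∀ (q lo w : Seq) →
  (∀ i → 0ℚ ≤ lo i) → (∀ i → 0ℚ ≤ w i) →
  (∀ i → lo i * lo i ≤ q i) → (∀ i → q i ≤ (lo i + w i) * (lo i + w i)) →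
  (∀ ε → 0ℚ < ε → ∃[ N ] (∀ i → N ℕ.≤ i → w i ≤ ε)) →
  Cauchy q → Cauchy (λ i → lo i + w i)
root-cauchy q lo w 0≤lo 0≤w lo²≤q q≤hi² w→0 q-cauchy ε 0<ε = M ℕ.⊔ N , λ i j ≤i ≤j → ≮⇒≥ λ far →
  <⇒≱ (sq-< (+-mono-≤ (0≤u j) 0≤η) (below i j (ℕ.m⊔n≤o⇒m≤o M N ≤i) far)) (begin
    lo i * lo i                         ≤⟨ lo²≤q i ⟩
    q i                                 ≤⟨ q≈ i j (ℕ.m⊔n≤o⇒n≤o M N ≤i) (ℕ.m⊔n≤o⇒n≤o M N ≤j) ⟩
    q j + η * η                         ≤⟨ +-monoˡ-≤ (η * η) (q≤hi² j) ⟩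
    u j * u j + η * η                   ≤⟨ ≤-+ʳ (+-mono-≤ (*-nonNeg (0≤u j) 0≤η) (*-nonNeg (0≤u j) 0≤η)) ⟩
    u j * u j + η * η + (u j * η + u j * η)
      ≡⟨ solve 2 (λ a e → a :* a :+ e :* e :+ (a :* e :+ a :* e) := (a :+ e) :* (a :+ e))
           refl (u j) η ⟩
    (u j + η) * (u j + η)               ∎)
  where
  open ≤-Reasoning
  open +-*-Solver
  η : ℚ
  η = ½ * ε
  0<η : 0ℚ < η
  0<η = *-pos (positive⁻¹ ½) 0<ε
  0≤η : 0ℚ ≤ η
  0≤η = <⇒≤ 0<η
  u : Seq
  u i = lo i + w i
  0≤u : ∀ i → 0ℚ ≤ u i
  0≤u i = +-mono-≤ (0≤lo i) (0≤w i)
  M N : ℕ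
  M = proj₁ (w→0 η 0<η)
  N = proj₁ (q-cauchy (η * η) (*-pos 0<η 0<η))
  q≈ : ∀ i j → N ℕ.≤ i → N ℕ.≤ j → q i ≤ q j + η * η
  q≈ = proj₂ (q-cauchy (η * η) (*-pos 0<η 0<η))
  below : ∀ i j → M ℕ.≤ i → u j + ε < u i → u j + η < lo i
  below i j M≤i far = ≰⇒> λ lo≤ → <⇒≱ far (begin
    lo i + w i          ≤⟨ +-mono-≤ lo≤ (proj₂ (w→0 η 0<η) i M≤i) ⟩
    u j + η + η         ≡⟨ +-assoc (u j) η η ⟩
    u j + (η + η)       ≡⟨ cong (λ e → u j + e) (½+½ ε) ⟩
    u j + ε             ∎)

root-away : ∀ (q u : Seq) → (∀ i → 0ℚ ≤ u i) → (∀ i → q i ≤ u i * u i) →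
  AwayFromZero q → AwayFromZero u
root-away q u 0≤u q≤u² (δ , 0<δ , δ≤q) = δ ⊓ 1ℚ , 0<δ⊓1 , λ i → ≮⇒≥ λ u<δ⊓1 →
  <⇒≱ (sq-< (0≤u i) u<δ⊓1) (begin
    (δ ⊓ 1ℚ) * (δ ⊓ 1ℚ)   ≤⟨ *-monoˡ-≤-nonNeg (δ ⊓ 1ℚ) {{nonNegative (<⇒≤ 0<δ⊓1)}} (p⊓q≤q δ 1ℚ) ⟩
    (δ ⊓ 1ℚ) * 1ℚ         ≡⟨ *-identityʳ (δ ⊓ 1ℚ) ⟩
    δ ⊓ 1ℚ                ≤⟨ p⊓q≤p δ 1ℚ ⟩
    δ                     ≤⟨ δ≤q i ⟩
    q i                   ≤⟨ q≤u² i ⟩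
    u i * u i             ∎)
  where
  open ≤-Reasoning
  0<δ⊓1 : 0ℚ < δ ⊓ 1ℚ
  0<δ⊓1 with ⊓-sel δ 1ℚ
  ... | inj₁ ≡δ = subst (0ℚ <_) (sym ≡δ) 0<δ
  ... | inj₂ ≡1 = subst (0ℚ <_) (sym ≡1) (positive⁻¹ 1ℚ)

width→0 : ∀ q → Cauchy q → ∀ ε → 0ℚ < ε → ∃[ N ] (∀ i → N ℕ.≤ i → width (q i) i ≤ ε)
width→0 q q-cauchy ε 0<ε = proj₁ small , λ i N≤i → ≤-trans
  (*-monoʳ-≤-nonNeg (½^ i) {{nonNegative (<⇒≤ (½^-pos i))}} (+-monoˡ-≤ 1ℚ (q≤B i)))
  (proj₂ small i N≤i)
  where
  B : ℚ
  B = proj₁ (bounded q q-cauchy)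
  q≤B : ∀ i → q i ≤ B
  q≤B = proj₂ (proj₂ (bounded q q-cauchy))
  small : ∃[ N ] (∀ i → N ℕ.≤ i → (B + 1ℚ) * ½^ i ≤ ε)
  small = geometric→0 (B + 1ℚ) ε 0<ε

√_ : ℝ⁺ → ℝ⁺
√ x = record
  { real = record
    { approx = λ i → √hi (q i) i
    ; cauchy = root-cauchy q (λ i → √lo (q i) i) (λ i → width (q i) i)
                 0≤lo 0≤w (λ i → proj₁ (proj₂ (√-bounds (0≤q i) i))) q≤hi²
                 (width→0 q (cauchy (real x))) (cauchy (real x))
    }
  ; away = root-away q (λ i → √hi (q i) i) (λ i → +-mono-≤ (0≤lo i) (0≤w i)) q≤hi² (away x)
  }
  where
  q : Seq
  q = approx (real x)
  0≤q : ∀ i → 0ℚ ≤ q i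
  0≤q i = <⇒≤ (positive-approx x i)
  0≤lo : ∀ i → 0ℚ ≤ √lo (q i) i
  0≤lo i = proj₁ (√-bounds (0≤q i) i)
  0≤w : ∀ i → 0ℚ ≤ width (q i) i
  0≤w i = width-nonNeg (0≤q i) i
  q≤hi² : ∀ i → q i ≤ √hi (q i) i * √hi (q i) i
  q≤hi² i = proj₂ (proj₂ (√-bounds (0≤q i) i))

sum≤ : Seq → Seq
sum≤ a zero    = a 0
sum≤ a (suc n) = sum≤ a n + a (suc n)

ratio-cauchy : ∀ (a : Seq) N → (∀ i → 0ℚ ≤ a i) → (∀ i → N ℕ.≤ i → a (suc i) ≤ ½ * a i) →
  Cauchy (sum≤ a)
ratio-cauchy a N 0≤a halve = squeeze-cauchy (sum≤ a) a N 0≤a a→0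
  (λ i _ → ≤-+ʳ (0≤a (suc i)))
  (λ i N≤i → begin
    sum≤ a i + a (suc i) + a (suc i)     ≡⟨ +-assoc (sum≤ a i) (a (suc i)) (a (suc i)) ⟩
    sum≤ a i + (a (suc i) + a (suc i))
      ≤⟨ +-monoʳ-≤ (sum≤ a i) (+-mono-≤ (halve i N≤i) (halve i N≤i)) ⟩
    sum≤ a i + (½ * a i + ½ * a i)       ≡⟨ cong (λ p → sum≤ a i + p) (½+½ (a i)) ⟩
    sum≤ a i + a i                       ∎)
  where
  open ≤-Reasoning
  open +-*-Solver
  decay : ∀ d → a (d ℕ.+ N) ≤ a N * ½^ d
  decay zero    = ≤-reflexive (sym (*-identityʳ (a N)))
  decay (suc d) = begin
    a (suc (d ℕ.+ N))     ≤⟨ halve (d ℕ.+ N) (ℕ.m≤n+m N d) ⟩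
    ½ * a (d ℕ.+ N)       ≤⟨ *-monoˡ-≤-nonNeg ½ (decay d) ⟩
    ½ * (a N * ½^ d)      ≡⟨ solve 3 (λ h p x → h :* (p :* x) := p :* (h :* x)) refl ½ (a N) (½^ d) ⟩
    a N * (½ * ½^ d)      ∎

  a→0 : ∀ ε → 0ℚ < ε → ∃[ M ] (∀ i → M ℕ.≤ i → a i ≤ ε)
  a→0 ε 0<ε = M ℕ.+ N , λ i M+N≤i → begin
    a i                       ≡⟨ cong a (ℕ.m∸n+n≡m (ℕ.m+n≤o⇒n≤o M M+N≤i)) ⟨
    a (i ℕ.∸ N ℕ.+ N)         ≤⟨ decay (i ℕ.∸ N) ⟩
    a N * ½^ (i ℕ.∸ N)        ≤⟨ small (i ℕ.∸ N) (ℕ.m+n≤o⇒m≤o∸n M M+N≤i) ⟩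
    ε                         ∎
    where
    M : ℕ
    M = proj₁ (geometric→0 (a N) ε 0<ε)
    small : ∀ i → M ℕ.≤ i → a N * ½^ i ≤ ε
    small = proj₂ (geometric→0 (a N) ε 0<ε)

exp-term : ℕ → ℕ → ℚ
exp-term m i = (+ (m ℕ.^ i) / i !) {{i ℕ.!≢0}}

exp-term-nonNeg : ∀ m i → 0ℚ ≤ exp-term m i
exp-term-nonNeg m i = nonNegative⁻¹ _ {{normalize-nonNeg (m ℕ.^ i) (i !) {{i ℕ.!≢0}}}}

exp-term-halves : ∀ m i → m ℕ.+ m ℕ.≤ i → exp-term m (suc i) ≤ ½ * exp-term m i
exp-term-halves m i 2m≤i = *-cancelʳ-≤-pos (ι (suc i !)) {{ι-pos (suc i !) {{suc i ℕ.!≢0}}}} (begin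
  exp-term m (suc i) * ι (suc i !)          ≡⟨ /-ι (m ℕ.^ suc i) (suc i !) {{suc i ℕ.!≢0}} ⟩
  ι (m ℕ.* m ℕ.^ i)                         ≡⟨ ι-* m (m ℕ.^ i) ⟩
  ι m * ι (m ℕ.^ i)
    ≤⟨ *-monoʳ-≤-nonNeg (ι (m ℕ.^ i)) {{ι-nonNeg (m ℕ.^ i)}} m≤½[1+i] ⟩
  ½ * ι (suc i) * ι (m ℕ.^ i)
    ≡⟨ cong (λ p → ½ * ι (suc i) * p) (/-ι (m ℕ.^ i) (i !) {{i ℕ.!≢0}}) ⟨
  ½ * ι (suc i) * (exp-term m i * ι (i !))
    ≡⟨ solve 4 (λ h a t f → (h :* a) :* (t :* f) := (h :* t) :* (a :* f))
         refl ½ (ι (suc i)) (exp-term m i) (ι (i !)) ⟩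
  ½ * exp-term m i * (ι (suc i) * ι (i !))  ≡⟨ cong (λ p → ½ * exp-term m i * p) (ι-* (suc i) (i !)) ⟨
  ½ * exp-term m i * ι (suc i !)            ∎)
  where
  open ≤-Reasoning
  open +-*-Solver
  m≤½[1+i] : ι m ≤ ½ * ι (suc i)
  m≤½[1+i] = begin
    ι m                   ≡⟨ ½+½ (ι m) ⟨
    ½ * ι m + ½ * ι m     ≡⟨ *-distribˡ-+ ½ (ι m) (ι m) ⟨
    ½ * (ι m + ι m)       ≡⟨ cong (½ *_) (ι-+ m m) ⟨
    ½ * ι (m ℕ.+ m)       ≤⟨ *-monoˡ-≤-nonNeg ½ (ι-mono (ℕ.m≤n⇒m≤1+n 2m≤i)) ⟩
    ½ * ι (suc i)         ∎

exp : ℕ → ℝ⁺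
exp m = record
  { real = record
    { approx = sum≤ (exp-term m)
    ; cauchy = ratio-cauchy (exp-term m) (m ℕ.+ m) (exp-term-nonNeg m) (exp-term-halves m)
    }
  ; away = 1ℚ , positive⁻¹ 1ℚ , 1≤sum
  }
  where
  1≤sum : ∀ n → 1ℚ ≤ sum≤ (exp-term m) n
  1≤sum zero    = ≤-refl
  1≤sum (suc n) = ≤-trans (1≤sum n) (≤-+ʳ (exp-term-nonNeg m (suc n)))

harmonic : ℕ → ℕ → ℚ
harmonic m zero    = 0ℚ
harmonic m (suc l) = harmonic m l + + 1 / suc (m ℕ.+ l)

unit : ℕ → ℚ
unit a = + 1 / suc a

unit-nonNeg : ∀ a → 0ℚ ≤ unit a
unit-nonNeg a = nonNegative⁻¹ _ {{normalize-nonNeg 1 (suc a)}}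

unit-anti : ∀ {a b} → a ℕ.≤ b → unit b ≤ unit a
unit-anti {a} {b} a≤b = *-cancelʳ-≤-pos (ι (suc a)) {{ι-pos (suc a)}} (begin
  unit b * ι (suc a)
    ≤⟨ *-monoˡ-≤-nonNeg (unit b) {{nonNegative (unit-nonNeg b)}} (ι-mono (ℕ.s≤s a≤b)) ⟩
  unit b * ι (suc b)   ≡⟨ /-ι 1 (suc b) ⟩
  1ℚ                   ≡⟨ /-ι 1 (suc a) ⟨
  unit a * ι (suc a)   ∎)
  where open ≤-Reasoning

unit-double : ∀ a → unit (suc (a ℕ.+ a)) + unit (suc (a ℕ.+ a)) ≡ unit a
unit-double a = trans (cong₂ _+_ eq eq) (½+½ (unit a))
  where
  open ≡-Reasoning
  open +-*-Solver
  b : ℕ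
  b = suc (a ℕ.+ a)
  2a : ι (suc b) ≡ ι (suc a) + ι (suc a)
  2a = trans (cong (λ n → ι (suc n)) (sym (ℕ.+-suc a a))) (ι-+ (suc a) (suc a))
  eq : unit b ≡ ½ * unit a
  eq = begin
    unit b                                     ≡⟨ *-identityʳ (unit b) ⟨
    unit b * 1ℚ                                ≡⟨ cong (unit b *_) (/-ι 1 (suc a)) ⟨
    unit b * (unit a * ι (suc a))              ≡⟨ cong (λ p → unit b * (unit a * p)) (½+½ (ι (suc a))) ⟨
    unit b * (unit a * (½ * ι (suc a) + ½ * ι (suc a)))
      ≡⟨ solve 4 (λ x y h z → x :* (y :* (h :* z :+ h :* z)) := (h :* y) :* (x :* (z :+ z)))
           refl (unit b) (unit a) ½ (ι (suc a)) ⟩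
    ½ * unit a * (unit b * (ι (suc a) + ι (suc a)))  ≡⟨ cong (λ p → ½ * unit a * (unit b * p)) 2a ⟨
    ½ * unit a * (unit b * ι (suc b))          ≡⟨ cong (½ * unit a *_) (/-ι 1 (suc b)) ⟩
    ½ * unit a * 1ℚ                            ≡⟨ *-identityʳ (½ * unit a) ⟩
    ½ * unit a                                 ∎

harmonic-double : ∀ m l → harmonic (m ℕ.+ m) (suc l ℕ.+ suc l) ≡
  harmonic (m ℕ.+ m) (l ℕ.+ l) + unit ((m ℕ.+ l) ℕ.+ (m ℕ.+ l)) + unit (suc ((m ℕ.+ l) ℕ.+ (m ℕ.+ l)))
harmonic-double m l = begin
  harmonic (m ℕ.+ m) (suc (l ℕ.+ suc l))
    ≡⟨ cong (λ n → harmonic (m ℕ.+ m) (suc n)) (ℕ.+-suc l l) ⟩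
  harmonic (m ℕ.+ m) (suc (suc (l ℕ.+ l)))
    ≡⟨ cong₂ (λ a b → harmonic (m ℕ.+ m) (l ℕ.+ l) + unit a + unit b) even
         (trans (ℕ.+-suc (m ℕ.+ m) (l ℕ.+ l)) (cong suc even)) ⟩
  _ ∎
  where
  open ≡-Reasoning
  open import Algebra.Properties.CommutativeSemigroup ℕ.+-commutativeSemigroup using (interchange)
  even : (m ℕ.+ m) ℕ.+ (l ℕ.+ l) ≡ (m ℕ.+ l) ℕ.+ (m ℕ.+ l)
  even = interchange m m l l

harmonic-up : ∀ m l → harmonic m l ≤ harmonic (m ℕ.+ m) (l ℕ.+ l)
harmonic-up m zero    = ≤-refl
harmonic-up m (suc l) = begin
  harmonic m l + unit a             ≡⟨ cong (λ p → harmonic m l + p) (unit-double a) ⟨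
  harmonic m l + (unit (suc (a ℕ.+ a)) + unit (suc (a ℕ.+ a)))
    ≤⟨ +-mono-≤ (harmonic-up m l) (+-monoˡ-≤ (unit (suc (a ℕ.+ a))) (unit-anti (ℕ.n≤1+n (a ℕ.+ a)))) ⟩
  harmonic (m ℕ.+ m) (l ℕ.+ l) + (unit (a ℕ.+ a) + unit (suc (a ℕ.+ a)))
    ≡⟨ +-assoc (harmonic (m ℕ.+ m) (l ℕ.+ l)) (unit (a ℕ.+ a)) (unit (suc (a ℕ.+ a))) ⟨
  harmonic (m ℕ.+ m) (l ℕ.+ l) + unit (a ℕ.+ a) + unit (suc (a ℕ.+ a))
    ≡⟨ harmonic-double m l ⟨
  harmonic (m ℕ.+ m) (suc l ℕ.+ suc l) ∎
  where
  open ≤-Reasoning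
  a : ℕ
  a = m ℕ.+ l

harmonic-down : ∀ m l →
  harmonic (m ℕ.+ m) (l ℕ.+ l) + unit (ℕ.pred ((m ℕ.+ l) ℕ.+ (m ℕ.+ l))) ≤
  harmonic m l + unit (ℕ.pred (m ℕ.+ m))
harmonic-down m zero    = ≤-reflexive (cong (λ n → 0ℚ + unit (ℕ.pred (n ℕ.+ n))) (ℕ.+-identityʳ m))
harmonic-down m (suc l) = begin
  harmonic (m ℕ.+ m) (suc l ℕ.+ suc l) + unit (ℕ.pred ((m ℕ.+ suc l) ℕ.+ (m ℕ.+ suc l)))
    ≡⟨ cong₂ _+_ (harmonic-double m l) (cong unit next) ⟩
  H + unit (a ℕ.+ a) + v + v
    ≤⟨ +-monoˡ-≤ v (+-monoˡ-≤ v (+-monoʳ-≤ H (unit-anti (ℕ.pred[n]≤n {a ℕ.+ a})))) ⟩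
  H + unit (ℕ.pred (a ℕ.+ a)) + v + v
    ≡⟨ +-assoc (H + unit (ℕ.pred (a ℕ.+ a))) v v ⟩
  H + unit (ℕ.pred (a ℕ.+ a)) + (v + v)
    ≤⟨ +-monoˡ-≤ (v + v) (harmonic-down m l) ⟩
  harmonic m l + unit (ℕ.pred (m ℕ.+ m)) + (v + v)
    ≡⟨ solve 3 (λ x y z → x :+ y :+ z := x :+ z :+ y) refl
         (harmonic m l) (unit (ℕ.pred (m ℕ.+ m))) (v + v) ⟩
  harmonic m l + (v + v) + unit (ℕ.pred (m ℕ.+ m))
    ≡⟨ cong (λ p → harmonic m l + p + unit (ℕ.pred (m ℕ.+ m))) (unit-double a) ⟩
  harmonic m l + unit a + unit (ℕ.pred (m ℕ.+ m)) ∎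
  where
  open ≤-Reasoning
  open +-*-Solver
  a : ℕ
  a = m ℕ.+ l
  H v : ℚ
  H = harmonic (m ℕ.+ m) (l ℕ.+ l)
  v = unit (suc (a ℕ.+ a))
  next : ℕ.pred ((m ℕ.+ suc l) ℕ.+ (m ℕ.+ suc l)) ≡ suc (a ℕ.+ a)
  next = trans (cong (λ n → ℕ.pred (n ℕ.+ n)) (ℕ.+-suc m l)) (ℕ.+-suc a a)

unit-½^ : ∀ j → unit (ℕ.pred (2 ℕ.^ j)) ≤ ½^ j
unit-½^ zero    = ≤-refl
unit-½^ (suc j) with 2 ℕ.^ j | ℕ.m^n≢0 2 j | unit-½^ j
... | suc p | _ | ih = begin
  unit (p ℕ.+ suc (p ℕ.+ 0))     ≡⟨ cong unit (trans (ℕ.+-suc p (p ℕ.+ 0))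
                                      (cong (λ n → suc (p ℕ.+ n)) (ℕ.+-identityʳ p))) ⟩
  unit (suc (p ℕ.+ p))           ≡⟨ ½+½ _ ⟨
  ½ * unit (suc (p ℕ.+ p)) + ½ * unit (suc (p ℕ.+ p))
    ≡⟨ *-distribˡ-+ ½ (unit (suc (p ℕ.+ p))) (unit (suc (p ℕ.+ p))) ⟨
  ½ * (unit (suc (p ℕ.+ p)) + unit (suc (p ℕ.+ p)))
    ≡⟨ cong (½ *_) (unit-double p) ⟩
  ½ * unit p                     ≤⟨ *-monoˡ-≤-nonNeg ½ ih ⟩
  ½ * ½^ j                       ∎
  where open ≤-Reasoning

-- The lower Riemann sum of ∫₁ⁿ dt/t with mesh 2⁻ʲ.
log-approx : ℕ → Seq
log-approx n j = harmonic (2 ℕ.^ j) ((n ℕ.∸ 1) ℕ.* 2 ℕ.^ j)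

module _ (n : ℕ) where
  private
    m l : ℕ → ℕ
    m j = 2 ℕ.^ j
    l j = (n ℕ.∸ 1) ℕ.* m j

    twice : ∀ x → 2 ℕ.* x ≡ x ℕ.+ x
    twice x = cong (λ y → x ℕ.+ y) (ℕ.+-identityʳ x)

  log-approx-suc : ∀ j → log-approx n (suc j) ≡ harmonic (m j ℕ.+ m j) (l j ℕ.+ l j)
  log-approx-suc j = cong₂ harmonic (twice (m j))
    (trans (cong (λ x → (n ℕ.∸ 1) ℕ.* x) (twice (m j))) (ℕ.*-distribˡ-+ (n ℕ.∸ 1) (m j) (m j)))

  log-approx-up : ∀ j → log-approx n j ≤ log-approx n (suc j)
  log-approx-up j = ≤-trans (harmonic-up (m j) (l j)) (≤-reflexive (sym (log-approx-suc j)))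

  log-approx-down : ∀ j → log-approx n (suc j) + ½^ suc j ≤ log-approx n j + ½^ j
  log-approx-down j = begin
    log-approx n (suc j) + ½^ suc j
      ≡⟨ cong (λ p → p + ½^ suc j) (log-approx-suc j) ⟩
    harmonic (m j ℕ.+ m j) (l j ℕ.+ l j) + ½^ suc j
      ≤⟨ +-monoˡ-≤ (½^ suc j) (≤-trans (≤-+ʳ {harmonic (m j ℕ.+ m j) (l j ℕ.+ l j)}
           (unit-nonNeg (ℕ.pred ((m j ℕ.+ l j) ℕ.+ (m j ℕ.+ l j)))))
           (harmonic-down (m j) (l j))) ⟩
    log-approx n j + unit (ℕ.pred (m j ℕ.+ m j)) + ½^ suc j
      ≤⟨ +-monoˡ-≤ (½^ suc j) (+-monoʳ-≤ (log-approx n j)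
           (subst (λ x → unit (ℕ.pred x) ≤ ½^ suc j) (twice (m j)) (unit-½^ (suc j)))) ⟩
    log-approx n j + ½^ suc j + ½^ suc j
      ≡⟨ +-assoc (log-approx n j) (½^ suc j) (½^ suc j) ⟩
    log-approx n j + (½ * ½^ j + ½ * ½^ j)
      ≡⟨ cong (λ p → log-approx n j + p) (½+½ (½^ j)) ⟩
    log-approx n j + ½^ j ∎
    where open ≤-Reasoning

  log-cauchy : Cauchy (log-approx n)
  log-cauchy = squeeze-cauchy (log-approx n) ½^_ 0 (λ i → <⇒≤ (½^-pos i))
    (λ ε 0<ε → proj₁ (geometric→0 1ℚ ε 0<ε) , λ i N≤i →
      ≤-trans (≤-reflexive (sym (*-identityˡ (½^ i)))) (proj₂ (geometric→0 1ℚ ε 0<ε) i N≤i))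
    (λ j _ → log-approx-up j) (λ j _ → log-approx-down j)

½≤log-approx : ∀ n → .{{NonTrivial n}} → ∀ j → ½ ≤ log-approx n j
½≤log-approx n (suc j) = ≤-trans (½≤log-approx n j) (log-approx-up n j)
½≤log-approx (suc (suc n)) zero = ½≤harmonic (n ℕ.* 1)
  where
  ½≤harmonic : ∀ l → ½ ≤ harmonic 1 (suc l)
  ½≤harmonic zero    = ≤ᵇ⇒≤ _
  ½≤harmonic (suc l) = ≤-trans (½≤harmonic l) (≤-+ʳ (unit-nonNeg (suc (suc l))))

log : (n : ℕ) → .{{NonTrivial n}} → ℝ⁺
log n = record
  { real = record { approx = log-approx n ; cauchy = log-cauchy n }
  ; away = ½ , positive⁻¹ ½ , ½≤log-approx n
  }

module _ (n k : ℕ) (2≤k : 2 ℕ.≤ k) (2k≤n : 2 ℕ.* k ℕ.≤ n) where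
  private
    instance
      k≢0 : ℕ.NonZero k
      k≢0 = ℕ.>-nonZero (ℕ.≤-trans (ℕ.s≤s ℕ.z≤n) 2≤k)

      n>1 : NonTrivial n
      n>1 = ℕ.n>1⇒nonTrivial (ℕ.≤-trans 2≤k (ℕ.≤-trans (ℕ.m≤n*m k 2) 2k≤n))

      n≢0 : ℕ.NonZero n
      n≢0 = ℕ.nonTrivial⇒nonZero n

      n²≢0 : ℕ.NonZero (n ℕ.^ 2)
      n²≢0 = ℕ.m^n≢0 n 2

  maxRadius : ℝ⁺
  maxRadius = √ (fromℕ⁺ n ∕ (fromℕ⁺ 64 · exp 6 · fromℕ⁺ k))

  rate : ℝ⁺
  rate = fromℕ⁺ n ∕ ((√ fromℕ⁺ k) · (log n · log n))

  failure : ℚ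
  failure = ½^ (k ℕ.∸ 1) ⊔ + 2 / n ℕ.^ 2

Dist : Set → Set
Dist A = List (A × ℚ)

private
  variable
    A B : Set
    m : ℕ

pure : A → Dist A
pure x = (x , 1ℚ) ∷ []

infixl 1 _>>=_

_>>=_ : Dist A → (A → Dist B) → Dist B
d >>= f = concatMap (λ (x , p) → map (λ (y , q) → y , p * q) (f x)) d

uniform : List A → Dist A
uniform []          = []
uniform xs@(_ ∷ _)  = map (λ x → x , + 1 / length xs) xs

independent : Vec (Dist A) m → Dist (Vec A m)
independent []       = pure []
independent (d ∷ ds) = d >>= λ x → independent ds >>= λ xs → pure (x ∷ xs)

Pr : Dist A → (A → Bool) → ℚ
Pr d D = foldr _+_ 0ℚ (map proj₂ (filterᵇ (λ (x , _) → D x) d))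

Node : ℕ → Set
Node s = Fin s × Fin s

manhattan : ∀ {s} → Node s → Node s → ℕ
manhattan (x , y) (x′ , y′) = ∣ toℕ x - toℕ x′ ∣ ℕ.+ ∣ toℕ y - toℕ y′ ∣

nodes : ∀ s → List (Node s)
nodes s = cartesianProduct (allFin s) (allFin s)

neighbours : ∀ {s} → Node s → List (Node s)
neighbours v = filter (λ w → manhattan v w ℕ.≟ 1) (nodes _)

step : ∀ {s} → Node s → Dist (Node s)
step v = (v , 1ℚ - + length (neighbours v) / 5) ∷ map (λ w → w , + 1 / 5) (neighbours v)

module _ (s k : ℕ) where

  Config : Set
  Config = Vec (Node s) k

  -- Most recent configuration first.
  walk : ∀ t → Dist (Vec Config (suc t))
  walk zero    = independent (replicate k (uniform (nodes s))) >>= λ c → pure (c ∷ [])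
  walk (suc t) = walk t >>= λ cs → independent (Vec.map step (head cs)) >>= λ c → pure (c ∷ cs)

  Path : Set
  Path = ℕ → Config

  history : Path → ∀ t → Vec Config (suc t)
  history ω zero    = ω 0 ∷ []
  history ω (suc t) = ω (suc t) ∷ history ω t

  -- E contains a cylinder set of probability at least p. For an event determined
  -- by finitely many steps, such as a lower bound on the broadcast time, this says
  -- that P(E) ≥ p.
  HasProbability≥ : Pred Path 0ℓ → ℚ → Set
  HasProbability≥ E p = ∃[ t ] Σ (Vec Config (suc t) → Bool) λ D →
    p ≤ Pr (walk t) D × (∀ ω → T (D (history ω t)) → E ω)

module _ {s k : ℕ} (r : ℕ) (ω : Path s k) where

  Agent : Set
  Agent = Fin k

  Visible : ℕ → Rel Agent 0ℓ
  Visible t a b = manhattan (lookup (ω t) a) (lookup (ω t) b) ℕ.≤ r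

  -- Nothing is exchanged at time 0; the first exchange uses the visibility graph at time 1.
  rumours : ∀ {R : Set} → (Agent → Pred R 0ℓ) → ℕ → Agent → Pred R 0ℓ
  rumours M₀ zero    a m = M₀ a m
  rumours M₀ (suc t) a m = ∃[ b ] (Star (Visible (suc t)) a b × rumours M₀ t b m)

  -- ⊤ is the set whose only element is the single rumour.
  knownBy : Agent → Agent → Pred ⊤ 0ℓ
  knownBy source a _ = a ≡ source

  AllInformed : Agent → ℕ → Set
  AllInformed source t = ∀ a → rumours (knownBy source) t a tt

  IsBroadcastTime : Agent → ℕ → Set
  IsBroadcastTime source t = AllInformed source t × (∀ t′ → t′ ℕ.< t → ¬ AllInformed source t′)

  -- The broadcast time is ∞ on paths along which some agent is never informed.
  BroadcastTime≥ : Agent → ℝ → Set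
  BroadcastTime≥ source x = ∀ t → IsBroadcastTime source t → x ≤ᴿ fromℕ t

module Submission where

-- Since the step distribution is symmetric, at every time the agents are independent and
-- uniform on the grid. Link two agents when they are within γ = Θ(√(n/k)) of each other, call
-- the components of this graph islands, and cut time into phases so short that, with high
-- probability, no agent moves further than γ/3 during a phase; then two agents that see each
-- other during a phase are linked at its end. A union bound over the loop-free paths shows
-- that islands have diameter O(γ log n), so that each phase extends the informed region by
-- O(γ log n), whereas with probability at least 1 - 4^-(k-1) some agent starts at distance
-- Θ(√n) from the source.
--
-- If √k = O(log n), a single phase is long enough: all agents would have to form one island,
-- so that each of them would have a neighbour, which has probability at most 2 · 4^-k. If
-- γ = O(log n), phases of length γ/3 (or, when r = 0, of length 1 and without any islands)
-- suffice, because an agent makes at most one move per step.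
--
-- The errors add up to at most 4^-(k-1) + n^-2, which is at most the mean of 2^-(k-1) and
-- 2/n², and therefore at most their maximum.

open import Data.Bool using (Bool; true; false; T; not; _∨_; if_then_else_)
open import Data.Fin using (Fin; zero; suc; toℕ; fromℕ<; punchIn)
import Data.Fin.Properties as Fin
import Data.Integer as ℤ
open import Data.Nat using (ℕ; zero; suc)
import Data.Nat as ℕ
import Data.Nat.Properties as ℕ
open import Data.Product using (∃-syntax; _×_; _,_; proj₁; proj₂)
open import Data.Sum using (_⊎_; inj₁; inj₂)
open import Data.Unit using (tt)
open import Function using (_∘_; _|>_)
open import Level using (0ℓ)
open import Relation.Binary.PropositionalEquality
  using (_≡_; _≢_; refl; sym; ≢-sym; trans; cong; cong₂; subst; module ≡-Reasoning)
open import Relation.Nullary using (Dec; does; yes; no; ¬_; contradiction)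
open import Relation.Unary using (Pred; Decidable)

-- The rate is a product of two scales. Deviations beyond γ/3 must be polynomially unlikely, so a
-- phase has only L = Θ(γ²/log n) steps; an island may span γ log n, so only P = Θ(√n/(γ log n))
-- phases fit before the rumor can have covered the distance. Hence P L = Θ(γ√n/log² n) = Θ(n/(√k
-- log² n)), and each logarithm is paid once. The obstacle is that every step brings a new
-- visibility graph. Linking agents at the larger distance γ replaces all the graphs of a phase by a
-- single one, taken at its end. Its expected degree is at most 1/64 once γ ≥ 2, which makes long
-- paths, and also the absence of isolated agents, improbable. The special cases are those in which
-- a scale rounds to zero. If √k is below log n, the bound on a single island may exceed the
-- distance, so that P could be 0; if γ is of order log n, so is the unit q = γ/(36 G) in which the
-- moves of a phase are measured.

-- Powers of rationals and inequalities of Bernoulli type.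

module Powers where
  open import Defs
  open import Data.Rational
  open import Data.Rational.Properties
  open import Data.Rational.Solver using (module +-*-Solver)

  0≤* : ∀ p q → 0ℚ ≤ p → 0ℚ ≤ q → 0ℚ ≤ p * q
  0≤* p q = *-nonNeg {p} {q}

  0≤+ : ∀ {p q} → 0ℚ ≤ p → 0ℚ ≤ q → 0ℚ ≤ p + q
  0≤+ {p} {q} 0≤p 0≤q = ≤-trans (≤-reflexive (sym (+-identityˡ 0ℚ))) (+-mono-≤ 0≤p 0≤q)

  *-monoˡ : ∀ p {q r} → 0ℚ ≤ p → q ≤ r → p * q ≤ p * r
  *-monoˡ p 0≤p = *-monoˡ-≤-nonNeg p {{nonNegative 0≤p}}

  *-monoʳ : ∀ p {q r} → 0ℚ ≤ p → q ≤ r → q * p ≤ r * p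
  *-monoʳ p 0≤p = *-monoʳ-≤-nonNeg p {{nonNegative 0≤p}}

  0≤ι : ∀ n → 0ℚ ≤ ι n
  0≤ι n = nonNegative⁻¹ (ι n) {{ι-nonNeg n}}

  0≤1 : 0ℚ ≤ 1ℚ
  0≤1 = nonNegative⁻¹ 1ℚ

  infixr 8 _**_

  _**_ : ℚ → ℕ → ℚ
  p ** zero  = 1ℚ
  p ** suc n = p * p ** n

  **-+ : ∀ p m n → p ** (m ℕ.+ n) ≡ p ** m * p ** n
  **-+ p zero    n = sym (*-identityˡ (p ** n))
  **-+ p (suc m) n = trans (cong (p *_) (**-+ p m n)) (sym (*-assoc p (p ** m) (p ** n)))

  **-* : ∀ p m n → p ** (m ℕ.* n) ≡ (p ** n) ** m
  **-* p zero    n = refl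
  **-* p (suc m) n = trans (**-+ p n (m ℕ.* n)) (cong (p ** n *_) (**-* p m n))

  *-** : ∀ p q n → (p * q) ** n ≡ p ** n * q ** n
  *-** p q zero    = refl
  *-** p q (suc n) = trans (cong (p * q *_) (*-** p q n))
    (solve 4 (λ a b c d → a :* b :* (c :* d) := a :* c :* (b :* d)) refl p q (p ** n) (q ** n))
    where open +-*-Solver

  1**n≡1 : ∀ n → 1ℚ ** n ≡ 1ℚ
  1**n≡1 zero    = refl
  1**n≡1 (suc n) = trans (*-identityˡ (1ℚ ** n)) (1**n≡1 n)

  0≤** : ∀ {p} → 0ℚ ≤ p → ∀ n → 0ℚ ≤ p ** n
  0≤** 0≤p zero    = 0≤1
  0≤** {p} 0≤p (suc n) = 0≤* p (p ** n) 0≤p (0≤** 0≤p n)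

  **-monoˡ : ∀ {p q} → 0ℚ ≤ p → p ≤ q → ∀ n → p ** n ≤ q ** n
  **-monoˡ 0≤p p≤q zero    = ≤-refl
  **-monoˡ 0≤p p≤q (suc n) = *-mono-≤-nonNeg 0≤p (0≤** (≤-trans 0≤p p≤q) n) p≤q (**-monoˡ 0≤p p≤q n)

  1≤** : ∀ {p} → 1ℚ ≤ p → ∀ n → 1ℚ ≤ p ** n
  1≤** {p} 1≤p n = subst (_≤ p ** n) (1**n≡1 n) (**-monoˡ 0≤1 1≤p n)

  **≤1 : ∀ {p} → 0ℚ ≤ p → p ≤ 1ℚ → ∀ n → p ** n ≤ 1ℚ
  **≤1 {p} 0≤p p≤1 n = subst (p ** n ≤_) (1**n≡1 n) (**-monoˡ 0≤p p≤1 n)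

  **-monoʳ : ∀ {p} → 1ℚ ≤ p → ∀ {m n} → m ℕ.≤ n → p ** m ≤ p ** n
  **-monoʳ {p} 1≤p {m} {n} m≤n = begin
    p ** m  ≡⟨ *-identityʳ (p ** m) ⟨
    p ** m * 1ℚ  ≤⟨ *-monoˡ (p ** m) 0≤pᵐ (1≤** 1≤p (n ℕ.∸ m)) ⟩
    p ** m * p ** (n ℕ.∸ m)      ≡⟨ **-+ p m (n ℕ.∸ m) ⟨
    p ** (m ℕ.+ (n ℕ.∸ m))       ≡⟨ cong (p **_) (ℕ.m+[n∸m]≡n m≤n) ⟩
    p ** n  ∎
    where
    open ≤-Reasoning
    0≤pᵐ : 0ℚ ≤ p ** m
    0≤pᵐ = 0≤** (≤-trans 0≤1 1≤p) m

  ι-^ : ∀ m n → ι (m ℕ.^ n) ≡ ι m ** n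
  ι-^ m zero    = refl
  ι-^ m (suc n) = trans (ι-* m (m ℕ.^ n)) (cong (ι m *_) (ι-^ m n))

  ½**≡½^ : ∀ n → ½ ** n ≡ ½^ n
  ½**≡½^ zero    = refl
  ½**≡½^ (suc n) = cong (½ *_) (½**≡½^ n)

  bernoulli : ∀ {u} → 0ℚ ≤ u → ∀ n → 1ℚ + ι n * u ≤ (1ℚ + u) ** n
  bernoulli {u} 0≤u zero    = ≤-reflexive (trans (cong (1ℚ +_) (*-zeroˡ u)) (+-identityʳ 1ℚ))
  bernoulli {u} 0≤u (suc n) = begin
    1ℚ + ι (suc n) * u  ≡⟨ cong (λ z → 1ℚ + z * u) (ι-suc n) ⟩
    1ℚ + (1ℚ + ι n) * u  ≤⟨ ≤-+ʳ {1ℚ + (1ℚ + ι n) * u} (0≤* u (ι n * u) 0≤u (0≤* (ι n) u (0≤ι n) 0≤u)) ⟩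
    1ℚ + (1ℚ + ι n) * u + u * (ι n * u)
      ≡⟨ solve 2 (λ a u → con 1ℚ :+ (con 1ℚ :+ a) :* u :+ u :* (a :* u)
                     := (con 1ℚ :+ u) :* (con 1ℚ :+ a :* u)) refl (ι n) u ⟩
    (1ℚ + u) * (1ℚ + ι n * u)
      ≤⟨ *-monoˡ (1ℚ + u) (0≤+ 0≤1 0≤u) (bernoulli 0≤u n) ⟩
    (1ℚ + u) * (1ℚ + u) ** n       ∎
    where
    open ≤-Reasoning
    open +-*-Solver

  -- A converse of Bernoulli's inequality: while 2nx ≤ 1, the cross term x · 2nx of the induction
  -- step is at most x, and the doubled slope keeps just that much in reserve.
  **≤1+2nx : ∀ {x} → 0ℚ ≤ x → ∀ n → (ι n + ι n) * x ≤ 1ℚ → (1ℚ + x) ** n ≤ 1ℚ + (ι n + ι n) * x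
  **≤1+2nx {x} 0≤x zero    _      = ≤-reflexive (sym (trans (cong (1ℚ +_) (*-zeroˡ x)) (+-identityʳ 1ℚ)))
  **≤1+2nx {x} 0≤x (suc n) 2nx≤1  = begin
    (1ℚ + x) * (1ℚ + x) ** n
      ≤⟨ *-monoˡ (1ℚ + x) (0≤+ 0≤1 0≤x) (**≤1+2nx 0≤x n below) ⟩
    (1ℚ + x) * (1ℚ + (a + a) * x)
      ≡⟨ solve 2 (λ a x → (con 1ℚ :+ x) :* (con 1ℚ :+ (a :+ a) :* x)
                     := con 1ℚ :+ ((a :+ a) :* x :+ x) :+ x :* ((a :+ a) :* x)) refl a x ⟩
    1ℚ + ((a + a) * x + x) + x * ((a + a) * x)
      ≤⟨ +-monoʳ-≤ (1ℚ + ((a + a) * x + x)) (*-monoˡ x 0≤x below) ⟩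
    1ℚ + ((a + a) * x + x) + x * 1ℚ
      ≡⟨ solve 2 (λ a x → con 1ℚ :+ ((a :+ a) :* x :+ x) :+ x :* con 1ℚ
                     := con 1ℚ :+ (con 1ℚ :+ a :+ (con 1ℚ :+ a)) :* x) refl a x ⟩
    1ℚ + (1ℚ + a + (1ℚ + a)) * x   ≡⟨ cong (λ z → 1ℚ + (z + z) * x) (ι-suc n) ⟨
    1ℚ + (ι (suc n) + ι (suc n)) * x ∎
    where
    open ≤-Reasoning
    open +-*-Solver
    a : ℚ
    a = ι n
    n≤1+n : a ≤ ι (suc n)
    n≤1+n = ι-mono (ℕ.n≤1+n n)
    below : (a + a) * x ≤ 1ℚ
    below = ≤-trans (*-monoʳ x 0≤x (+-mono-≤ n≤1+n n≤1+n)) 2nx≤1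

-- Expectations over finite distributions and sums over lists.

module Expectation where
  open import Defs
  open Powers
  open import Data.List using ([]; _∷_; _++_; map; List; length)
  open import Data.List.Relation.Unary.All as All using (All; []; _∷_)
  import Data.List.Relation.Unary.All.Properties as All
  open import Data.Rational
  open import Data.Rational.Properties
  open import Data.Rational.Solver using (module +-*-Solver)
  open import Data.Vec as Vec using (Vec; []; _∷_; lookup; replicate; _[_]≔_)

  private
    variable
      A B : Set
      m : ℕ

  𝟙 : Bool → ℚ
  𝟙 true  = 1ℚ
  𝟙 false = 0ℚ

  0≤𝟙 : ∀ b → 0ℚ ≤ 𝟙 b
  0≤𝟙 true  = 0≤1
  0≤𝟙 false = ≤-refl

  𝟙≤1 : ∀ b → 𝟙 b ≤ 1ℚ
  𝟙≤1 true  = ≤-refl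
  𝟙≤1 false = 0≤1

  𝔼 : Dist A → (A → ℚ) → ℚ
  𝔼 []            f = 0ℚ
  𝔼 ((x , p) ∷ d) f = p * f x + 𝔼 d f

  𝔼-cong : ∀ (d : Dist A) {f g : A → ℚ} → (∀ x → f x ≡ g x) → 𝔼 d f ≡ 𝔼 d g
  𝔼-cong []            f≡g = refl
  𝔼-cong ((x , p) ∷ d) f≡g = cong₂ (λ a b → p * a + b) (f≡g x) (𝔼-cong d f≡g)

  𝔼-++ : ∀ (d e : Dist A) (f : A → ℚ) → 𝔼 (d ++ e) f ≡ 𝔼 d f + 𝔼 e f
  𝔼-++ []            e f = sym (+-identityˡ (𝔼 e f))
  𝔼-++ ((x , p) ∷ d) e f = trans (cong (p * f x +_) (𝔼-++ d e f)) (sym (+-assoc (p * f x) _ _))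

  𝔼-0 : ∀ (d : Dist A) → 𝔼 d (λ _ → 0ℚ) ≡ 0ℚ
  𝔼-0 []            = refl
  𝔼-0 ((x , p) ∷ d) = trans (cong₂ _+_ (*-zeroʳ p) (𝔼-0 d)) (+-identityʳ 0ℚ)

  𝔼-+ : ∀ (d : Dist A) (f g : A → ℚ) → 𝔼 d (λ x → f x + g x) ≡ 𝔼 d f + 𝔼 d g
  𝔼-+ []            f g = sym (+-identityʳ 0ℚ)
  𝔼-+ ((x , p) ∷ d) f g = trans (cong (p * (f x + g x) +_) (𝔼-+ d f g))
    (solve 5 (λ p a b c d → p :* (a :+ b) :+ (c :+ d) := (p :* a :+ c) :+ (p :* b :+ d))
      refl p (f x) (g x) (𝔼 d f) (𝔼 d g))
    where open +-*-Solver

  𝔼-*ˡ : ∀ (d : Dist A) c (f : A → ℚ) → 𝔼 d (λ x → c * f x) ≡ c * 𝔼 d f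
  𝔼-*ˡ []            c f = sym (*-zeroʳ c)
  𝔼-*ˡ ((x , p) ∷ d) c f = trans (cong (p * (c * f x) +_) (𝔼-*ˡ d c f))
    (solve 4 (λ p c a b → p :* (c :* a) :+ c :* b := c :* (p :* a :+ b)) refl p c (f x) (𝔼 d f))
    where open +-*-Solver

  𝔼-*ʳ : ∀ (d : Dist A) c (f : A → ℚ) → 𝔼 d (λ x → f x * c) ≡ 𝔼 d f * c
  𝔼-*ʳ d c f = trans (𝔼-cong d (λ x → *-comm (f x) c)) (trans (𝔼-*ˡ d c f) (*-comm c (𝔼 d f)))

  𝔼-reweight : ∀ (d : Dist A) p (f : A → ℚ) → 𝔼 (map (λ (y , q) → y , p * q) d) f ≡ p * 𝔼 d f
  𝔼-reweight []            p f = sym (*-zeroʳ p)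
  𝔼-reweight ((y , q) ∷ d) p f = trans (cong (p * q * f y +_) (𝔼-reweight d p f))
    (solve 4 (λ p q a b → p :* q :* a :+ p :* b := p :* (q :* a :+ b)) refl p q (f y) (𝔼 d f))
    where open +-*-Solver

  𝔼->>= : ∀ (d : Dist A) (K : A → Dist B) (f : B → ℚ) → 𝔼 (d >>= K) f ≡ 𝔼 d (λ x → 𝔼 (K x) f)
  𝔼->>= []            K f = refl
  𝔼->>= ((x , p) ∷ d) K f = trans (𝔼-++ (map (λ (y , q) → y , p * q) (K x)) (d >>= K) f)
    (cong₂ _+_ (𝔼-reweight (K x) p f) (𝔼->>= d K f))

  𝔼-pure : ∀ (x : A) (f : A → ℚ) → 𝔼 (pure x) f ≡ f x
  𝔼-pure x f = trans (+-identityʳ (1ℚ * f x)) (*-identityˡ (f x))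

  𝔼-swap : ∀ (d : Dist A) (e : Dist B) (f : A → B → ℚ) →
    𝔼 d (λ x → 𝔼 e (f x)) ≡ 𝔼 e (λ y → 𝔼 d (λ x → f x y))
  𝔼-swap []            e f = sym (𝔼-0 e)
  𝔼-swap ((x , p) ∷ d) e f = begin
    p * 𝔼 e (f x) + 𝔼 d (λ x → 𝔼 e (f x))
      ≡⟨ cong₂ _+_ (sym (𝔼-*ˡ e p (f x))) (𝔼-swap d e f) ⟩
    𝔼 e (λ y → p * f x y) + 𝔼 e (λ y → 𝔼 d (λ x → f x y))
      ≡⟨ 𝔼-+ e _ _ ⟨
    𝔼 e (λ y → p * f x y + 𝔼 d (λ x → f x y)) ∎
    where open ≡-Reasoning

  record IsProbability (d : Dist A) : Set where
    field
      weights-nonNeg : All (λ (_ , p) → 0ℚ ≤ p) d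
      mass           : 𝔼 d (λ _ → 1ℚ) ≡ 1ℚ

  open IsProbability public

  module _ {d : Dist A} (prob : IsProbability d) where

    𝔼-mono : ∀ {f g : A → ℚ} → (∀ x → f x ≤ g x) → 𝔼 d f ≤ 𝔼 d g
    𝔼-mono {f} {g} f≤g = go (weights-nonNeg prob)
      where
      go : ∀ {d} → All (λ (_ , p) → 0ℚ ≤ p) d → 𝔼 d f ≤ 𝔼 d g
      go []                            = ≤-refl
      go (_∷_ {x = (x , p)} 0≤p 0≤d) =
        +-mono-≤ (*-monoˡ p 0≤p (f≤g x)) (go 0≤d)

    𝔼-const : ∀ c → 𝔼 d (λ _ → c) ≡ c
    𝔼-const c = begin
      𝔼 d (λ _ → c)        ≡⟨ 𝔼-cong d (λ _ → sym (*-identityʳ c)) ⟩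
      𝔼 d (λ _ → c * 1ℚ)   ≡⟨ 𝔼-*ˡ d c (λ _ → 1ℚ) ⟩
      c * 𝔼 d (λ _ → 1ℚ)   ≡⟨ cong (c *_) (mass prob) ⟩
      c * 1ℚ  ≡⟨ *-identityʳ c ⟩
      c  ∎
      where open ≡-Reasoning

    𝔼-≤const : ∀ {f : A → ℚ} {c} → (∀ x → f x ≤ c) → 𝔼 d f ≤ c
    𝔼-≤const {c = c} f≤c = ≤-trans (𝔼-mono f≤c) (≤-reflexive (𝔼-const c))

    0≤𝔼 : ∀ {f : A → ℚ} → (∀ x → 0ℚ ≤ f x) → 0ℚ ≤ 𝔼 d f
    0≤𝔼 0≤f = ≤-trans (≤-reflexive (sym (𝔼-const 0ℚ))) (𝔼-mono 0≤f)

  pure-isProbability : ∀ (x : A) → IsProbability (pure x)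
  pure-isProbability x = record { weights-nonNeg = 0≤1 ∷ [] ; mass = 𝔼-pure x (λ _ → 1ℚ) }

  >>=-isProbability : ∀ {d : Dist A} {K : A → Dist B} →
    IsProbability d → (∀ x → IsProbability (K x)) → IsProbability (d >>= K)
  >>=-isProbability {d = d} {K} dP KP = record
    { weights-nonNeg = go (weights-nonNeg dP)
    ; mass   = trans (𝔼->>= d K (λ _ → 1ℚ)) (trans (𝔼-cong d (λ x → mass (KP x))) (mass dP))
    }
    where
    go : ∀ {d} → All (λ (_ , p) → 0ℚ ≤ p) d → All (λ (_ , p) → 0ℚ ≤ p) (d >>= K)
    go []                            = []
    go (_∷_ {x = (x , p)} 0≤p 0≤d) =
      All.++⁺ (All.map⁺ (All.map (λ {(_ , q)} → 0≤* p q 0≤p) (weights-nonNeg (KP x)))) (go 0≤d)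

  Pr≡𝔼 : ∀ (d : Dist A) (D : A → Bool) → Pr d D ≡ 𝔼 d (𝟙 ∘ D)
  Pr≡𝔼 []            D = refl
  Pr≡𝔼 ((x , p) ∷ d) D with D x
  ... | true  = cong₂ _+_ (sym (*-identityʳ p)) (Pr≡𝔼 d D)
  ... | false = trans (Pr≡𝔼 d D) (sym (trans (cong (_+ 𝔼 d (𝟙 ∘ D)) (*-zeroʳ p)) (+-identityˡ _)))

  -- `𝔼` does not presuppose total mass 1, so sums are expectations with unit weights and inherit
  -- linearity and exchange of order.
  ∑ : List A → (A → ℚ) → ℚ
  ∑ xs f = 𝔼 (map (λ x → x , 1ℚ) xs) f

  ∑-∷ : ∀ (x : A) xs f → ∑ (x ∷ xs) f ≡ f x + ∑ xs f
  ∑-∷ x xs f = cong (_+ ∑ xs f) (*-identityˡ (f x))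

  ∑-++ : ∀ (xs ys : List A) f → ∑ (xs ++ ys) f ≡ ∑ xs f + ∑ ys f
  ∑-++ []       ys f = sym (+-identityˡ _)
  ∑-++ (x ∷ xs) ys f = trans (cong (1ℚ * f x +_) (∑-++ xs ys f)) (sym (+-assoc (1ℚ * f x) _ _))

  ∑-mono : ∀ (xs : List A) {f g : A → ℚ} → (∀ x → f x ≤ g x) → ∑ xs f ≤ ∑ xs g
  ∑-mono []       f≤g = ≤-refl
  ∑-mono (x ∷ xs) f≤g = +-mono-≤ (*-monoˡ-≤-nonNeg 1ℚ (f≤g x)) (∑-mono xs f≤g)

  ∑-map : ∀ (h : A → B) xs f → ∑ (map h xs) f ≡ ∑ xs (f ∘ h)
  ∑-map h []       f = refl
  ∑-map h (x ∷ xs) f = cong (1ℚ * f (h x) +_) (∑-map h xs f)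

  private
    weigh : List A → Dist A
    weigh = map (λ x → x , 1ℚ)

  ∑-cong : ∀ (xs : List A) {f g : A → ℚ} → (∀ x → f x ≡ g x) → ∑ xs f ≡ ∑ xs g
  ∑-cong xs = 𝔼-cong (weigh xs)

  ∑-0 : ∀ (xs : List A) → ∑ xs (λ _ → 0ℚ) ≡ 0ℚ
  ∑-0 xs = 𝔼-0 (weigh xs)

  ∑-+ : ∀ (xs : List A) f g → ∑ xs (λ x → f x + g x) ≡ ∑ xs f + ∑ xs g
  ∑-+ xs = 𝔼-+ (weigh xs)

  ∑-*ˡ : ∀ (xs : List A) c f → ∑ xs (λ x → c * f x) ≡ c * ∑ xs f
  ∑-*ˡ xs = 𝔼-*ˡ (weigh xs)

  ∑-*ʳ : ∀ (xs : List A) c f → ∑ xs (λ x → f x * c) ≡ ∑ xs f * c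
  ∑-*ʳ xs = 𝔼-*ʳ (weigh xs)

  ∑-swap : ∀ (xs : List A) (ys : List B) f →
    ∑ xs (λ x → ∑ ys (f x)) ≡ ∑ ys (λ y → ∑ xs (λ x → f x y))
  ∑-swap xs ys = 𝔼-swap (weigh xs) (weigh ys)

  ∑-const : ∀ (xs : List A) c → ∑ xs (λ _ → c) ≡ ι (length xs) * c
  ∑-const []       c = sym (*-zeroˡ c)
  ∑-const (x ∷ xs) c = begin
    1ℚ * c + ∑ xs (λ _ → c)       ≡⟨ cong (1ℚ * c +_) (∑-const xs c) ⟩
    1ℚ * c + ι (length xs) * c    ≡⟨ *-distribʳ-+ c 1ℚ (ι (length xs)) ⟨
    (1ℚ + ι (length xs)) * c      ≡⟨ cong (_* c) (ι-suc (length xs)) ⟨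
    ι (suc (length xs)) * c       ∎
    where open ≡-Reasoning

  𝔼-weighted : ∀ (xs : List A) p f → 𝔼 (map (λ x → x , p) xs) f ≡ p * ∑ xs f
  𝔼-weighted []       p f = sym (*-zeroʳ p)
  𝔼-weighted (x ∷ xs) p f = trans (cong (p * f x +_) (𝔼-weighted xs p f))
    (solve 3 (λ p a b → p :* a :+ p :* b := p :* (con 1ℚ :* a :+ b)) refl p (f x) (∑ xs f))
    where open +-*-Solver

  weighted-nonNeg : ∀ (xs : List A) {p} → 0ℚ ≤ p → All (λ (_ , q) → 0ℚ ≤ q) (map (λ x → x , p) xs)
  weighted-nonNeg xs 0≤p = All.map⁺ (All.universal (λ _ → 0≤p) xs)

  𝔼-uniform : ∀ (xs : List A) .{{_ : ℕ.NonZero (length xs)}} f →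
    ι (length xs) * 𝔼 (uniform xs) f ≡ ∑ xs f
  𝔼-uniform xs@(_ ∷ _) f = begin
    ι (length xs) * 𝔼 (uniform xs) f  ≡⟨ cong (ι (length xs) *_) (𝔼-weighted xs (ℤ.+ 1 / length xs) f) ⟩
    ι (length xs) * ((ℤ.+ 1 / length xs) * ∑ xs f)
      ≡⟨ solve 3 (λ a b c → a :* (b :* c) := (b :* a) :* c) refl (ι (length xs)) (ℤ.+ 1 / length xs) (∑ xs f) ⟩
    ((ℤ.+ 1 / length xs) * ι (length xs)) * ∑ xs f    ≡⟨ cong (_* ∑ xs f) (/-ι 1 (length xs)) ⟩
    1ℚ * ∑ xs f  ≡⟨ *-identityˡ (∑ xs f) ⟩
    ∑ xs f  ∎
    where
    open ≡-Reasoning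
    open +-*-Solver

  uniform-isProbability : ∀ (xs : List A) .{{_ : ℕ.NonZero (length xs)}} → IsProbability (uniform xs)
  uniform-isProbability xs@(_ ∷ _) = record
    { weights-nonNeg = weighted-nonNeg xs (unit-nonNeg (ℕ.pred (length xs)))
    ; mass   = trans (𝔼-weighted xs (ℤ.+ 1 / length xs) (λ _ → 1ℚ))
        (trans (cong ((ℤ.+ 1 / length xs) *_) (trans (∑-const xs 1ℚ) (*-identityʳ (ι (length xs))))) (/-ι 1 (length xs)))
    }

  𝔼-independent-∷ : ∀ (d : Dist A) (ds : Vec (Dist A) m) f →
    𝔼 (independent (d ∷ ds)) f ≡ 𝔼 d (λ x → 𝔼 (independent ds) (λ xs → f (x ∷ xs)))
  𝔼-independent-∷ d ds f = trans (𝔼->>= d (λ x → independent ds >>= λ xs → pure (x ∷ xs)) f) (𝔼-cong d λ x →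
    trans (𝔼->>= (independent ds) (λ xs → pure (x ∷ xs)) f) (𝔼-cong (independent ds) λ xs → 𝔼-pure (x ∷ xs) f))

  independent-isProbability : ∀ (ds : Vec (Dist A) m) → (∀ i → IsProbability (lookup ds i)) →
    IsProbability (independent ds)
  independent-isProbability []       dsP = pure-isProbability []
  independent-isProbability (d ∷ ds) dsP = >>=-isProbability (dsP zero) λ x →
    >>=-isProbability (independent-isProbability ds (dsP ∘ suc)) λ xs → pure-isProbability (x ∷ xs)

  𝔼-marginal : ∀ (ds : Vec (Dist A) m) → (∀ i → IsProbability (lookup ds i)) → ∀ i (f : A → ℚ) →
    𝔼 (independent ds) (λ xs → f (lookup xs i)) ≡ 𝔼 (lookup ds i) f
  𝔼-marginal (d ∷ ds) dsP zero    f = trans (𝔼-independent-∷ d ds _)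
    (𝔼-cong d λ x → 𝔼-const (independent-isProbability ds (dsP ∘ suc)) (f x))
  𝔼-marginal (d ∷ ds) dsP (suc i) f = trans (𝔼-independent-∷ d ds _)
    (trans (𝔼-const (dsP zero) _) (𝔼-marginal ds (dsP ∘ suc) i f))

  -- Once coordinate `i` is overwritten, its old entry no longer matters, so redrawing it from its
  -- own law changes nothing. This is how one conditions on all the other agents.
  𝔼-resample : ∀ (ds : Vec (Dist A) m) → (∀ i → IsProbability (lookup ds i)) → ∀ i (f : Vec A m → ℚ) →
    𝔼 (independent ds) f ≡ 𝔼 (independent ds) (λ xs → 𝔼 (lookup ds i) (λ y → f (xs [ i ]≔ y)))
  𝔼-resample (d ∷ ds) dsP zero f = begin
    𝔼 (independent (d ∷ ds)) f
      ≡⟨ 𝔼-independent-∷ d ds f ⟩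
    𝔼 d (λ y → 𝔼 (independent ds) (λ xs → f (y ∷ xs)))
      ≡⟨ 𝔼-swap d (independent ds) (λ y xs → f (y ∷ xs)) ⟩
    𝔼 (independent ds) (λ xs → 𝔼 d (λ y → f (y ∷ xs)))
      ≡⟨ 𝔼-const (dsP zero) _ ⟨
    𝔼 d (λ x → 𝔼 (independent ds) (λ xs → 𝔼 d (λ y → f (y ∷ xs))))
      ≡⟨ 𝔼-independent-∷ d ds _ ⟨
    𝔼 (independent (d ∷ ds)) (λ xs → 𝔼 d (λ y → f (xs [ zero ]≔ y))) ∎
    where open ≡-Reasoning
  𝔼-resample (d ∷ ds) dsP (suc i) f = trans (𝔼-independent-∷ d ds f)
    (trans (𝔼-cong d λ x → 𝔼-resample ds (dsP ∘ suc) i (λ xs → f (x ∷ xs)))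
      (sym (𝔼-independent-∷ d ds _)))

  -- The average over the remaining coordinates commutes with the kernel of the leading one, so
  -- stationarity can be applied one coordinate at a time.
  𝔼-stationary : ∀ (d : Dist A) (K : A → Dist A) → (∀ f → 𝔼 d (λ x → 𝔼 (K x) f) ≡ 𝔼 d f) →
    ∀ m (f : Vec A m → ℚ) →
    𝔼 (independent (replicate m d)) (λ xs → 𝔼 (independent (Vec.map K xs)) f) ≡
    𝔼 (independent (replicate m d)) f
  𝔼-stationary d K stat zero    f = trans (𝔼-pure [] (λ xs → 𝔼 (independent (Vec.map K xs)) f)) refl
  𝔼-stationary d K stat (suc m) f = begin
    𝔼 (independent (d ∷ ds)) (λ xs → 𝔼 (independent (Vec.map K xs)) f)
      ≡⟨ 𝔼-independent-∷ d ds _ ⟩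
    𝔼 d (λ x → 𝔼 (independent ds) (λ xs → 𝔼 (independent (K x ∷ Vec.map K xs)) f))
      ≡⟨ 𝔼-cong d (λ x → 𝔼-cong (independent ds) (λ xs → 𝔼-independent-∷ (K x) (Vec.map K xs) f)) ⟩
    𝔼 d (λ x → 𝔼 (independent ds) (λ xs → 𝔼 (K x) (λ y → 𝔼 (independent (Vec.map K xs)) (λ ys → f (y ∷ ys)))))
      ≡⟨ 𝔼-cong d (λ x → 𝔼-swap (independent ds) (K x) _) ⟩
    𝔼 d (λ x → 𝔼 (K x) (λ y → 𝔼 (independent ds) (λ xs → 𝔼 (independent (Vec.map K xs)) (λ ys → f (y ∷ ys)))))
      ≡⟨ 𝔼-cong d (λ x → 𝔼-cong (K x) (λ y → 𝔼-stationary d K stat m (λ ys → f (y ∷ ys)))) ⟩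
    𝔼 d (λ x → 𝔼 (K x) (λ y → 𝔼 (independent ds) (λ ys → f (y ∷ ys))))
      ≡⟨ stat (λ y → 𝔼 (independent ds) (λ ys → f (y ∷ ys))) ⟩
    𝔼 d (λ y → 𝔼 (independent ds) (λ ys → f (y ∷ ys)))
      ≡⟨ 𝔼-independent-∷ d ds f ⟨
    𝔼 (independent (d ∷ ds)) f ∎
    where
    open ≡-Reasoning
    ds : Vec (Dist _) m
    ds = replicate m d

-- Counting coordinates at a given distance.

module Grid where
  open import Defs
  open Powers
  open Expectation
  open import Data.List using (List; []; _∷_; map; length; allFin; tabulate; filter; cartesianProduct)
  open import Data.List.Properties using (map-tabulate; length-tabulate; length-++; length-map)
  open import Data.List.Relation.Unary.All using (_∷_)
  open import Data.Nat using (_≡ᵇ_; _≤ᵇ_; ∣_-_∣)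
  open import Data.Rational hiding (∣_∣; _≤ᵇ_)
  open import Data.Rational.Properties

  private
    variable
      A B : Set

  ∑-filter : ∀ {P : A → Set} (P? : Decidable P) xs f → ∑ (filter P? xs) f ≡ ∑ xs (λ x → 𝟙 (does (P? x)) * f x)
  ∑-filter P? []       f = refl
  ∑-filter P? (x ∷ xs) f with does (P? x)
  ... | true  = cong₂ _+_ (cong (1ℚ *_) (sym (*-identityˡ (f x)))) (∑-filter P? xs f)
  ... | false = trans (∑-filter P? xs f)
    (sym (trans (cong (λ z → 1ℚ * z + S) (*-zeroˡ (f x))) (+-identityˡ S)))
    where S = ∑ xs (λ x → 𝟙 (does (P? x)) * f x)

  ∑-cartesianProduct : ∀ (xs : List A) (ys : List B) f →
    ∑ (cartesianProduct xs ys) f ≡ ∑ xs (λ x → ∑ ys (λ y → f (x , y)))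
  ∑-cartesianProduct []       ys f = refl
  ∑-cartesianProduct (x ∷ xs) ys f = trans (∑-++ (map (x ,_) ys) (cartesianProduct xs ys) f)
    (cong₂ _+_ (trans (∑-map (x ,_) ys f) (sym (*-identityˡ _))) (∑-cartesianProduct xs ys f))

  length-cartesianProduct : ∀ (xs : List A) (ys : List B) →
    length (cartesianProduct xs ys) ≡ length xs ℕ.* length ys
  length-cartesianProduct []       ys = refl
  length-cartesianProduct (x ∷ xs) ys = trans (length-++ (map (x ,_) ys))
    (cong₂ ℕ._+_ (length-map (x ,_) ys) (length-cartesianProduct xs ys))

  length-nodes : ∀ s → length (nodes s) ≡ s ℕ.* s
  length-nodes s = trans (length-cartesianProduct (allFin s) (allFin s))
    (cong₂ ℕ._*_ (length-tabulate {n = s} (λ x → x)) (length-tabulate {n = s} (λ x → x)))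

  ∑-allFin-suc : ∀ n f → ∑ (allFin (suc n)) f ≡ f zero + ∑ (allFin n) (f ∘ suc)
  ∑-allFin-suc n f = trans (∑-∷ zero (tabulate suc) f)
    (cong (f zero +_) (trans (cong (λ xs → ∑ xs f) (sym (map-tabulate (λ x → x) suc))) (∑-map suc (allFin n) f)))

  -- A factor that is 1 on the grid and 0 beyond it: neighbours of a coordinate can be written as
  -- natural numbers without separate boundary cases.
  hits : ∀ n → ℕ → ℚ
  hits n c = ∑ (allFin n) (λ x → 𝟙 (toℕ x ≡ᵇ c))

  hits-suc : ∀ n c → hits (suc n) (suc c) ≡ hits n c
  hits-suc n c = trans (∑-allFin-suc n (λ x → 𝟙 (toℕ x ≡ᵇ suc c))) (+-identityˡ (hits n c))

  hits-zero : ∀ n → hits (suc n) zero ≡ 1ℚ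
  hits-zero n = trans (∑-allFin-suc n (λ x → 𝟙 (toℕ x ≡ᵇ zero))) (trans (cong (1ℚ +_) (∑-0 (allFin n))) (+-identityʳ 1ℚ))

  hits≤1 : ∀ n c → hits n c ≤ 1ℚ
  hits≤1 zero    c       = 0≤1
  hits≤1 (suc n) zero    = ≤-reflexive (hits-zero n)
  hits≤1 (suc n) (suc c) = ≤-trans (≤-reflexive (hits-suc n c)) (hits≤1 n c)

  hits≡1 : ∀ {n c} → c ℕ.< n → hits n c ≡ 1ℚ
  hits≡1 {suc n} {zero}  _           = hits-zero n
  hits≡1 {suc n} {suc c} (ℕ.s≤s c<n) = trans (hits-suc n c) (hits≡1 c<n)

  ∑-hits : ∀ n c (f : ℕ → ℚ) → ∑ (allFin n) (λ x → 𝟙 (toℕ x ≡ᵇ c) * f (toℕ x)) ≡ hits n c * f c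
  ∑-hits n c f = trans (∑-cong (allFin n) (λ x → pointwise (toℕ x)))
    (∑-*ʳ (allFin n) (f c) (λ x → 𝟙 (toℕ x ≡ᵇ c)))
    where
    pointwise : ∀ x → 𝟙 (x ≡ᵇ c) * f x ≡ 𝟙 (x ≡ᵇ c) * f c
    pointwise x with x ≡ᵇ c in eq
    ... | true  = cong (λ z → 1ℚ * f z) (ℕ.≡ᵇ⇒≡ x c (subst T (sym eq) tt))
    ... | false = trans (*-zeroˡ (f x)) (sym (*-zeroˡ (f c)))

  sphere≤2 : ∀ n c m → ∑ (allFin n) (λ x → 𝟙 (∣ c - toℕ x ∣ ≡ᵇ m)) ≤ ι 2
  sphere≤2 n c m = begin
    ∑ (allFin n) (λ x → 𝟙 (∣ c - toℕ x ∣ ≡ᵇ m))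
      ≤⟨ ∑-mono (allFin n) (λ x → split (toℕ x)) ⟩
    ∑ (allFin n) (λ x → 𝟙 (toℕ x ≡ᵇ c ℕ.+ m) + 𝟙 (toℕ x ≡ᵇ c ℕ.∸ m))
      ≡⟨ ∑-+ (allFin n) (λ x → 𝟙 (toℕ x ≡ᵇ c ℕ.+ m)) (λ x → 𝟙 (toℕ x ≡ᵇ c ℕ.∸ m)) ⟩
    hits n (c ℕ.+ m) + hits n (c ℕ.∸ m)
      ≤⟨ +-mono-≤ (hits≤1 n (c ℕ.+ m)) (hits≤1 n (c ℕ.∸ m)) ⟩
    1ℚ + 1ℚ ∎
    where
    open ≤-Reasoning
    hit : ∀ {x y} → x ≡ y → 1ℚ ≤ 𝟙 (x ≡ᵇ y)
    hit {x} {y} x≡y with x ≡ᵇ y | ℕ.≡⇒≡ᵇ x y x≡y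
    ... | true | _ = ≤-refl
    split : ∀ x → 𝟙 (∣ c - x ∣ ≡ᵇ m) ≤ 𝟙 (x ≡ᵇ c ℕ.+ m) + 𝟙 (x ≡ᵇ c ℕ.∸ m)
    split x with ∣ c - x ∣ ≡ᵇ m in eq
    ... | false = 0≤+ (0≤𝟙 (x ≡ᵇ c ℕ.+ m)) (0≤𝟙 (x ≡ᵇ c ℕ.∸ m))
    ... | true with ℕ.≡ᵇ⇒≡ ∣ c - x ∣ m (subst T (sym eq) tt) | ℕ.≤-total c x
    ...   | refl | inj₁ c≤x = ≤-trans (hit x≡) (≤-+ʳ (0≤𝟙 (x ≡ᵇ c ℕ.∸ ∣ c - x ∣)))
      where
      x≡ : x ≡ c ℕ.+ ∣ c - x ∣
      x≡ = sym (trans (cong (c ℕ.+_) (ℕ.m≤n⇒∣m-n∣≡n∸m c≤x)) (ℕ.m+[n∸m]≡n c≤x))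
    ...   | refl | inj₂ x≤c = ≤-trans (hit x≡)
      (≤-trans (≤-reflexive (sym (+-identityˡ _))) (+-monoˡ-≤ _ (0≤𝟙 (x ≡ᵇ c ℕ.+ ∣ c - x ∣))))
      where
      x≡ : x ≡ c ℕ.∸ ∣ c - x ∣
      x≡ = sym (trans (cong (c ℕ.∸_) (ℕ.m≤n⇒∣n-m∣≡n∸m x≤c)) (ℕ.m∸[m∸n]≡n x≤c))

  ∣-∣≡ᵇ0 : ∀ c x → (∣ c - x ∣ ≡ᵇ 0) ≡ (x ≡ᵇ c)
  ∣-∣≡ᵇ0 zero    zero    = refl
  ∣-∣≡ᵇ0 zero    (suc x) = refl
  ∣-∣≡ᵇ0 (suc c) zero    = refl
  ∣-∣≡ᵇ0 (suc c) (suc x) = ∣-∣≡ᵇ0 c x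

  interval≤ : ∀ n c m → ∑ (allFin n) (λ x → 𝟙 (∣ c - toℕ x ∣ ≤ᵇ m)) ≤ ι (2 ℕ.* m ℕ.+ 1)
  interval≤ n c zero = ≤-trans
    (≤-reflexive (∑-cong (allFin n) λ x → cong 𝟙 (trans (≤ᵇ0 ∣ c - toℕ x ∣) (∣-∣≡ᵇ0 c (toℕ x))))) (hits≤1 n c)
    where
    ≤ᵇ0 : ∀ m → (m ≤ᵇ 0) ≡ (m ≡ᵇ 0)
    ≤ᵇ0 zero    = refl
    ≤ᵇ0 (suc m) = refl
  interval≤ n c (suc m) = begin
    ∑ (allFin n) (λ x → 𝟙 (∣ c - toℕ x ∣ ≤ᵇ suc m))
      ≤⟨ ∑-mono (allFin n) (λ x → split ∣ c - toℕ x ∣ m) ⟩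
    ∑ (allFin n) (λ x → 𝟙 (∣ c - toℕ x ∣ ≡ᵇ suc m) + 𝟙 (∣ c - toℕ x ∣ ≤ᵇ m))
      ≡⟨ ∑-+ (allFin n) (λ x → 𝟙 (∣ c - toℕ x ∣ ≡ᵇ suc m)) (λ x → 𝟙 (∣ c - toℕ x ∣ ≤ᵇ m)) ⟩
    ∑ (allFin n) (λ x → 𝟙 (∣ c - toℕ x ∣ ≡ᵇ suc m)) + ∑ (allFin n) (λ x → 𝟙 (∣ c - toℕ x ∣ ≤ᵇ m))
      ≤⟨ +-mono-≤ (sphere≤2 n c (suc m)) (interval≤ n c m) ⟩
    ι 2 + ι (2 ℕ.* m ℕ.+ 1)
      ≡⟨ ι-+ 2 (2 ℕ.* m ℕ.+ 1) ⟨
    ι (2 ℕ.+ (2 ℕ.* m ℕ.+ 1))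
      ≡⟨ cong (λ z → ι (z ℕ.+ 1)) (sym (ℕ.*-suc 2 m)) ⟩
    ι (2 ℕ.* suc m ℕ.+ 1) ∎
    where
    open ≤-Reasoning
    <ᵇ-irrefl : ∀ d m → (d ≡ᵇ m) ≡ true → (d ℕ.<ᵇ m) ≡ false
    <ᵇ-irrefl zero    zero    _  = refl
    <ᵇ-irrefl (suc d) (suc m) eq = <ᵇ-irrefl d m eq
    split : ∀ d m → 𝟙 (d ≤ᵇ suc m) ≤ 𝟙 (d ≡ᵇ suc m) + 𝟙 (d ≤ᵇ m)
    split zero    m       = ≤ᵇ⇒≤ _
    split (suc zero)    zero    = ≤ᵇ⇒≤ _
    split (suc (suc d)) zero    = ≤ᵇ⇒≤ _
    split (suc d) (suc m) = ≤-trans (≤-reflexive (cong 𝟙 (<ᵇ-suc d (suc m)))) (≤-trans (split d m)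
      (≤-reflexive (cong (λ b → 𝟙 (d ≡ᵇ suc m) + 𝟙 b) (sym (<ᵇ-suc d m)))))
      where
      <ᵇ-suc : ∀ d m → (d ℕ.<ᵇ suc m) ≡ (d ≤ᵇ m)
      <ᵇ-suc zero    m = refl
      <ᵇ-suc (suc d) m = refl

-- A single step of one agent: generator, stationarity and size of balls.

module Steps where
  open import Defs
  open Powers
  open Expectation
  open Grid
  open import Data.List using (map; length; allFin)
  open import Data.List.Relation.Unary.All using (_∷_)
  open import Data.Nat using (_≡ᵇ_; _≤ᵇ_; ∣_-_∣)
  open import Data.Rational hiding (∣_∣; _≤ᵇ_)
  open import Data.Rational.Properties
  open import Data.Rational.Solver using (module +-*-Solver)

  ≤⇒true : ∀ {a b} → a ℕ.≤ b → (a ≤ᵇ b) ≡ true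
  ≤⇒true {a} {b} a≤b with a ≤ᵇ b | ℕ.≤⇒≤ᵇ a≤b
  ... | true | _ = refl

  ⅕ : ℚ
  ⅕ = ℤ.+ 1 / 5

  0≤⅕ : 0ℚ ≤ ⅕
  0≤⅕ = ≤ᵇ⇒≤ _

  module _ {s : ℕ} where

    adj : Node s → Node s → ℚ
    adj v w = 𝟙 (manhattan v w ≡ᵇ 1)

    manhattan-sym : ∀ (v w : Node s) → manhattan v w ≡ manhattan w v
    manhattan-sym (x , y) (x′ , y′) = cong₂ ℕ._+_ (ℕ.∣-∣-comm (toℕ x) (toℕ x′)) (ℕ.∣-∣-comm (toℕ y) (toℕ y′))

    manhattan-refl : ∀ (v : Node s) → manhattan v v ≡ 0
    manhattan-refl (x , y) = cong₂ ℕ._+_ (ℕ.∣n-n∣≡0 (toℕ x)) (ℕ.∣n-n∣≡0 (toℕ y))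

    manhattan-triangle : ∀ (u v w : Node s) → manhattan u w ℕ.≤ manhattan u v ℕ.+ manhattan v w
    manhattan-triangle (x , y) (x′ , y′) (x″ , y″) = begin
      ∣ a - a″ ∣ ℕ.+ ∣ b - b″ ∣
        ≤⟨ ℕ.+-mono-≤ (ℕ.∣-∣-triangle a a′ a″) (ℕ.∣-∣-triangle b b′ b″) ⟩
      (∣ a - a′ ∣ ℕ.+ ∣ a′ - a″ ∣) ℕ.+ (∣ b - b′ ∣ ℕ.+ ∣ b′ - b″ ∣)
        ≡⟨ interchange (∣ a - a′ ∣) (∣ a′ - a″ ∣) (∣ b - b′ ∣) (∣ b′ - b″ ∣) ⟩
      (∣ a - a′ ∣ ℕ.+ ∣ b - b′ ∣) ℕ.+ (∣ a′ - a″ ∣ ℕ.+ ∣ b′ - b″ ∣) ∎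
      where
      open ℕ.≤-Reasoning
      open import Algebra.Properties.CommutativeSemigroup ℕ.+-commutativeSemigroup using (interchange)
      a  = toℕ x ; a′ = toℕ x′ ; a″ = toℕ x″
      b  = toℕ y ; b′ = toℕ y′ ; b″ = toℕ y″

    ∑-neighbours : ∀ v f → ∑ (neighbours v) f ≡ ∑ (nodes s) (λ w → adj v w * f w)
    ∑-neighbours v f = ∑-filter (λ w → manhattan v w ℕ.≟ 1) (nodes s) f

    degree : ∀ v → ι (length (neighbours v)) ≡ ∑ (nodes s) (adj v)
    degree v = begin
      ι (length (neighbours v))  ≡⟨ *-identityʳ (ι (length (neighbours v))) ⟨
      ι (length (neighbours v)) * 1ℚ         ≡⟨ ∑-const (neighbours v) 1ℚ ⟨
      ∑ (neighbours v) (λ _ → 1ℚ)  ≡⟨ ∑-neighbours v (λ _ → 1ℚ) ⟩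
      ∑ (nodes s) (λ w → adj v w * 1ℚ)       ≡⟨ ∑-cong (nodes s) (λ w → *-identityʳ (adj v w)) ⟩
      ∑ (nodes s) (adj v)  ∎
      where open ≡-Reasoning

    n/5 : ∀ n → ℤ.+ n / 5 ≡ ⅕ * ι n
    n/5 n = begin
      ℤ.+ n / 5  ≡⟨ *-identityʳ (ℤ.+ n / 5) ⟨
      (ℤ.+ n / 5) * (ι 5 * ⅕)         ≡⟨ *-assoc (ℤ.+ n / 5) (ι 5) ⅕ ⟨
      (ℤ.+ n / 5) * ι 5 * ⅕  ≡⟨ cong (_* ⅕) (/-ι n 5) ⟩
      ι n * ⅕  ≡⟨ *-comm (ι n) ⅕ ⟩
      ⅕ * ι n  ∎
      where open ≡-Reasoning

    -- The generator form of the walk. The probability of staying depends on the degree, but in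
    -- terms of differences `f w - f v` the degree cancels.
    𝔼-step : ∀ v f → 𝔼 (step v) f ≡ f v + ⅕ * ∑ (nodes s) (λ w → adj v w * (f w - f v))
    𝔼-step v f = begin
      (1ℚ - ℤ.+ deg / 5) * f v + 𝔼 (map (λ w → w , ⅕) (neighbours v)) f
        ≡⟨ cong₂ (λ a b → (1ℚ - a) * f v + b) (n/5 deg) (𝔼-weighted (neighbours v) ⅕ f) ⟩
      (1ℚ - ⅕ * ι deg) * f v + ⅕ * ∑ (neighbours v) f
        ≡⟨ solve 4 (λ c n a b → (con 1ℚ :- c :* n) :* a :+ c :* b := a :+ c :* (b :+ :- a :* n))
             refl ⅕ (ι deg) (f v) (∑ (neighbours v) f) ⟩
      f v + ⅕ * (∑ (neighbours v) f + - f v * ι deg)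
        ≡⟨ cong (λ z → f v + ⅕ * z) (cong₂ (λ a b → a + - f v * b) (∑-neighbours v f) (degree v)) ⟩
      f v + ⅕ * (∑ (nodes s) (λ w → adj v w * f w) + - f v * ∑ (nodes s) (adj v))
        ≡⟨ cong (λ z → f v + ⅕ * (∑ (nodes s) (λ w → adj v w * f w) + z)) (∑-*ˡ (nodes s) (- f v) (adj v)) ⟨
      f v + ⅕ * (∑ (nodes s) (λ w → adj v w * f w) + ∑ (nodes s) (λ w → - f v * adj v w))
        ≡⟨ cong (λ z → f v + ⅕ * z) (∑-+ (nodes s) (λ w → adj v w * f w) (λ w → - f v * adj v w)) ⟨
      f v + ⅕ * ∑ (nodes s) (λ w → adj v w * f w + - f v * adj v w)
        ≡⟨ cong (λ z → f v + ⅕ * z) (∑-cong (nodes s) λ w →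
             solve 3 (λ a b c → a :* b :+ :- c :* a := a :* (b :- c)) refl (adj v w) (f w) (f v)) ⟩
      f v + ⅕ * ∑ (nodes s) (λ w → adj v w * (f w - f v)) ∎
      where
      open ≡-Reasoning
      open +-*-Solver
      deg : ℕ
      deg = length (neighbours v)

    ∑-product : ∀ (f g : Fin s → ℚ) →
      ∑ (nodes s) (λ (x , y) → f x * g y) ≡ ∑ (allFin s) f * ∑ (allFin s) g
    ∑-product f g = begin
      ∑ (nodes s) (λ (x , y) → f x * g y)
        ≡⟨ ∑-cartesianProduct (allFin s) (allFin s) (λ (x , y) → f x * g y) ⟩
      ∑ (allFin s) (λ x → ∑ (allFin s) (λ y → f x * g y))
        ≡⟨ ∑-cong (allFin s) (λ x → ∑-*ˡ (allFin s) (f x) g) ⟩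
      ∑ (allFin s) (λ x → f x * ∑ (allFin s) g)
        ≡⟨ ∑-*ʳ (allFin s) (∑ (allFin s) g) f ⟩
      ∑ (allFin s) f * ∑ (allFin s) g ∎
      where open ≡-Reasoning

    -- The ball lies in a square of side 2m + 1, whose indicator is a product over the two
    -- coordinates.
    ball≤ : ∀ v m → ∑ (nodes s) (λ w → 𝟙 (manhattan v w ≤ᵇ m)) ≤ ι ((2 ℕ.* m ℕ.+ 1) ℕ.* (2 ℕ.* m ℕ.+ 1))
    ball≤ (x , y) m = begin
      ∑ (nodes s) (λ w → 𝟙 (manhattan (x , y) w ≤ᵇ m))
        ≤⟨ ∑-mono (nodes s) (λ (x′ , y′) → split (∣ toℕ x - toℕ x′ ∣) (∣ toℕ y - toℕ y′ ∣)) ⟩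
      ∑ (nodes s) (λ (x′ , y′) → f x′ * g y′)
        ≡⟨ ∑-product f g ⟩
      ∑ (allFin s) f * ∑ (allFin s) g
        ≤⟨ *-mono-≤-nonNeg (0≤∑ f λ x′ → 0≤𝟙 (∣ toℕ x - toℕ x′ ∣ ≤ᵇ m)) (0≤ι (2 ℕ.* m ℕ.+ 1))
             (interval≤ s (toℕ x) m) (interval≤ s (toℕ y) m) ⟩
      ι (2 ℕ.* m ℕ.+ 1) * ι (2 ℕ.* m ℕ.+ 1)
        ≡⟨ ι-* (2 ℕ.* m ℕ.+ 1) (2 ℕ.* m ℕ.+ 1) ⟨
      ι ((2 ℕ.* m ℕ.+ 1) ℕ.* (2 ℕ.* m ℕ.+ 1)) ∎
      where
      open ≤-Reasoning
      f g : Fin s → ℚ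
      f x′ = 𝟙 (∣ toℕ x - toℕ x′ ∣ ≤ᵇ m)
      g y′ = 𝟙 (∣ toℕ y - toℕ y′ ∣ ≤ᵇ m)
      0≤∑ : ∀ (f : Fin s → ℚ) → (∀ x → 0ℚ ≤ f x) → 0ℚ ≤ ∑ (allFin s) f
      0≤∑ f 0≤f = ≤-trans (≤-reflexive (sym (∑-0 (allFin s)))) (∑-mono (allFin s) 0≤f)
      split : ∀ a b → 𝟙 (a ℕ.+ b ≤ᵇ m) ≤ 𝟙 (a ≤ᵇ m) * 𝟙 (b ≤ᵇ m)
      split a b with a ℕ.+ b ≤ᵇ m in eq
      ... | false = 0≤* (𝟙 (a ≤ᵇ m)) (𝟙 (b ≤ᵇ m)) (0≤𝟙 (a ≤ᵇ m)) (0≤𝟙 (b ≤ᵇ m))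
      ... | true  = ≤-reflexive (sym (cong₂ (λ p q → 𝟙 p * 𝟙 q)
        (≤⇒true (ℕ.m+n≤o⇒m≤o a a+b≤m)) (≤⇒true (ℕ.m+n≤o⇒n≤o a a+b≤m))))
        where
        a+b≤m : a ℕ.+ b ℕ.≤ m
        a+b≤m = ℕ.≤ᵇ⇒≤ (a ℕ.+ b) m (subst T (sym eq) tt)

    hit∑ : ∀ (y : Fin s) → ∑ (allFin s) (λ y′ → 𝟙 (∣ toℕ y - toℕ y′ ∣ ≡ᵇ 0)) ≡ 1ℚ
    hit∑ y = trans (∑-cong (allFin s) (λ y′ → cong 𝟙 (∣-∣≡ᵇ0 (toℕ y) (toℕ y′)))) (hits≡1 (Fin.toℕ<n y))

    -- Adjacent nodes differ by a unit in one coordinate and by nothing in the other. The bound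
    -- keeps the probability of staying nonnegative.
    degree≤4 : ∀ v → ι (length (neighbours v)) ≤ ι 4
    degree≤4 v@(x , y) = begin
      ι (length (neighbours v))
        ≡⟨ degree v ⟩
      ∑ (nodes s) (adj v)
        ≤⟨ ∑-mono (nodes s) (λ (x′ , y′) → split ∣ toℕ x - toℕ x′ ∣ ∣ toℕ y - toℕ y′ ∣) ⟩
      ∑ (nodes s) (λ (x′ , y′) → X 1 x′ * Y 0 y′ + X 0 x′ * Y 1 y′)
        ≡⟨ ∑-+ (nodes s) (λ (x′ , y′) → X 1 x′ * Y 0 y′) (λ (x′ , y′) → X 0 x′ * Y 1 y′) ⟩
      ∑ (nodes s) (λ (x′ , y′) → X 1 x′ * Y 0 y′) + ∑ (nodes s) (λ (x′ , y′) → X 0 x′ * Y 1 y′)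
        ≡⟨ cong₂ _+_ (trans (∑-product (X 1) (Y 0)) (cong (∑ (allFin s) (X 1) *_) (hit∑ y)))
                     (trans (∑-product (X 0) (Y 1)) (cong (_* ∑ (allFin s) (Y 1)) (hit∑ x))) ⟩
      ∑ (allFin s) (X 1) * 1ℚ + 1ℚ * ∑ (allFin s) (Y 1)
        ≤⟨ +-mono-≤ (*-monoʳ 1ℚ 0≤1 (sphere≤2 s (toℕ x) 1)) (*-monoˡ 1ℚ 0≤1 (sphere≤2 s (toℕ y) 1)) ⟩
      ι 2 * 1ℚ + 1ℚ * ι 2 ∎
      where
      open ≤-Reasoning
      X Y : ℕ → Fin s → ℚ
      X m x′ = 𝟙 (∣ toℕ x - toℕ x′ ∣ ≡ᵇ m)
      Y m y′ = 𝟙 (∣ toℕ y - toℕ y′ ∣ ≡ᵇ m)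
      split : ∀ a b → 𝟙 (a ℕ.+ b ≡ᵇ 1) ≤ 𝟙 (a ≡ᵇ 1) * 𝟙 (b ≡ᵇ 0) + 𝟙 (a ≡ᵇ 0) * 𝟙 (b ≡ᵇ 1)
      split zero          zero          = ≤ᵇ⇒≤ _
      split zero          (suc zero)    = ≤ᵇ⇒≤ _
      split zero          (suc (suc b)) = ≤ᵇ⇒≤ _
      split (suc zero)    zero          = ≤ᵇ⇒≤ _
      split (suc zero)    (suc zero)    = ≤ᵇ⇒≤ _
      split (suc zero)    (suc (suc b)) = ≤ᵇ⇒≤ _
      split (suc (suc a)) zero          = ≤ᵇ⇒≤ _
      split (suc (suc a)) (suc zero)    = ≤ᵇ⇒≤ _
      split (suc (suc a)) (suc (suc b)) = ≤ᵇ⇒≤ _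

    step-isProbability : ∀ (v : Node s) → IsProbability (step v)
    step-isProbability v = record
      { weights-nonNeg = stay ∷ weighted-nonNeg (neighbours v) 0≤⅕
      ; mass = trans (𝔼-step v (λ _ → 1ℚ)) (cong (λ z → 1ℚ + ⅕ * z)
          (trans (∑-cong (nodes s) (λ w → *-zeroʳ (adj v w))) (∑-0 (nodes s))))
      }
      where
      open ≤-Reasoning
      deg : ℕ
      deg = length (neighbours v)
      stay : 0ℚ ≤ 1ℚ - ℤ.+ deg / 5
      stay = begin
        0ℚ  ≤⟨ ≤ᵇ⇒≤ _ ⟩
        1ℚ - ⅕ * ι 4         ≤⟨ +-monoʳ-≤ 1ℚ (neg-antimono-≤ (*-monoˡ ⅕ 0≤⅕ (degree≤4 v))) ⟩
        1ℚ - ⅕ * ι deg       ≡⟨ cong (λ z → 1ℚ - z) (n/5 deg) ⟨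
        1ℚ - ℤ.+ deg / 5     ∎

    -- The step gives no weight to nodes further than 1 away, so `f` may be replaced by `c` there
    -- before the pointwise bound is integrated.
    𝔼-step≤ : ∀ v f c → (∀ w → manhattan v w ℕ.≤ 1 → f w ≤ c) → 𝔼 (step v) f ≤ c
    𝔼-step≤ v f c f≤c = begin
      𝔼 (step v) f
        ≡⟨ 𝔼-step v f ⟩
      f v + ⅕ * ∑ (nodes s) (λ w → adj v w * (f w - f v))
        ≡⟨ cong₂ (λ a b → a + ⅕ * b) here (∑-cong (nodes s) there) ⟩
      g v + ⅕ * ∑ (nodes s) (λ w → adj v w * (g w - g v))
        ≡⟨ 𝔼-step v g ⟨
      𝔼 (step v) g
        ≤⟨ 𝔼-≤const (step-isProbability v) g≤c ⟩
      c ∎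
      where
      open ≤-Reasoning
      g : Node s → ℚ
      g w = if manhattan v w ≤ᵇ 1 then f w else c
      g≤c : ∀ w → g w ≤ c
      g≤c w with manhattan v w ≤ᵇ 1 in eq
      ... | true  = f≤c w (ℕ.≤ᵇ⇒≤ _ 1 (subst T (sym eq) tt))
      ... | false = ≤-refl
      here : f v ≡ g v
      here rewrite manhattan-refl v = refl
      there : ∀ w → adj v w * (f w - f v) ≡ adj v w * (g w - g v)
      there w rewrite sym here with manhattan v w
      ... | zero          = trans (*-zeroˡ (f w - f v)) (sym (*-zeroˡ (f w - f v)))
      ... | suc zero      = refl
      ... | suc (suc m)   = trans (*-zeroˡ (f w - f v)) (sym (*-zeroˡ (c - f v)))

    -- The adjacency relation is symmetric, so the flow `adj v w * (f w - f v)` is antisymmetric and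
    -- its total over all pairs equals its own negative.
    ∑-step : ∀ f → ∑ (nodes s) (λ v → 𝔼 (step v) f) ≡ ∑ (nodes s) f
    ∑-step f = begin
      ∑ (nodes s) (λ v → 𝔼 (step v) f)
        ≡⟨ ∑-cong (nodes s) (λ v → 𝔼-step v f) ⟩
      ∑ (nodes s) (λ v → f v + ⅕ * flow v)
        ≡⟨ trans (∑-+ (nodes s) f (λ v → ⅕ * flow v)) (cong (∑ (nodes s) f +_) (∑-*ˡ (nodes s) ⅕ flow)) ⟩
      ∑ (nodes s) f + ⅕ * ∑ (nodes s) flow
        ≡⟨ cong (λ z → ∑ (nodes s) f + ⅕ * z) total≡0 ⟩
      ∑ (nodes s) f + 0ℚ
        ≡⟨ +-identityʳ (∑ (nodes s) f) ⟩
      ∑ (nodes s) f ∎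
      where
      open ≡-Reasoning
      open +-*-Solver
      flow : Node s → ℚ
      flow v = ∑ (nodes s) (λ w → adj v w * (f w - f v))
      antisym : ∑ (nodes s) flow ≡ - 1ℚ * ∑ (nodes s) flow
      antisym = begin
        ∑ (nodes s) (λ v → ∑ (nodes s) (λ w → adj v w * (f w - f v)))
          ≡⟨ ∑-swap (nodes s) (nodes s) (λ v w → adj v w * (f w - f v)) ⟩
        ∑ (nodes s) (λ w → ∑ (nodes s) (λ v → adj v w * (f w - f v)))
          ≡⟨ ∑-cong (nodes s) (λ w → ∑-cong (nodes s) (λ v →
               trans (cong (λ m → 𝟙 (m ≡ᵇ 1) * (f w - f v)) (manhattan-sym v w))
                 (solve 3 (λ a b c → a :* (b :- c) := :- con 1ℚ :* (a :* (c :- b))) refl (adj w v) (f w) (f v)))) ⟩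
        ∑ (nodes s) (λ w → ∑ (nodes s) (λ v → - 1ℚ * (adj w v * (f v - f w))))
          ≡⟨ ∑-cong (nodes s) (λ w → ∑-*ˡ (nodes s) (- 1ℚ) (λ v → adj w v * (f v - f w))) ⟩
        ∑ (nodes s) (λ w → - 1ℚ * flow w)
          ≡⟨ ∑-*ˡ (nodes s) (- 1ℚ) flow ⟩
        - 1ℚ * ∑ (nodes s) flow ∎
      total≡0 : ∑ (nodes s) flow ≡ 0ℚ
      total≡0 = begin
        S  ≡⟨ ½+½ S ⟨
        ½ * S + ½ * S  ≡⟨ cong (λ z → ½ * z + ½ * S) antisym ⟩
        ½ * (- 1ℚ * S) + ½ * S  ≡⟨ solve 2 (λ h s → h :* (:- con 1ℚ :* s) :+ h :* s := con 0ℚ) refl ½ S ⟩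
        0ℚ  ∎
        where
        S : ℚ
        S = ∑ (nodes s) flow

  module _ {s : ℕ} .{{_ : ℕ.NonZero s}} where

    private instance
      nodes≢0 : ℕ.NonZero (length (nodes s))
      nodes≢0 = subst ℕ.NonZero (sym (length-nodes s)) (ℕ.m*n≢0 s s)

    node-isProbability : IsProbability (uniform (nodes s))
    node-isProbability = uniform-isProbability (nodes s)

    step-stationary : ∀ f → 𝔼 (uniform (nodes s)) (λ v → 𝔼 (step v) f) ≡ 𝔼 (uniform (nodes s)) f
    step-stationary f = *-cancelˡ-≡-pos (trans (𝔼-uniform (nodes s) (λ v → 𝔼 (step v) f))
      (trans (∑-step f) (sym (𝔼-uniform (nodes s) f))))
      where
      *-cancelˡ-≡-pos : ∀ {p q} → ι (length (nodes s)) * p ≡ ι (length (nodes s)) * q → p ≡ q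
      *-cancelˡ-≡-pos {p} {q} eq = ≤-antisym
        (*-cancelˡ-≤-pos (ι (length (nodes s))) {{ι-pos (length (nodes s))}} (≤-reflexive eq))
        (*-cancelˡ-≤-pos (ι (length (nodes s))) {{ι-pos (length (nodes s))}} (≤-reflexive (sym eq)))

    ball-probability : ∀ v m → ι (s ℕ.* s) * 𝔼 (uniform (nodes s)) (λ w → 𝟙 (manhattan v w ≤ᵇ m)) ≤
      ι ((2 ℕ.* m ℕ.+ 1) ℕ.* (2 ℕ.* m ℕ.+ 1))
    ball-probability v m = ≤-trans (≤-reflexive (trans
      (cong (λ n → ι n * 𝔼 (uniform (nodes s)) (λ w → 𝟙 (manhattan v w ≤ᵇ m))) (sym (length-nodes s)))
      (𝔼-uniform (nodes s) (λ w → 𝟙 (manhattan v w ≤ᵇ m))))) (ball≤ v m)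

-- Drift of a convex potential that is a sum over the two coordinates.

module Potential where
  open import Defs
  open Powers
  open Expectation
  open Grid
  open Steps
  open import Data.List using (allFin)
  open import Data.Nat using (_≡ᵇ_; ∣_-_∣)
  open import Data.Rational hiding (∣_∣)
  open import Data.Rational.Properties
  open import Data.Rational.Solver using (module +-*-Solver)

  p-p≡0 : ∀ p → p - p ≡ 0ℚ
  p-p≡0 = +-inverseʳ

  0≤q-p : ∀ {p q} → p ≤ q → 0ℚ ≤ q - p
  0≤q-p {p} {q} p≤q = ≤-trans (≤-reflexive (sym (p-p≡0 p))) (+-monoˡ-≤ (- p) p≤q)

  -- The walk is not defined beyond the boundary, but a convex even potential centred inside
  -- the grid would only increase by stepping outwards, so the boundary needs no reflection.
  module Drift (c : ℕ → ℚ) (η : ℚ) (0≤η : 0ℚ ≤ η) (0≤c : ∀ m → 0ℚ ≤ c m)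
    (mono : ∀ m → c m ≤ c (suc m))
    (centre : (c 1 - c 0) + (c 1 - c 0) ≤ η * c 0)
    (convex : ∀ m → (c (suc (suc m)) - c (suc m)) + (c m - c (suc m)) ≤ η * c (suc m))
    where

    module _ {n : ℕ} (x₀ : Fin n) where
      private
        φ : ℕ → ℚ
        φ j = c ∣ toℕ x₀ - j ∣

        split : ∀ (f : ℕ → ℚ) x x′ → 𝟙 (∣ x - x′ ∣ ≡ᵇ 1) * f x′ ≡
                𝟙 (x′ ≡ᵇ suc x) * f x′ + 𝟙 (suc x′ ≡ᵇ x) * f x′
        split f x x′ = trans (cong (_* f x′) (go x x′)) (*-distribʳ-+ (f x′) (𝟙 (x′ ≡ᵇ suc x)) (𝟙 (suc x′ ≡ᵇ x)))
          where
          go : ∀ x x′ → 𝟙 (∣ x - x′ ∣ ≡ᵇ 1) ≡ 𝟙 (x′ ≡ᵇ suc x) + 𝟙 (suc x′ ≡ᵇ x)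
          go zero          zero           = refl
          go zero          (suc zero)     = refl
          go zero          (suc (suc x′)) = refl
          go (suc zero)    zero           = refl
          go (suc (suc x)) zero           = refl
          go (suc x)       (suc x′)       = go x x′

        sum : ℕ → ℚ
        sum x = ∑ (allFin n) (λ x′ → 𝟙 (∣ x - toℕ x′ ∣ ≡ᵇ 1) * (φ (toℕ x′) - φ x))

        below : ℕ → ℚ
        below x = ∑ (allFin n) (λ x′ → 𝟙 (suc (toℕ x′) ≡ᵇ x) * (φ (toℕ x′) - φ x))

        -- The two neighbours are separated because they meet different boundaries: the right one
        -- drops out through `hits n (suc x)`, the left one through `below-zero`.
        sum≡ : ∀ x → sum x ≡ hits n (suc x) * (φ (suc x) - φ x) + below x
        sum≡ x = begin
          sum x
            ≡⟨ ∑-cong (allFin n) (λ x′ → split (λ j → φ j - φ x) x (toℕ x′)) ⟩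
          ∑ (allFin n) (λ x′ → 𝟙 (toℕ x′ ≡ᵇ suc x) * (φ (toℕ x′) - φ x) + 𝟙 (suc (toℕ x′) ≡ᵇ x) * (φ (toℕ x′) - φ x))
            ≡⟨ ∑-+ (allFin n) (λ x′ → 𝟙 (toℕ x′ ≡ᵇ suc x) * (φ (toℕ x′) - φ x))
                              (λ x′ → 𝟙 (suc (toℕ x′) ≡ᵇ x) * (φ (toℕ x′) - φ x)) ⟩
          ∑ (allFin n) (λ x′ → 𝟙 (toℕ x′ ≡ᵇ suc x) * (φ (toℕ x′) - φ x)) + below x
            ≡⟨ cong (_+ below x) (∑-hits n (suc x) (λ j → φ j - φ x)) ⟩
          hits n (suc x) * (φ (suc x) - φ x) + below x ∎
          where open ≡-Reasoning

        below-zero : below 0 ≡ 0ℚ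
        below-zero = trans (∑-cong (allFin n) (λ x′ → *-zeroˡ (φ (toℕ x′) - φ 0))) (∑-0 (allFin n))

        below-suc : ∀ x → below (suc x) ≡ hits n x * (φ x - φ (suc x))
        below-suc x = ∑-hits n x (λ j → φ j - φ (suc x))

        -- Away from the centre the increment is nonnegative, so a missing neighbour does no harm.
        -- Towards the centre it is nonpositive and must be present in full, whence `h ≡ 1ℚ` in
        -- `loss`; that neighbour exists because the centre is on the grid.
        gain : ∀ h {p} → h ≤ 1ℚ → 0ℚ ≤ p → h * p ≤ p
        gain h {p} h≤1 0≤p = ≤-trans (*-monoʳ p 0≤p h≤1) (≤-reflexive (*-identityˡ p))

        loss : ∀ {h} p → h ≡ 1ℚ → h * p ≤ p
        loss p h≡1 = ≤-reflexive (trans (cong (_* p) h≡1) (*-identityˡ p))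

        φ< : ∀ x k → toℕ x₀ ≡ suc (x ℕ.+ k) → φ x ≡ c (suc k) × φ (suc x) ≡ c k
        φ< x k eq rewrite eq = cong c (dist x k) , cong c (dist′ x k)
          where
          dist : ∀ x k → ∣ suc (x ℕ.+ k) - x ∣ ≡ suc k
          dist zero    k = refl
          dist (suc x) k = dist x k
          dist′ : ∀ x k → ∣ x ℕ.+ k - x ∣ ≡ k
          dist′ zero    k = ℕ.∣-∣-identityʳ k
          dist′ (suc x) k = dist′ x k

        φ≥ : ∀ k → φ (toℕ x₀ ℕ.+ k) ≡ c k
        φ≥ k = cong c (ℕ.∣m-m+n∣≡n (toℕ x₀) k)

        below≤ : ∀ x k → toℕ x₀ ≡ suc (x ℕ.+ k) → below x ≤ c (suc (suc k)) - c (suc k)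
        below≤ zero    k eq = ≤-trans (≤-reflexive below-zero) (0≤q-p (mono (suc k)))
        below≤ (suc x) k eq = begin
          below (suc x)  ≡⟨ below-suc x ⟩
          hits n x * (φ x - φ (suc x))  ≡⟨ cong₂ (λ a b → hits n x * (a - b))
                                                         (proj₁ (φ< x (suc k) eq′)) (proj₁ (φ< (suc x) k eq)) ⟩
          hits n x * (c (suc (suc k)) - c (suc k))  ≤⟨ gain (hits n x) (hits≤1 n x) (0≤q-p (mono (suc k))) ⟩
          c (suc (suc k)) - c (suc k)  ∎
          where
          open ≤-Reasoning
          eq′ : toℕ x₀ ≡ suc (x ℕ.+ suc k)
          eq′ = trans eq (cong suc (sym (ℕ.+-suc x k)))

        above≤ : ∀ k → hits n (suc (toℕ x₀ ℕ.+ k)) * (φ (suc (toℕ x₀ ℕ.+ k)) - φ (toℕ x₀ ℕ.+ k)) ≤ c (suc k) - c k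
        above≤ k = ≤-trans (≤-reflexive (cong₂ (λ a b → hits n (suc (toℕ x₀ ℕ.+ k)) * (a - b))
            (trans (cong φ (sym (ℕ.+-suc (toℕ x₀) k))) (φ≥ (suc k))) (φ≥ k)))
          (gain (hits n (suc (toℕ x₀ ℕ.+ k))) (hits≤1 n _) (0≤q-p (mono k)))

        below≤₀ : ∀ x → toℕ x₀ ≡ x → below x ≤ c 1 - c 0
        below≤₀ zero    eq = ≤-trans (≤-reflexive below-zero) (0≤q-p (mono 0))
        below≤₀ (suc x) eq = begin
          below (suc x)  ≡⟨ below-suc x ⟩
          hits n x * (φ x - φ (suc x))  ≡⟨ cong₂ (λ a b → hits n x * (a - b)) (proj₁ φs) (proj₂ φs) ⟩
          hits n x * (c 1 - c 0)  ≤⟨ gain (hits n x) (hits≤1 n x) (0≤q-p (mono 0)) ⟩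
          c 1 - c 0  ∎
          where
          open ≤-Reasoning
          φs : φ x ≡ c 1 × φ (suc x) ≡ c 0
          φs = φ< x 0 (trans eq (cong suc (sym (ℕ.+-identityʳ x))))

        bound-< : ∀ x k → toℕ x₀ ≡ suc (x ℕ.+ k) → hits n (suc x) * (φ (suc x) - φ x) + below x ≤ η * φ x
        bound-< x k eq = begin
          hits n (suc x) * (φ (suc x) - φ x) + below x
            ≤⟨ +-mono-≤ (loss (φ (suc x) - φ x) (hits≡1 (ℕ.≤-<-trans 1+x≤x₀ (Fin.toℕ<n x₀)))) (below≤ x k eq) ⟩
          (φ (suc x) - φ x) + (c (suc (suc k)) - c (suc k))
            ≡⟨ cong₂ (λ a b → (a - b) + (c (suc (suc k)) - c (suc k))) (proj₂ (φ< x k eq)) (proj₁ (φ< x k eq)) ⟩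
          (c k - c (suc k)) + (c (suc (suc k)) - c (suc k))
            ≡⟨ +-comm (c k - c (suc k)) (c (suc (suc k)) - c (suc k)) ⟩
          (c (suc (suc k)) - c (suc k)) + (c k - c (suc k))
            ≤⟨ convex k ⟩
          η * c (suc k)
            ≡⟨ cong (η *_) (proj₁ (φ< x k eq)) ⟨
          η * φ x ∎
          where
          open ≤-Reasoning
          1+x≤x₀ : suc x ℕ.≤ toℕ x₀
          1+x≤x₀ = ℕ.≤-trans (ℕ.s≤s (ℕ.m≤m+n x k)) (ℕ.≤-reflexive (sym eq))

        bound-≥ : ∀ k → toℕ x₀ ℕ.+ k ℕ.< n →
          hits n (suc (toℕ x₀ ℕ.+ k)) * (φ (suc (toℕ x₀ ℕ.+ k)) - φ (toℕ x₀ ℕ.+ k)) + below (toℕ x₀ ℕ.+ k) ≤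
          η * φ (toℕ x₀ ℕ.+ k)
        bound-≥ zero _ = begin
          _ ≤⟨ +-mono-≤ (above≤ 0) (below≤₀ (toℕ x₀ ℕ.+ 0) (sym (ℕ.+-identityʳ (toℕ x₀)))) ⟩
          (c 1 - c 0) + (c 1 - c 0)   ≤⟨ centre ⟩
          η * c 0  ≡⟨ cong (η *_) (φ≥ 0) ⟨
          η * φ (toℕ x₀ ℕ.+ 0)        ∎
          where open ≤-Reasoning
        bound-≥ (suc k) x<n = begin
          _
            ≤⟨ +-mono-≤ (above≤ (suc k)) (≤-reflexive (trans (cong below (ℕ.+-suc (toℕ x₀) k)) (below-suc (toℕ x₀ ℕ.+ k)))) ⟩
          (c (suc (suc k)) - c (suc k)) + hits n (toℕ x₀ ℕ.+ k) * (φ (toℕ x₀ ℕ.+ k) - φ (suc (toℕ x₀ ℕ.+ k)))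
            ≤⟨ +-monoʳ-≤ (c (suc (suc k)) - c (suc k)) (loss (φ (toℕ x₀ ℕ.+ k) - φ (suc (toℕ x₀ ℕ.+ k)))
                 (hits≡1 (ℕ.<-trans (ℕ.+-monoʳ-< (toℕ x₀) (ℕ.n<1+n k)) x<n))) ⟩
          (c (suc (suc k)) - c (suc k)) + (φ (toℕ x₀ ℕ.+ k) - φ (suc (toℕ x₀ ℕ.+ k)))
            ≡⟨ cong₂ (λ a b → (c (suc (suc k)) - c (suc k)) + (a - b)) (φ≥ k)
                 (trans (cong φ (sym (ℕ.+-suc (toℕ x₀) k))) (φ≥ (suc k))) ⟩
          (c (suc (suc k)) - c (suc k)) + (c k - c (suc k))
            ≤⟨ convex k ⟩
          η * c (suc k)
            ≡⟨ cong (η *_) (φ≥ (suc k)) ⟨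
          η * φ (toℕ x₀ ℕ.+ suc k) ∎
          where open ≤-Reasoning

      drift : ∀ (x : Fin n) →
        ∑ (allFin n) (λ x′ → 𝟙 (∣ toℕ x - toℕ x′ ∣ ≡ᵇ 1) * (c ∣ toℕ x₀ - toℕ x′ ∣ - c ∣ toℕ x₀ - toℕ x ∣)) ≤
        η * c ∣ toℕ x₀ - toℕ x ∣
      drift x = ≤-trans (≤-reflexive (sum≡ (toℕ x))) (compare (ℕ.≤-<-connex (toℕ x₀) (toℕ x)))
        where
        compare : toℕ x₀ ℕ.≤ toℕ x ⊎ toℕ x ℕ.< toℕ x₀ →
          hits n (suc (toℕ x)) * (φ (suc (toℕ x)) - φ (toℕ x)) + below (toℕ x) ≤ η * φ (toℕ x)
        compare (inj₁ x₀≤x) = subst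
          (λ z → z ℕ.< n → hits n (suc z) * (φ (suc z) - φ z) + below z ≤ η * φ z)
          (ℕ.m+[n∸m]≡n x₀≤x) (bound-≥ (toℕ x ℕ.∸ toℕ x₀)) (Fin.toℕ<n x)
        compare (inj₂ x<x₀) = bound-< (toℕ x) (toℕ x₀ ℕ.∸ suc (toℕ x)) (sym (ℕ.m+[n∸m]≡n x<x₀))

    module _ {s : ℕ} where

      potential : Node s → Node s → ℚ
      potential (x₀ , y₀) (x , y) = c ∣ toℕ x₀ - toℕ x ∣ + c ∣ toℕ y₀ - toℕ y ∣

      private
        -- A vertical neighbour shares the first coordinate of `v`, where `f` vanishes, so only
        -- horizontal neighbours contribute and the sum becomes one-dimensional.
        ∑-coordinate : ∀ (v : Node s) (f : Fin s → ℚ) → f (proj₁ v) ≡ 0ℚ →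
          ∑ (nodes s) (λ w → adj v w * f (proj₁ w)) ≡
          ∑ (allFin s) (λ x′ → 𝟙 (∣ toℕ (proj₁ v) - toℕ x′ ∣ ≡ᵇ 1) * f x′)
        ∑-coordinate (x , y) f fx≡0 = begin
          ∑ (nodes s) (λ w → adj (x , y) w * f (proj₁ w))
            ≡⟨ ∑-cong (nodes s) (λ (x′ , y′) → pointwise x′ ∣ toℕ y - toℕ y′ ∣) ⟩
          ∑ (nodes s) (λ (x′ , y′) → 𝟙 (∣ toℕ x - toℕ x′ ∣ ≡ᵇ 1) * f x′ * 𝟙 (∣ toℕ y - toℕ y′ ∣ ≡ᵇ 0))
            ≡⟨ ∑-product (λ x′ → 𝟙 (∣ toℕ x - toℕ x′ ∣ ≡ᵇ 1) * f x′) (λ y′ → 𝟙 (∣ toℕ y - toℕ y′ ∣ ≡ᵇ 0)) ⟩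
          S * ∑ (allFin s) (λ y′ → 𝟙 (∣ toℕ y - toℕ y′ ∣ ≡ᵇ 0))
            ≡⟨ trans (cong (S *_) (hit∑ y)) (*-identityʳ S) ⟩
          S ∎
          where
          open ≡-Reasoning
          S : ℚ
          S = ∑ (allFin s) (λ x′ → 𝟙 (∣ toℕ x - toℕ x′ ∣ ≡ᵇ 1) * f x′)
          pointwise : ∀ x′ b → 𝟙 (∣ toℕ x - toℕ x′ ∣ ℕ.+ b ≡ᵇ 1) * f x′ ≡
                      𝟙 (∣ toℕ x - toℕ x′ ∣ ≡ᵇ 1) * f x′ * 𝟙 (b ≡ᵇ 0)
          pointwise x′ b with ∣ toℕ x - toℕ x′ ∣ in eq
          pointwise x′ b       | zero        = trans (cong (𝟙 (b ≡ᵇ 1) *_) fx′≡0) (trans (*-zeroʳ (𝟙 (b ≡ᵇ 1)))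
            (sym (trans (cong (λ z → 0ℚ * z * 𝟙 (b ≡ᵇ 0)) fx′≡0) (*-zeroˡ (𝟙 (b ≡ᵇ 0))))))
            where
            fx′≡0 : f x′ ≡ 0ℚ
            fx′≡0 = trans (cong f (sym (Fin.toℕ-injective (ℕ.∣m-n∣≡0⇒m≡n eq)))) fx≡0
          pointwise x′ zero    | suc zero    = sym (*-identityʳ (1ℚ * f x′))
          pointwise x′ (suc b) | suc zero    = trans (*-zeroˡ (f x′)) (sym (*-zeroʳ (1ℚ * f x′)))
          pointwise x′ b       | suc (suc a) = trans (*-zeroˡ (f x′))
            (sym (trans (cong (_* 𝟙 (b ≡ᵇ 0)) (*-zeroˡ (f x′))) (*-zeroˡ (𝟙 (b ≡ᵇ 0)))))

        flip : ∀ (f : Node s → ℚ) → ∑ (nodes s) f ≡ ∑ (nodes s) (λ (x , y) → f (y , x))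
        flip f = trans (∑-cartesianProduct (allFin s) (allFin s) f)
          (trans (∑-swap (allFin s) (allFin s) (λ x y → f (x , y)))
            (sym (∑-cartesianProduct (allFin s) (allFin s) (λ (x , y) → f (y , x)))))

        ∑-coordinate₂ : ∀ (v : Node s) (f : Fin s → ℚ) → f (proj₂ v) ≡ 0ℚ →
          ∑ (nodes s) (λ w → adj v w * f (proj₂ w)) ≡
          ∑ (allFin s) (λ y′ → 𝟙 (∣ toℕ (proj₂ v) - toℕ y′ ∣ ≡ᵇ 1) * f y′)
        ∑-coordinate₂ (x , y) f fy≡0 = trans (flip (λ w → adj (x , y) w * f (proj₂ w)))
          (trans (∑-cong (nodes s) (λ (x′ , y′) → cong (λ m → 𝟙 (m ≡ᵇ 1) * f x′)
            (ℕ.+-comm ∣ toℕ x - toℕ y′ ∣ ∣ toℕ y - toℕ x′ ∣)))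
            (∑-coordinate (y , x) f fy≡0))

      potential-step : ∀ v₀ v → 𝔼 (step v) (potential v₀) ≤ (1ℚ + ⅕ * η) * potential v₀ v
      potential-step v₀@(x₀ , y₀) v@(x , y) = begin
        𝔼 (step v) h
          ≡⟨ 𝔼-step v h ⟩
        h v + ⅕ * ∑ (nodes s) (λ w → adj v w * (h w - h v))
          ≡⟨ cong (λ z → h v + ⅕ * z) (∑-cong (nodes s) (λ w@(x′ , y′) →
               solve 5 (λ e a b c d → e :* (a :+ b :- (c :+ d)) := e :* (a :- c) :+ e :* (b :- d)) refl
                 (adj v w) (cx x′) (cy y′) (cx x) (cy y))) ⟩
        h v + ⅕ * ∑ (nodes s) (λ w → adj v w * dx (proj₁ w) + adj v w * dy (proj₂ w))
          ≡⟨ cong (λ z → h v + ⅕ * z) (trans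
               (∑-+ (nodes s) (λ w → adj v w * dx (proj₁ w)) (λ w → adj v w * dy (proj₂ w)))
               (cong₂ _+_ (∑-coordinate v dx (p-p≡0 (cx x))) (∑-coordinate₂ v dy (p-p≡0 (cy y))))) ⟩
        h v + ⅕ * (∑ (allFin s) (λ x′ → 𝟙 (∣ toℕ x - toℕ x′ ∣ ≡ᵇ 1) * dx x′) +
                   ∑ (allFin s) (λ y′ → 𝟙 (∣ toℕ y - toℕ y′ ∣ ≡ᵇ 1) * dy y′))
          ≤⟨ +-monoʳ-≤ (h v) (*-monoˡ ⅕ 0≤⅕ (+-mono-≤ (drift x₀ x) (drift y₀ y))) ⟩
        h v + ⅕ * (η * cx x + η * cy y)
          ≡⟨ solve 4 (λ f e a b → (a :+ b) :+ f :* (e :* a :+ e :* b) := (con 1ℚ :+ f :* e) :* (a :+ b)) refl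
               ⅕ η (cx x) (cy y) ⟩
        (1ℚ + ⅕ * η) * h v ∎
        where
        open ≤-Reasoning
        open +-*-Solver
        cx cy dx dy : Fin s → ℚ
        cx x′ = c ∣ toℕ x₀ - toℕ x′ ∣
        cy y′ = c ∣ toℕ y₀ - toℕ y′ ∣
        dx x′ = cx x′ - cx x
        dy y′ = cy y′ - cy y
        h : Node s → ℚ
        h = potential v₀

      potential-refl : ∀ v → potential v v ≡ c 0 + c 0
      potential-refl (x , y) = cong₂ (λ a b → c a + c b) (ℕ.∣n-n∣≡0 (toℕ x)) (ℕ.∣n-n∣≡0 (toℕ y))

      0≤potential : ∀ v w → 0ℚ ≤ potential v w
      0≤potential (x , y) (x′ , y′) = 0≤+ (0≤c ∣ toℕ x - toℕ x′ ∣) (0≤c ∣ toℕ y - toℕ y′ ∣)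

      private
        c-mono : ∀ {m n} → m ℕ.≤ n → c m ≤ c n
        c-mono {m} m≤n = go (ℕ.≤⇒≤′ m≤n)
          where
          go : ∀ {n} → m ℕ.≤′ n → c m ≤ c n
          go (ℕ.≤′-reflexive refl) = ≤-refl
          go (ℕ.≤′-step m≤′n)      = ≤-trans (go m≤′n) (mono _)

      -- At Manhattan distance 2a at least one of the two coordinates differs by a.
      potential-far : ∀ a v w → a ℕ.+ a ℕ.≤ manhattan v w → c a ≤ potential v w
      potential-far a v@(x , y) w@(x′ , y′) 2a≤d with ℕ.≤-<-connex a ∣ toℕ x - toℕ x′ ∣
      ... | inj₁ a≤dx = ≤-trans (c-mono a≤dx) (≤-+ʳ (0≤c ∣ toℕ y - toℕ y′ ∣))
      ... | inj₂ dx<a = ≤-trans (c-mono a≤dy)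
        (≤-trans (≤-reflexive (sym (+-identityˡ (c ∣ toℕ y - toℕ y′ ∣)))) (+-monoˡ-≤ _ (0≤c ∣ toℕ x - toℕ x′ ∣)))
        where
        a≤dy : a ℕ.≤ ∣ toℕ y - toℕ y′ ∣
        a≤dy = ℕ.+-cancelˡ-≤ a _ _ (ℕ.≤-trans 2a≤d (ℕ.+-monoˡ-≤ _ (ℕ.<⇒≤ dx<a)))

-- A hyperbolic cosine as potential and its growth in time and in space.

module Deviation where
  open import Defs
  open Powers
  open Steps
  open Potential
  open import Data.Rational
  open import Data.Rational.Properties
  open import Data.Rational.Solver using (module +-*-Solver)

  module Cosh (p : ℕ) where
    open +-*-Solver

    private
      q : ℕ
      q = suc p

      u v ρ σ : ℚ
      u = unit p
      v = unit q
      ρ = 1ℚ + u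
      σ = 1ℚ - v

      0≤u : 0ℚ ≤ u
      0≤u = unit-nonNeg p
      0≤v : 0ℚ ≤ v
      0≤v = unit-nonNeg q
      v≤u : v ≤ u
      v≤u = unit-anti (ℕ.n≤1+n p)
      qu≡1 : ι q * u ≡ 1ℚ
      qu≡1 = trans (*-comm (ι q) u) (/-ι 1 q)

      η : ℚ
      η = u * v

      0≤η : 0ℚ ≤ η
      0≤η = 0≤* u v 0≤u 0≤v

      u-v≡uv : u - v ≡ u * v
      u-v≡uv = begin
        u - v  ≡⟨ cong₂ _-_ (trans (sym (*-identityʳ u)) (cong (u *_) (sym (/-ι 1 (suc q)))))
                                                    (trans (sym (*-identityˡ v)) (cong (_* v) (sym (/-ι 1 q)))) ⟩
        u * (v * ι (suc q)) - u * ι q * v      ≡⟨ cong (λ z → u * (v * z) - u * ι q * v) (ι-suc q) ⟩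
        u * (v * (1ℚ + ι q)) - u * ι q * v     ≡⟨ solve 3 (λ u v q → u :* (v :* (con 1ℚ :+ q)) :- u :* q :* v := u :* v) refl u v (ι q) ⟩
        u * v  ∎
        where open ≡-Reasoning

      ρσ≡1 : ρ * σ ≡ 1ℚ
      ρσ≡1 = begin
        (1ℚ + u) * (1ℚ - v)         ≡⟨ solve 2 (λ u v → (con 1ℚ :+ u) :* (con 1ℚ :- v) := con 1ℚ :+ (u :- v) :- u :* v) refl u v ⟩
        1ℚ + (u - v) - u * v        ≡⟨ cong (λ z → 1ℚ + z - u * v) u-v≡uv ⟩
        1ℚ + u * v - u * v  ≡⟨ solve 1 (λ z → con 1ℚ :+ z :- z := con 1ℚ) refl (u * v) ⟩
        1ℚ  ∎
        where open ≡-Reasoning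

      ρ+σ : ρ + σ ≡ 1ℚ + 1ℚ + η
      ρ+σ = trans (solve 2 (λ u v → con 1ℚ :+ u :+ (con 1ℚ :- v) := con 1ℚ :+ con 1ℚ :+ (u :- v)) refl u v)
        (cong (1ℚ + 1ℚ +_) u-v≡uv)

      1≤ρ : 1ℚ ≤ ρ
      1≤ρ = ≤-+ʳ 0≤u
      0≤ρ : 0ℚ ≤ ρ
      0≤ρ = ≤-trans 0≤1 1≤ρ
      0≤σ : 0ℚ ≤ σ
      0≤σ = 0≤q-p (unit-anti {0} {q} ℕ.z≤n)
      σ≤1 : σ ≤ 1ℚ
      σ≤1 = ≤-trans (+-monoʳ-≤ 1ℚ (neg-antimono-≤ 0≤v)) (≤-reflexive (+-identityʳ 1ℚ))

    -- Twice the hyperbolic cosine of m log ρ in rational form: ρ = (q+1)/q and σ = q/(q+1) is its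
    -- inverse. It is an eigenfunction of the second difference with eigenvalue η = 1/(q(q+1)), so
    -- `convex` and `centre` hold with equality.
    c : ℕ → ℚ
    c m = ρ ** m + σ ** m

    private
      0≤c : ∀ m → 0ℚ ≤ c m
      0≤c m = 0≤+ (0≤** 0≤ρ m) (0≤** 0≤σ m)

      mono : ∀ m → c m ≤ c (suc m)
      mono m = begin
        R + S  ≡⟨ +-identityʳ (R + S) ⟨
        R + S + 0ℚ  ≤⟨ +-monoʳ-≤ (R + S) (0≤q-p vS≤uR) ⟩
        R + S + (u * R - v * S)
          ≡⟨ solve 4 (λ u v r s → r :+ s :+ (u :* r :- v :* s) := (con 1ℚ :+ u) :* r :+ (con 1ℚ :- v) :* s) refl u v R S ⟩
        ρ * R + σ * S  ∎
        where
        open ≤-Reasoning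
        R S : ℚ
        R = ρ ** m
        S = σ ** m
        vS≤uR : v * S ≤ u * R
        vS≤uR = *-mono-≤-nonNeg 0≤v (0≤** 0≤ρ m) v≤u (≤-trans (**≤1 0≤σ σ≤1 m) (1≤** 1≤ρ m))

      -- ρ and σ have product 1 and sum 2 + η, hence they are the roots of x² - (2 + η)x + 1.
      recurrence : ∀ m → c (suc (suc m)) + c m ≡ (1ℚ + 1ℚ + η) * c (suc m)
      recurrence m = begin
        (ρ * (ρ * R) + σ * (σ * S)) + (R + S)
          ≡⟨ solve 4 (λ a b r s → (a :* (a :* r) :+ b :* (b :* s)) :+ (r :+ s)
               := (a :+ b) :* (a :* r :+ b :* s) :+ (con 1ℚ :- a :* b) :* (r :+ s)) refl ρ σ R S ⟩
        (ρ + σ) * c (suc m) + (1ℚ - ρ * σ) * c m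
          ≡⟨ cong₂ (λ a b → a * c (suc m) + (1ℚ - b) * c m) ρ+σ ρσ≡1 ⟩
        (1ℚ + 1ℚ + η) * c (suc m) + (1ℚ - 1ℚ) * c m
          ≡⟨ trans (cong ((1ℚ + 1ℚ + η) * c (suc m) +_) (*-zeroˡ (c m))) (+-identityʳ _) ⟩
        (1ℚ + 1ℚ + η) * c (suc m) ∎
        where
        open ≡-Reasoning
        R S : ℚ
        R = ρ ** m
        S = σ ** m

      convex : ∀ m → (c (suc (suc m)) - c (suc m)) + (c m - c (suc m)) ≤ η * c (suc m)
      convex m = ≤-reflexive (begin
        (c (suc (suc m)) - c (suc m)) + (c m - c (suc m))
          ≡⟨ solve 3 (λ a b d → (a :- b) :+ (d :- b) := (a :+ d) :- (b :+ b)) refl (c (suc (suc m))) (c (suc m)) (c m) ⟩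
        (c (suc (suc m)) + c m) - (c (suc m) + c (suc m))
          ≡⟨ cong (_- (c (suc m) + c (suc m))) (recurrence m) ⟩
        (1ℚ + 1ℚ + η) * c (suc m) - (c (suc m) + c (suc m))
          ≡⟨ solve 2 (λ e b → (con 1ℚ :+ con 1ℚ :+ e) :* b :- (b :+ b) := e :* b) refl η (c (suc m)) ⟩
        η * c (suc m) ∎)
        where open ≡-Reasoning

      centre : (c 1 - c 0) + (c 1 - c 0) ≤ η * c 0
      centre = ≤-reflexive (begin
        (c 1 - c 0) + (c 1 - c 0)
          ≡⟨ solve 2 (λ a b → let d = (a :* con 1ℚ :+ b :* con 1ℚ) :- (con 1ℚ :+ con 1ℚ) in
               d :+ d := (a :+ b :- (con 1ℚ :+ con 1ℚ)) :* (con 1ℚ :+ con 1ℚ)) refl ρ σ ⟩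
        (ρ + σ - (1ℚ + 1ℚ)) * c 0
          ≡⟨ cong (λ z → (z - (1ℚ + 1ℚ)) * c 0) ρ+σ ⟩
        (1ℚ + 1ℚ + η - (1ℚ + 1ℚ)) * c 0
          ≡⟨ cong (_* c 0) (solve 1 (λ e → con 1ℚ :+ con 1ℚ :+ e :- (con 1ℚ :+ con 1ℚ) := e) refl η) ⟩
        η * c 0 ∎)
        where open ≡-Reasoning

    open Drift c η 0≤η 0≤c mono centre convex public

    growth : ℚ
    growth = 1ℚ + ⅕ * η

    0≤growth : 0ℚ ≤ growth
    0≤growth = 0≤+ 0≤1 (0≤* ⅕ η 0≤⅕ 0≤η)

    -- Since η ≤ 1/q², over q² steps the factor 1 + η/5 accumulates to at most 1 + 2/5, hence to
    -- less than 2.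
    growth-bound : ∀ i {ℓ} → ℓ ℕ.≤ i ℕ.* (q ℕ.* q) → growth ** ℓ ≤ ι 2 ** i
    growth-bound i {ℓ} ℓ≤ = begin
      growth ** ℓ  ≤⟨ **-monoʳ (≤-+ʳ (0≤* ⅕ η 0≤⅕ 0≤η)) ℓ≤ ⟩
      growth ** (i ℕ.* (q ℕ.* q))       ≡⟨ **-* growth i (q ℕ.* q) ⟩
      (growth ** (q ℕ.* q)) ** i        ≤⟨ **-monoˡ (0≤** 0≤growth (q ℕ.* q)) ≤2 i ⟩
      ι 2 ** i  ∎
      where
      open ≤-Reasoning
      N : ℚ
      N = ι (q ℕ.* q)
      2Nx≤1 : (N + N) * (⅕ * η) ≤ 1ℚ
      2Nx≤1 = begin
        (N + N) * (⅕ * (u * v))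
          ≤⟨ *-monoˡ (N + N) (0≤+ (0≤ι (q ℕ.* q)) (0≤ι (q ℕ.* q))) (*-monoˡ ⅕ 0≤⅕ (*-monoˡ u 0≤u v≤u)) ⟩
        (N + N) * (⅕ * (u * u))
          ≡⟨ cong (λ z → (z + z) * (⅕ * (u * u))) (ι-* q q) ⟩
        (ι q * ι q + ι q * ι q) * (⅕ * (u * u))
          ≡⟨ solve 3 (λ q u f → (q :* q :+ q :* q) :* (f :* (u :* u)) := (f :+ f) :* ((q :* u) :* (q :* u))) refl (ι q) u ⅕ ⟩
        (⅕ + ⅕) * ((ι q * u) * (ι q * u))
          ≡⟨ cong (λ z → (⅕ + ⅕) * (z * z)) qu≡1 ⟩
        (⅕ + ⅕) * (1ℚ * 1ℚ)
          ≤⟨ ≤ᵇ⇒≤ _ ⟩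
        1ℚ ∎
      ≤2 : growth ** (q ℕ.* q) ≤ ι 2
      ≤2 = ≤-trans (**≤1+2nx (0≤* ⅕ η 0≤⅕ 0≤η) (q ℕ.* q) 2Nx≤1) (+-monoʳ-≤ 1ℚ 2Nx≤1)

    -- (1 + 1/q)^q ≥ 2 by Bernoulli. Together with `growth-bound` this is diffusive scaling: the
    -- potential doubles with every q units of distance, its expectation at most with every q²
    -- steps.
    c-growth : ∀ j → ι 2 ** j ≤ c (j ℕ.* q)
    c-growth j = begin
      ι 2 ** j  ≤⟨ **-monoˡ (0≤ι 2) 2≤ρ^q j ⟩
      (ρ ** q) ** j        ≡⟨ **-* ρ j q ⟨
      ρ ** (j ℕ.* q)       ≤⟨ ≤-+ʳ (0≤** 0≤σ (j ℕ.* q)) ⟩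
      c (j ℕ.* q)  ∎
      where
      open ≤-Reasoning
      2≤ρ^q : ι 2 ≤ ρ ** q
      2≤ρ^q = ≤-trans (≤-reflexive (cong (1ℚ +_) (sym qu≡1))) (bernoulli 0≤u q)

-- The joint process of the agents and a calculus of likely events.

module Walks where
  open import Defs
  open Powers
  open Expectation
  open Steps
  open import Data.List using (List; []; _∷_; length)
  open import Data.Rational
  open import Data.Rational.Properties
  open import Data.Vec as Vec using (Vec; []; _∷_; lookup; replicate; head; tail)
  open import Data.Vec.Properties using (lookup-map; lookup-replicate)

  1-anti : ∀ {p q} → p ≤ q → 1ℚ - q ≤ 1ℚ - p
  1-anti p≤q = +-monoʳ-≤ 1ℚ (neg-antimono-≤ p≤q)

  -- Markov's inequality for the complementary event, before expectations are taken.
  1-p≤𝟙[p<1] : ∀ {p} → 0ℚ ≤ p → 1ℚ - p ≤ 𝟙 (not (1ℚ ≤ᵇ p))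
  1-p≤𝟙[p<1] {p} 0≤p with 1ℚ ≤ᵇ p in eq
  ... | true  = 1-anti (≤ᵇ⇒≤ {1ℚ} {p} (subst T (sym eq) tt))
  ... | false = 1-anti 0≤p

  module Process (s k : ℕ) .{{_ : ℕ.NonZero s}} where

    private
      C : Set
      C = Config s k

    initial : Dist C
    initial = independent (replicate k (uniform (nodes s)))

    move : C → Dist C
    move c = independent (Vec.map step c)

    replicate-isProbability : ∀ m i → IsProbability (lookup (replicate m (uniform (nodes s))) i)
    replicate-isProbability m i = subst IsProbability (sym (lookup-replicate i (uniform (nodes s)))) node-isProbability

    initial-isProbability : IsProbability initial
    initial-isProbability = independent-isProbability (replicate k (uniform (nodes s))) (replicate-isProbability k)

    steps-isProbability : ∀ (c : C) i → IsProbability (lookup (Vec.map step c) i)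
    steps-isProbability c i = subst IsProbability (sym (lookup-map i step c)) (step-isProbability (lookup c i))

    move-isProbability : ∀ (c : C) → IsProbability (move c)
    move-isProbability c = independent-isProbability (Vec.map step c) (steps-isProbability c)

    𝔼-move-agent : ∀ (c : C) a f → 𝔼 (move c) (λ c′ → f (lookup c′ a)) ≡ 𝔼 (step (lookup c a)) f
    𝔼-move-agent c a f = trans (𝔼-marginal (Vec.map step c) (steps-isProbability c) a f)
      (cong (λ d → 𝔼 d f) (lookup-map a step c))

    walk-isProbability : ∀ t → IsProbability (walk s k t)
    walk-isProbability zero    = >>=-isProbability initial-isProbability (λ c → pure-isProbability (c ∷ []))
    walk-isProbability (suc t) = >>=-isProbability (walk-isProbability t) λ cs →
      >>=-isProbability (move-isProbability (head cs)) λ c → pure-isProbability (c ∷ cs)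

    𝔼-walk-zero : ∀ F → 𝔼 (walk s k 0) F ≡ 𝔼 initial (λ c → F (c ∷ []))
    𝔼-walk-zero F = trans (𝔼->>= initial (λ c → pure (c ∷ [])) F) (𝔼-cong initial λ c → 𝔼-pure (c ∷ []) F)

    𝔼-walk-suc : ∀ t F → 𝔼 (walk s k (suc t)) F ≡ 𝔼 (walk s k t) (λ cs → 𝔼 (move (head cs)) (λ c → F (c ∷ cs)))
    𝔼-walk-suc t F = trans
      (𝔼->>= (walk s k t) (λ cs → move (head cs) >>= λ c → pure (c ∷ cs)) F)
      (𝔼-cong (walk s k t) λ cs → trans (𝔼->>= (move (head cs)) (λ c → pure (c ∷ cs)) F)
        (𝔼-cong (move (head cs)) λ c → 𝔼-pure (c ∷ cs) F))

    𝔼-walk-head : ∀ t f → 𝔼 (walk s k t) (f ∘ head) ≡ 𝔼 initial f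
    𝔼-walk-head zero    f = 𝔼-walk-zero (f ∘ head)
    𝔼-walk-head (suc t) f = begin
      𝔼 (walk s k (suc t)) (f ∘ head)  ≡⟨ 𝔼-walk-suc t (f ∘ head) ⟩
      𝔼 (walk s k t) (λ cs → 𝔼 (move (head cs)) f)       ≡⟨ 𝔼-walk-head t (λ c → 𝔼 (move c) f) ⟩
      𝔼 initial (λ c → 𝔼 (move c) f)  ≡⟨ 𝔼-stationary (uniform (nodes s)) step step-stationary k f ⟩
      𝔼 initial f  ∎
      where open ≡-Reasoning

    head-history : ∀ ω t → head (history s k ω t) ≡ ω t
    head-history ω zero    = refl
    head-history ω (suc t) = refl

    -- Q holds outside an event of probability at most ε; by Markov's inequality that
    -- event may be given as {score ≥ 1} with score of expectation at most ε.
    record Whp (t : ℕ) (ε : ℚ) (Q : Pred (Path s k) 0ℓ) : Set where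
      field
        score   : Vec C (suc t) → ℚ
        0≤score : ∀ cs → 0ℚ ≤ score cs
        score≤ε : 𝔼 (walk s k t) score ≤ ε
        sound   : ∀ ω → score (history s k ω t) < 1ℚ → Q ω

    open Whp

    -- Rational comparison is decidable, so {score < 1} is an admissible cylinder event even where
    -- `Q` itself is not decidable.
    Whp⇒HasProbability≥ : ∀ {t ε p Q} → Whp t ε Q → p ≤ 1ℚ - ε → HasProbability≥ s k Q p
    Whp⇒HasProbability≥ {t} {ε} {p} {Q} w p≤ = t , D , p≤Pr , λ ω → sound w ω ∘ D⇒< (history s k ω t)
      where
      open ≤-Reasoning
      D : Vec C (suc t) → Bool
      D cs = not (1ℚ ≤ᵇ score w cs)
      D⇒< : ∀ cs → T (D cs) → score w cs < 1ℚ
      D⇒< cs Dcs with 1ℚ ≤ᵇ score w cs in eq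
      ... | false = ≰⇒> λ 1≤ → subst T eq (≤⇒≤ᵇ 1≤)
      p≤Pr : p ≤ Pr (walk s k t) D
      p≤Pr = begin
        p  ≤⟨ p≤ ⟩
        1ℚ - ε  ≤⟨ 1-anti (score≤ε w) ⟩
        1ℚ - 𝔼 (walk s k t) (score w)
          ≡⟨ cong₂ _+_ (sym (𝔼-const (walk-isProbability t) 1ℚ))
               (trans (neg-distribˡ-* 1ℚ (𝔼 (walk s k t) (score w)) |> λ eq →
                 trans (cong -_ (sym (*-identityˡ (𝔼 (walk s k t) (score w))))) eq)
                 (sym (𝔼-*ˡ (walk s k t) (- 1ℚ) (score w)))) ⟩
        𝔼 (walk s k t) (λ _ → 1ℚ) + 𝔼 (walk s k t) (λ cs → - 1ℚ * score w cs)
          ≡⟨ 𝔼-+ (walk s k t) (λ _ → 1ℚ) (λ cs → - 1ℚ * score w cs) ⟨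
        𝔼 (walk s k t) (λ cs → 1ℚ + - 1ℚ * score w cs)
          ≤⟨ 𝔼-mono (walk-isProbability t) (λ cs → ≤-trans
               (≤-reflexive (cong (1ℚ +_) (trans (sym (neg-distribˡ-* 1ℚ (score w cs))) (cong -_ (*-identityˡ (score w cs))))))
               (1-p≤𝟙[p<1] (0≤score w cs))) ⟩
        𝔼 (walk s k t) (𝟙 ∘ D)  ≡⟨ Pr≡𝔼 (walk s k t) D ⟨
        Pr (walk s k t) D  ∎


    whp-mono : ∀ {t ε ε′} {Q Q′ : Pred (Path s k) 0ℓ} → ε ≤ ε′ → (∀ ω → Q ω → Q′ ω) → Whp t ε Q → Whp t ε′ Q′
    whp-mono ε≤ε′ Q⊆Q′ w = record
      { score   = score w
      ; 0≤score = 0≤score w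
      ; score≤ε = ≤-trans (score≤ε w) ε≤ε′
      ; sound   = λ ω → Q⊆Q′ ω ∘ sound w ω
      }

    whp-always : ∀ {t} {Q : Pred (Path s k) 0ℓ} → (∀ ω → Q ω) → Whp t 0ℚ Q
    whp-always {t} q = record
      { score   = λ _ → 0ℚ
      ; 0≤score = λ _ → ≤-refl
      ; score≤ε = ≤-reflexive (𝔼-0 (walk s k t))
      ; sound   = λ ω _ → q ω
      }

    -- The union bound: scores add up, and if a sum of nonnegative scores is below 1, so is each of
    -- them.
    whp-× : ∀ {t ε ε′} {Q Q′ : Pred (Path s k) 0ℓ} → Whp t ε Q → Whp t ε′ Q′ → Whp t (ε + ε′) (λ ω → Q ω × Q′ ω)
    whp-× {t} w w′ = record
      { score   = λ cs → score w cs + score w′ cs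
      ; 0≤score = λ cs → 0≤+ (0≤score w cs) (0≤score w′ cs)
      ; score≤ε = ≤-trans (≤-reflexive (𝔼-+ (walk s k t) (score w) (score w′))) (+-mono-≤ (score≤ε w) (score≤ε w′))
      ; sound   = λ ω <1 → sound w ω (≤-<-trans (≤-+ʳ (0≤score w′ (history s k ω t))) <1)
                         , sound w′ ω (≤-<-trans (≤-trans (≤-reflexive (sym (+-identityˡ _)))
                             (+-monoˡ-≤ _ (0≤score w (history s k ω t)))) <1)
      }

    whp-∀Fin : ∀ {t ε m} {Q : Fin m → Pred (Path s k) 0ℓ} → (∀ i → Whp t ε (Q i)) →
      Whp t (ι m * ε) (λ ω → ∀ i → Q i ω)
    whp-∀Fin {ε = ε} {zero}  w = whp-mono (≤-reflexive (sym (*-zeroˡ ε))) (λ _ q → q) (whp-always λ _ ())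
    whp-∀Fin {t} {ε} {suc m} {Q} w = whp-mono
      (≤-reflexive (begin
        ε + ι m * ε  ≡⟨ cong (_+ ι m * ε) (*-identityˡ ε) ⟨
        1ℚ * ε + ι m * ε      ≡⟨ *-distribʳ-+ ε 1ℚ (ι m) ⟨
        (1ℚ + ι m) * ε        ≡⟨ cong (_* ε) (ι-suc m) ⟨
        ι (suc m) * ε         ∎))
      (λ { ω (q , qs) zero → q ; ω (q , qs) (suc i) → qs i })
      (whp-× (w zero) (whp-∀Fin {Q = Q ∘ suc} (w ∘ suc)))
      where open ≡-Reasoning

    whp-∀< : ∀ {t ε} {Q : ℕ → Pred (Path s k) 0ℓ} m → (∀ i → i ℕ.< m → Whp t ε (Q i)) →
      Whp t (ι m * ε) (λ ω → ∀ i → i ℕ.< m → Q i ω)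
    whp-∀< {Q = Q} m w = whp-mono ≤-refl
      (λ ω q i i<m → subst (λ j → Q j ω) (Fin.toℕ-fromℕ< i<m) (q (fromℕ< i<m)))
      (whp-∀Fin {Q = λ j → Q (toℕ j)} (λ j → w (toℕ j) (Fin.toℕ<n j)))

    whp-∀List : ∀ {t ε m} n {Q : List (Fin m) → Pred (Path s k) 0ℓ} → (∀ l → length l ≡ n → Whp t ε (Q l)) →
      Whp t (ι m ** n * ε) (λ ω → ∀ l → length l ≡ n → Q l ω)
    whp-∀List {ε = ε} zero w = whp-mono (≤-reflexive (sym (*-identityˡ ε)))
      (λ { ω q [] refl → q }) (w [] refl)
    whp-∀List {t} {ε} {m} (suc n) {Q} w = whp-mono
      (≤-reflexive (sym (*-assoc (ι m) (ι m ** n) ε)))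
      (λ { ω q (a ∷ l) refl → q a l refl })
      (whp-∀Fin λ a → whp-∀List n {λ l → Q (a ∷ l)} (λ l eq → w (a ∷ l) (cong suc eq)))

    whp-suc : ∀ {t ε Q} → Whp t ε Q → Whp (suc t) ε Q
    whp-suc {t} w = record
      { score   = score w ∘ tail
      ; 0≤score = 0≤score w ∘ tail
      ; score≤ε = ≤-trans (≤-reflexive (trans (𝔼-walk-suc t (score w ∘ tail))
          (𝔼-cong (walk s k t) λ cs → 𝔼-const (move-isProbability (head cs)) (score w cs)))) (score≤ε w)
      ; sound   = sound w
      }

    whp-later : ∀ {t t′ ε Q} → t ℕ.≤ t′ → Whp t ε Q → Whp t′ ε Q
    whp-later {t} t≤t′ w = go (ℕ.≤⇒≤′ t≤t′)
      where
      go : ∀ {t′} → t ℕ.≤′ t′ → Whp t′ _ _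
      go (ℕ.≤′-reflexive refl) = w
      go (ℕ.≤′-step t≤′t′)     = whp-suc (go t≤′t′)

    whp-static : ∀ t {ε} {Q : Pred C 0ℓ} f → (∀ c → 0ℚ ≤ f c) → 𝔼 initial f ≤ ε → (∀ c → f c < 1ℚ → Q c) →
      Whp t ε (λ ω → Q (ω t))
    whp-static t {Q = Q} f 0≤f 𝔼f≤ε f⇒Q = record
      { score   = f ∘ head
      ; 0≤score = 0≤f ∘ head
      ; score≤ε = ≤-trans (≤-reflexive (𝔼-walk-head t f)) 𝔼f≤ε
      ; sound   = λ ω <1 → subst Q (head-history ω t) (f⇒Q _ <1)
      }

    past : ∀ {i} δ → Vec C (suc (δ ℕ.+ i)) → C
    past zero    cs = head cs
    past (suc δ) cs = past δ (tail cs)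

    past-history : ∀ ω i δ → past {i} δ (history s k ω (δ ℕ.+ i)) ≡ ω i
    past-history ω i zero    = head-history ω i
    past-history ω i (suc δ) = past-history ω i δ

    module _ (φ : ℕ → C → C → ℚ) (M B : ℚ) (0≤M : 0ℚ ≤ M) (base : ∀ c → φ 0 c c ≤ B)
      (contract : ∀ δ c c′ → 𝔼 (move c′) (φ (suc δ) c) ≤ M * φ δ c c′) where

      -- After division by `M ** δ` the functional is a supermartingale. It compares the present
      -- configuration with the one δ steps ago and may itself change with δ.
      𝔼-evolve : ∀ i δ → 𝔼 (walk s k (δ ℕ.+ i)) (λ cs → φ δ (past δ cs) (head cs)) ≤ M ** δ * B
      𝔼-evolve i zero    = 𝔼-≤const (walk-isProbability i) λ cs →
        ≤-trans (base (head cs)) (≤-reflexive (sym (*-identityˡ B)))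
      𝔼-evolve i (suc δ) = begin
        𝔼 (walk s k (suc δ ℕ.+ i)) (λ cs → φ (suc δ) (past (suc δ) cs) (head cs))
          ≡⟨ 𝔼-walk-suc (δ ℕ.+ i) (λ cs → φ (suc δ) (past (suc δ) cs) (head cs)) ⟩
        𝔼 (walk s k (δ ℕ.+ i)) (λ cs → 𝔼 (move (head cs)) (φ (suc δ) (past δ cs)))
          ≤⟨ 𝔼-mono (walk-isProbability (δ ℕ.+ i)) (λ cs → contract δ (past δ cs) (head cs)) ⟩
        𝔼 (walk s k (δ ℕ.+ i)) (λ cs → M * φ δ (past δ cs) (head cs))
          ≡⟨ 𝔼-*ˡ (walk s k (δ ℕ.+ i)) M (λ cs → φ δ (past δ cs) (head cs)) ⟩
        M * 𝔼 (walk s k (δ ℕ.+ i)) (λ cs → φ δ (past δ cs) (head cs))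
          ≤⟨ *-monoˡ M 0≤M (𝔼-evolve i δ) ⟩
        M * (M ** δ * B)
          ≡⟨ *-assoc M (M ** δ) B ⟨
        M ** suc δ * B ∎
        where open ≤-Reasoning

      -- The weight `w` normalises the threshold: the exceptional event is that `φ` reaches 1/w.
      whp-dynamic : ∀ i δ {ε w} {Q : C → C → Set} → (∀ c c′ → 0ℚ ≤ φ δ c c′) → 0ℚ ≤ w → w * (M ** δ * B) ≤ ε →
        (∀ c c′ → w * φ δ c c′ < 1ℚ → Q c c′) → Whp (δ ℕ.+ i) ε (λ ω → Q (ω i) (ω (δ ℕ.+ i)))
      whp-dynamic i δ {w = w} {Q} 0≤φ 0≤w ≤ε φ⇒Q = record
        { score   = λ cs → w * φ δ (past δ cs) (head cs)
        ; 0≤score = λ cs → 0≤* w _ 0≤w (0≤φ (past δ cs) (head cs))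
        ; score≤ε = ≤-trans (≤-reflexive (𝔼-*ˡ (walk s k (δ ℕ.+ i)) w (λ cs → φ δ (past δ cs) (head cs))))
            (≤-trans (*-monoˡ w 0≤w (𝔼-evolve i δ)) ≤ε)
        ; sound   = λ ω <1 → subst (λ c → Q c (ω (δ ℕ.+ i))) (past-history ω i δ)
            (subst (Q _) (head-history ω (δ ℕ.+ i)) (φ⇒Q _ _ <1))
        }

-- Probability estimates for moves, paths of close agents, isolation and distance.

module Events where
  open import Defs
  open Powers
  open Expectation
  open Steps
  open Deviation
  open Walks
  open import Data.Bool.ListAction using (any)
  open import Data.List using (List; []; _∷_; length; map; allFin)
  open import Data.List.Properties using (length-map; length-tabulate)
  open import Data.List.Relation.Unary.All using (All; []; _∷_)
  open import Data.List.Relation.Unary.AllPairs using ([]; _∷_)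
  open import Data.List.Relation.Unary.Unique.Propositional using (Unique)
  open import Data.List.Relation.Unary.Unique.Propositional.Properties using (allFin⁺)
  open import Data.Nat using (_≤ᵇ_)
  open import Data.Rational hiding (_≤ᵇ_)
  open import Data.Rational.Properties hiding (≤ᵇ⇒≤; ≤⇒≤ᵇ)
  import Data.Rational.Properties as ℚ
  open import Data.Rational.Solver using (module +-*-Solver)
  open import Data.Vec using (Vec; []; _∷_; lookup; replicate; toList; _[_]≔_)
  open import Data.Vec.Properties using (lookup-replicate; lookup∘update; lookup∘update′; length-toList)
  open import Data.List.Relation.Unary.Unique.DecPropositional using (unique?)

  ¼ : ℚ
  ¼ = ½ * ½

  ½2** : ∀ n → ½ ** n * ι 2 ** n ≡ 1ℚ
  ½2** n = trans (sym (*-** ½ (ι 2) n)) (1**n≡1 n)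

  Near : ∀ {s k} → ℕ → Config s k → Fin k × Fin k → Set
  Near m c (a , b) = manhattan (lookup c b) (lookup c a) ℕ.≤ m

  links : {A : Set} → List A → List (A × A)
  links []          = []
  links (a ∷ [])    = []
  links (a ∷ b ∷ l) = (a , b) ∷ links (b ∷ l)

  length-links : ∀ {A : Set} h (l : List A) → length l ≡ suc h → length (links l) ≡ h
  length-links zero    (a ∷ [])    refl = refl
  length-links (suc h) (a ∷ b ∷ l) eq   = cong suc (length-links h (b ∷ l) (ℕ.suc-injective eq))

  module _ {s k : ℕ} .{{_ : ℕ.NonZero s}} where
    open Process s k

    private
      C : Set
      C = Config s k
      u : Dist (Node s)
      u = uniform (nodes s)

    -- A path is an arbitrary sequence of configurations and may contain jumps, so even this holds
    -- only outside a null event. The functional is the indicator of having left the ball of radius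
    -- δ: it starts at 0, and one step cannot leave the next larger ball from within the present
    -- one.
    whp-bounded-moves : ∀ a i δ → Whp (δ ℕ.+ i) 0ℚ (λ ω → manhattan (lookup (ω i) a) (lookup (ω (δ ℕ.+ i)) a) ℕ.≤ δ)
    whp-bounded-moves a i δ = whp-dynamic φ 1ℚ 0ℚ 0≤1 base contract i δ
      (λ c c′ → 0≤𝟙 (not (manhattan (lookup c a) (lookup c′ a) ≤ᵇ δ))) 0≤1
      (≤-reflexive (trans (*-identityˡ (1ℚ ** δ * 0ℚ)) (*-zeroʳ (1ℚ ** δ)))) small
      where
      φ : ℕ → C → C → ℚ
      φ δ c c′ = 𝟙 (not (manhattan (lookup c a) (lookup c′ a) ≤ᵇ δ))
      base : ∀ c → φ 0 c c ≤ 0ℚ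
      base c rewrite manhattan-refl (lookup c a) = ≤-refl
      contract : ∀ δ c c′ → 𝔼 (move c′) (φ (suc δ) c) ≤ 1ℚ * φ δ c c′
      contract δ c c′ = ≤-trans
        (≤-reflexive (𝔼-move-agent c′ a (λ w → 𝟙 (not (manhattan (lookup c a) w ≤ᵇ suc δ)))))
        (𝔼-step≤ (lookup c′ a) _ _ λ w v→w → ≤-trans (step-out w v→w) (≤-reflexive (sym (*-identityˡ (φ δ c c′)))))
        where
        step-out : ∀ w → manhattan (lookup c′ a) w ℕ.≤ 1 → 𝟙 (not (manhattan (lookup c a) w ≤ᵇ suc δ)) ≤ φ δ c c′
        step-out w v→w with manhattan (lookup c a) (lookup c′ a) ≤ᵇ δ in eq
        ... | false = 𝟙≤1 (not (manhattan (lookup c a) w ≤ᵇ suc δ))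
        ... | true rewrite ≤⇒true (ℕ.≤-trans (manhattan-triangle (lookup c a) (lookup c′ a) w)
                            (ℕ.≤-trans (ℕ.+-mono-≤ (ℕ.≤ᵇ⇒≤ (manhattan (lookup c a) (lookup c′ a)) δ (subst T (sym eq) tt)) v→w)
                              (ℕ.≤-reflexive (ℕ.+-comm δ 1)))) = ≤-refl
      small : ∀ c c′ → 1ℚ * φ δ c c′ < 1ℚ → manhattan (lookup c a) (lookup c′ a) ℕ.≤ δ
      small c c′ <1 with manhattan (lookup c a) (lookup c′ a) ≤ᵇ δ in eq
      ... | true  = ℕ.≤ᵇ⇒≤ _ δ (subst T (sym eq) tt)
      ... | false = contradiction <1 (<-irrefl refl)

    -- With q = p + 1, in at most I blocks of q² steps the expected potential grows from 4 to at
    -- most 4 · 2^I. A move longer than 6Iq has more than 3Iq in one coordinate or is otherwise of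
    -- potential at least 8^I, so Markov's inequality leaves 4 · 4^-I.
    whp-typical-moves : ∀ p I a i δ → δ ℕ.≤ I ℕ.* (suc p ℕ.* suc p) →
      Whp (δ ℕ.+ i) (ι 4 * ¼ ** I) (λ ω → manhattan (lookup (ω i) a) (lookup (ω (δ ℕ.+ i)) a) ℕ.≤
        (3 ℕ.* I) ℕ.* suc p ℕ.+ (3 ℕ.* I) ℕ.* suc p)
    whp-typical-moves p I a i δ δ≤ = whp-dynamic φ growth (c 0 + c 0) 0≤growth base contract i δ
      (λ c c′ → 0≤potential (lookup c a) (lookup c′ a)) (0≤** 0≤½ (3 ℕ.* I)) total small
      where
      open Cosh p
      open ≤-Reasoning
      0≤½ : 0ℚ ≤ ½
      0≤½ = nonNegative⁻¹ ½
      φ : ℕ → C → C → ℚ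
      φ _ c c′ = potential (lookup c a) (lookup c′ a)
      base : ∀ c′ → φ 0 c′ c′ ≤ c 0 + c 0
      base c′ = ≤-reflexive (potential-refl (lookup c′ a))
      contract : ∀ δ c c′ → 𝔼 (move c′) (φ (suc δ) c) ≤ growth * φ δ c c′
      contract δ c c′ = ≤-trans (≤-reflexive (𝔼-move-agent c′ a (potential (lookup c a))))
        (potential-step (lookup c a) (lookup c′ a))
      total : ½ ** (3 ℕ.* I) * (growth ** δ * (c 0 + c 0)) ≤ ι 4 * ¼ ** I
      total = begin
        ½ ** (3 ℕ.* I) * (growth ** δ * ι 4)
          ≤⟨ *-monoˡ (½ ** (3 ℕ.* I)) (0≤** 0≤½ (3 ℕ.* I)) (*-monoʳ (ι 4) (0≤ι 4) (growth-bound I δ≤)) ⟩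
        ½ ** (3 ℕ.* I) * (ι 2 ** I * ι 4)
          ≡⟨ cong (λ z → z * (ι 2 ** I * ι 4)) (trans (cong (½ **_) (ℕ.*-comm 3 I)) (**-* ½ I 3)) ⟩
        (½ ** 3) ** I * (ι 2 ** I * ι 4)
          ≡⟨ cong (_* (ι 2 ** I * ι 4)) (*-** ½ ¼ I) ⟩
        (½ ** I * ¼ ** I) * (ι 2 ** I * ι 4)
          ≡⟨ solve 4 (λ h q t f → (h :* q) :* (t :* f) := (h :* t) :* (f :* q)) refl (½ ** I) (¼ ** I) (ι 2 ** I) (ι 4) ⟩
        (½ ** I * ι 2 ** I) * (ι 4 * ¼ ** I)
          ≡⟨ trans (cong (_* (ι 4 * ¼ ** I)) (½2** I)) (*-identityˡ (ι 4 * ¼ ** I)) ⟩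
        ι 4 * ¼ ** I ∎
        where open +-*-Solver
      A : ℕ
      A = (3 ℕ.* I) ℕ.* suc p
      small : ∀ c c′ → ½ ** (3 ℕ.* I) * φ δ c c′ < 1ℚ → manhattan (lookup c a) (lookup c′ a) ℕ.≤ A ℕ.+ A
      small c₁ c′ <1 = ℕ.≮⇒≥ λ far → <-irrefl refl (≤-<-trans (begin
        1ℚ  ≡⟨ ½2** (3 ℕ.* I) ⟨
        ½ ** (3 ℕ.* I) * ι 2 ** (3 ℕ.* I)
          ≤⟨ *-monoˡ (½ ** (3 ℕ.* I)) (0≤** 0≤½ (3 ℕ.* I)) (≤-trans (c-growth (3 ℕ.* I))
               (potential-far A (lookup c₁ a) (lookup c′ a) (ℕ.<⇒≤ far))) ⟩
        ½ ** (3 ℕ.* I) * φ δ c₁ c′  ∎) <1)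

    module _ (m : ℕ) (β : ℚ) (0≤β : 0ℚ ≤ β)
      (ball : ∀ v → 𝔼 u (λ w → 𝟙 (manhattan v w ≤ᵇ m)) ≤ β) where

      near : C → Fin k × Fin k → ℚ
      near c (a , b) = 𝟙 (manhattan (lookup c b) (lookup c a) ≤ᵇ m)

      allNear : List (Fin k × Fin k) → C → ℚ
      allNear []      c = 1ℚ
      allNear (e ∷ l) c = allNear l c * near c e

      -- An order in which leaves can be pruned: the agent in front of each pair is absent from all
      -- later pairs, whereas its partner may recur.
      data Forest : List (Fin k × Fin k) → Set where
        []  : Forest []
        _∷_ : ∀ {a b l} → a ≢ b × All (λ (a′ , b′) → a′ ≢ a × b′ ≢ a) l → Forest l → Forest ((a , b) ∷ l)

      0≤allNear : ∀ l c → 0ℚ ≤ allNear l c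
      0≤allNear []            c = 0≤1
      0≤allNear ((a , b) ∷ l) c = 0≤* (allNear l c) (near c (a , b)) (0≤allNear l c)
        (0≤𝟙 (manhattan (lookup c b) (lookup c a) ≤ᵇ m))

      allNear-update : ∀ {a} l c y → All (λ (a′ , b′) → a′ ≢ a × b′ ≢ a) l → allNear l (c [ a ]≔ y) ≡ allNear l c
      allNear-update []               c y []                     = refl
      allNear-update {a} ((a′ , b′) ∷ l) c y ((a′≢a , b′≢a) ∷ fresh) = cong₂ _*_ (allNear-update l c y fresh)
        (cong₂ (λ v w → 𝟙 (manhattan v w ≤ᵇ m)) (lookup∘update′ b′≢a c y) (lookup∘update′ a′≢a c y))

      -- The tail of the list does not involve a, so that the position of a can be resampled.
      𝔼-allNear : ∀ {l} → Forest l → 𝔼 initial (allNear l) ≤ β ** length l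
      𝔼-allNear []                               = ≤-reflexive (mass initial-isProbability)
      𝔼-allNear {(a , b) ∷ l} ((a≢b , fresh) ∷ forest) = begin
        𝔼 initial (allNear ((a , b) ∷ l))
          ≡⟨ 𝔼-resample (replicate k u) (replicate-isProbability k) a (allNear ((a , b) ∷ l)) ⟩
        𝔼 initial (λ c → 𝔼 (lookup (replicate k u) a) (λ y → allNear ((a , b) ∷ l) (c [ a ]≔ y)))
          ≡⟨ 𝔼-cong initial (λ c → trans (cong (λ d → 𝔼 d (λ y → allNear ((a , b) ∷ l) (c [ a ]≔ y))) (lookup-replicate a u))
               (𝔼-cong u (λ y → cong₂ _*_ (allNear-update l c y fresh)
                 (cong₂ (λ v w → 𝟙 (manhattan v w ≤ᵇ m)) (lookup∘update′ (≢-sym a≢b) c y) (lookup∘update a c y))))) ⟩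
        𝔼 initial (λ c → 𝔼 u (λ y → allNear l c * 𝟙 (manhattan (lookup c b) y ≤ᵇ m)))
          ≡⟨ 𝔼-cong initial (λ c → 𝔼-*ˡ u (allNear l c) (λ y → 𝟙 (manhattan (lookup c b) y ≤ᵇ m))) ⟩
        𝔼 initial (λ c → allNear l c * 𝔼 u (λ y → 𝟙 (manhattan (lookup c b) y ≤ᵇ m)))
          ≤⟨ 𝔼-mono initial-isProbability (λ c → *-monoˡ (allNear l c) (0≤allNear l c) (ball (lookup c b))) ⟩
        𝔼 initial (λ c → allNear l c * β)
          ≡⟨ 𝔼-*ʳ initial β (allNear l) ⟩
        𝔼 initial (allNear l) * β
          ≤⟨ *-monoʳ β 0≤β (𝔼-allNear forest) ⟩
        β ** length l * β
          ≡⟨ *-comm (β ** length l) β ⟩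
        β ** suc (length l) ∎
        where
        open ≤-Reasoning

      whp-forest : ∀ t {l} → Forest l → Whp t (β ** length l) (λ ω → ¬ All (Near m (ω t)) l)
      whp-forest t {l} forest = whp-static t (allNear l) (0≤allNear l) (𝔼-allNear forest)
        λ c <1 near → <-irrefl (all⇒1 c near) <1
        where
        all⇒1 : ∀ c {l} → All (Near m c) l → allNear l c ≡ 1ℚ
        all⇒1 c []       = refl
        all⇒1 c (p ∷ ps) = cong₂ (λ a b → a * 𝟙 b) (all⇒1 c ps) (≤⇒true p)

      links-forest : ∀ {l} → Unique l → Forest (links l)
      links-forest {[]}        []               = []
      links-forest {a ∷ []}    _                = []
      links-forest {a ∷ b ∷ l} ((a≢b ∷ a∉l) ∷ unique) = (a≢b , fresh (a≢b ∷ a∉l)) ∷ links-forest unique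
        where
        fresh : ∀ {a l} → All (a ≢_) l → All (λ (a′ , b′) → a′ ≢ a × b′ ≢ a) (links l)
        fresh []                  = []
        fresh (_ ∷ [])            = []
        fresh (p ∷ q ∷ r)         = (≢-sym p , ≢-sym q) ∷ fresh (q ∷ r)

      -- There are k^(h+1) lists, and the h links of a repetition-free list form a forest, which has
      -- all its pairs close with probability at most β^h.
      whp-no-long-path : ∀ t h → Whp t (ι k * (ι k * β) ** h)
        (λ ω → ∀ l → length l ≡ suc h → Unique l → ¬ All (Near m (ω t)) (links l))
      whp-no-long-path t h = whp-mono
        (≤-reflexive (trans (*-assoc (ι k) (ι k ** h) (β ** h)) (cong (ι k *_) (sym (*-** (ι k) β h)))))
        (λ _ q → q)
        (whp-∀List (suc h) λ l len → one l len (unique? Fin._≟_ l))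
        where
        one : ∀ l → length l ≡ suc h → Dec (Unique l) → Whp t (β ** h) (λ ω → Unique l → ¬ All (Near m (ω t)) (links l))
        one l len (yes unique) = whp-mono (≤-reflexive (cong (β **_) (length-links h l len))) (λ _ q _ → q)
          (whp-forest t (links-forest unique))
        one l len (no ¬unique) = whp-mono (0≤** 0≤β h) (λ _ q → q) (whp-always λ _ unique → contradiction unique ¬unique)

      anyNear : Node s → List (Node s) → Bool
      anyNear v = any (λ w → manhattan w v ≤ᵇ m)

      𝔼-anyNear : ∀ ws → 𝔼 u (λ v → 𝟙 (anyNear v ws)) ≤ ι (length ws) * β
      𝔼-anyNear []       = ≤-reflexive (trans (𝔼-0 u) (sym (*-zeroˡ β)))
      𝔼-anyNear (w ∷ ws) = begin
        𝔼 u (λ v → 𝟙 (anyNear v (w ∷ ws)))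
          ≤⟨ 𝔼-mono node-isProbability (λ v → union (manhattan w v ≤ᵇ m) (anyNear v ws)) ⟩
        𝔼 u (λ v → 𝟙 (manhattan w v ≤ᵇ m) + 𝟙 (anyNear v ws))
          ≡⟨ 𝔼-+ u (λ v → 𝟙 (manhattan w v ≤ᵇ m)) (λ v → 𝟙 (anyNear v ws)) ⟩
        𝔼 u (λ v → 𝟙 (manhattan w v ≤ᵇ m)) + 𝔼 u (λ v → 𝟙 (anyNear v ws))
          ≤⟨ +-mono-≤ (ball w) (𝔼-anyNear ws) ⟩
        β + ι (length ws) * β
          ≡⟨ trans (cong (_+ ι (length ws) * β) (sym (*-identityˡ β))) (sym (*-distribʳ-+ β 1ℚ (ι (length ws)))) ⟩
        (1ℚ + ι (length ws)) * β
          ≡⟨ cong (_* β) (ι-suc (length ws)) ⟨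
        ι (suc (length ws)) * β ∎
        where
        open ≤-Reasoning
        union : ∀ a b → 𝟙 (a ∨ b) ≤ 𝟙 a + 𝟙 b
        union true  b = ≤-+ʳ (0≤𝟙 b)
        union false b = ≤-reflexive (sym (+-identityˡ (𝟙 b)))

      count : Bool → ℕ
      count true  = 1
      count false = 0

      -- Whether an agent has a neighbour depends on all the others at once. Counting neighbours in
      -- one direction only allows the positions to be exposed one by one, from the back for `later`
      -- and from the front for `earlier`; each new position is close to an exposed one with
      -- probability at most kβ, so exponential moments multiply.
      later : ∀ {j} → Vec (Node s) j → ℕ
      later []       = 0
      later (v ∷ vs) = count (anyNear v (toList vs)) ℕ.+ later vs

      earlier : ∀ {j} → List (Node s) → Vec (Node s) j → ℕ
      earlier seen []       = 0
      earlier seen (v ∷ vs) = count (anyNear v seen) ℕ.+ earlier (v ∷ seen) vs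

      -- For the induction, agents already passed are kept in `seen`: a neighbour of a remaining
      -- agent is either still ahead or among them.
      neighboured⇒count : ∀ {j} seen (vs : Vec (Node s) j) →
        (∀ i → (∃[ i′ ] (i′ ≢ i × manhattan (lookup vs i′) (lookup vs i) ℕ.≤ m)) ⊎ anyNear (lookup vs i) seen ≡ true) →
        j ℕ.≤ later vs ℕ.+ earlier seen vs
      neighboured⇒count seen []                 _    = ℕ.z≤n
      neighboured⇒count {suc j} seen (v ∷ vs)   nbrs = begin
        1 ℕ.+ j
          ≤⟨ ℕ.+-mono-≤ (head-count (nbrs zero)) (neighboured⇒count (v ∷ seen) vs (λ i → tail-nbrs i (nbrs (suc i)))) ⟩
        (count (anyNear v (toList vs)) ℕ.+ count (anyNear v seen)) ℕ.+ (later vs ℕ.+ earlier (v ∷ seen) vs)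
          ≡⟨ interchange (count (anyNear v (toList vs))) (count (anyNear v seen)) (later vs) (earlier (v ∷ seen) vs) ⟩
        (count (anyNear v (toList vs)) ℕ.+ later vs) ℕ.+ (count (anyNear v seen) ℕ.+ earlier (v ∷ seen) vs) ∎
        where
        open ℕ.≤-Reasoning
        open import Algebra.Properties.CommutativeSemigroup ℕ.+-commutativeSemigroup using (interchange)
        found : ∀ {j} (vs : Vec (Node s) j) i → manhattan (lookup vs i) v ℕ.≤ m → anyNear v (toList vs) ≡ true
        found (w ∷ vs) zero    near rewrite ≤⇒true near = refl
        found (w ∷ vs) (suc i) near with manhattan w v ≤ᵇ m
        ... | true  = refl
        ... | false = found vs i near
        head-count : (∃[ i′ ] (i′ ≢ zero × manhattan (lookup (v ∷ vs) i′) v ℕ.≤ m)) ⊎ anyNear v seen ≡ true →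
          1 ℕ.≤ count (anyNear v (toList vs)) ℕ.+ count (anyNear v seen)
        head-count (inj₁ (zero , ≢ , _))     = contradiction refl ≢
        head-count (inj₁ (suc i , _ , near)) rewrite found vs i near = ℕ.s≤s ℕ.z≤n
        head-count (inj₂ eq) rewrite eq = ℕ.m≤n+m 1 (count (anyNear v (toList vs)))
        tail-nbrs : ∀ i → (∃[ i′ ] (i′ ≢ suc i × manhattan (lookup (v ∷ vs) i′) (lookup vs i) ℕ.≤ m)) ⊎
            anyNear (lookup vs i) seen ≡ true →
          (∃[ i′ ] (i′ ≢ i × manhattan (lookup vs i′) (lookup vs i) ℕ.≤ m)) ⊎ anyNear (lookup vs i) (v ∷ seen) ≡ true
        tail-nbrs i (inj₁ (zero , _ , near)) rewrite ≤⇒true near = inj₂ refl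
        tail-nbrs i (inj₁ (suc i′ , ≢ , near)) = inj₁ (i′ , ≢ ∘ cong suc , near)
        tail-nbrs i (inj₂ eq) with manhattan v (lookup vs i) ≤ᵇ m
        ... | true  = inj₂ refl
        ... | false = inj₂ eq

      module _ (sparse : ι 64 * (ι k * β) ≤ 1ℚ) where

        -- The base 64 is what sparsity permits at the cost of a factor 2 per agent. Since k/2 hits
        -- weigh 64^(k/2) = 8^k against a moment of 2^k, it yields the decay 4^-k.
        𝔼-count : ∀ ws → length ws ℕ.≤ k → 𝔼 u (λ v → ι 64 ** count (anyNear v ws)) ≤ ι 2
        𝔼-count ws len≤k = begin
          𝔼 u (λ v → ι 64 ** count (anyNear v ws))
            ≤⟨ 𝔼-mono node-isProbability (λ v → linear (anyNear v ws)) ⟩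
          𝔼 u (λ v → 1ℚ + ι 64 * 𝟙 (anyNear v ws))
            ≡⟨ trans (𝔼-+ u (λ _ → 1ℚ) (λ v → ι 64 * 𝟙 (anyNear v ws)))
                 (cong₂ _+_ (mass node-isProbability) (𝔼-*ˡ u (ι 64) (λ v → 𝟙 (anyNear v ws)))) ⟩
          1ℚ + ι 64 * 𝔼 u (λ v → 𝟙 (anyNear v ws))
            ≤⟨ +-monoʳ-≤ 1ℚ (*-monoˡ (ι 64) (0≤ι 64) (≤-trans (𝔼-anyNear ws) (*-monoʳ β 0≤β (ι-mono len≤k)))) ⟩
          1ℚ + ι 64 * (ι k * β)
            ≤⟨ +-monoʳ-≤ 1ℚ sparse ⟩
          1ℚ + 1ℚ ∎
          where
          open ≤-Reasoning
          linear : ∀ b → ι 64 ** count b ≤ 1ℚ + ι 64 * 𝟙 b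
          linear true  = ℚ.≤ᵇ⇒≤ _
          linear false = ℚ.≤ᵇ⇒≤ _

        private
          us : ∀ j → Dist (Vec (Node s) j)
          us j = independent (replicate j u)

          us-isProbability : ∀ j → IsProbability (us j)
          us-isProbability j = independent-isProbability (replicate j u) (replicate-isProbability j)

        𝔼-later : ∀ j → j ℕ.≤ k → 𝔼 (us j) (λ vs → ι 64 ** later vs) ≤ ι 2 ** j
        𝔼-later zero    _   = ≤-reflexive (𝔼-pure {A = Vec (Node s) 0} [] (λ _ → 1ℚ))
        𝔼-later (suc j) j<k = begin
          𝔼 (us (suc j)) (λ vs → ι 64 ** later vs)
            ≡⟨ 𝔼-independent-∷ u (replicate j u) (λ vs → ι 64 ** later vs) ⟩
          𝔼 u (λ v → 𝔼 (us j) (λ vs → ι 64 ** (count (anyNear v (toList vs)) ℕ.+ later vs)))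
            ≡⟨ 𝔼-swap u (us j) (λ v vs → ι 64 ** (count (anyNear v (toList vs)) ℕ.+ later vs)) ⟩
          𝔼 (us j) (λ vs → 𝔼 u (λ v → ι 64 ** (count (anyNear v (toList vs)) ℕ.+ later vs)))
            ≡⟨ 𝔼-cong (us j) (λ vs → trans
                 (𝔼-cong u (λ v → **-+ (ι 64) (count (anyNear v (toList vs))) (later vs)))
                 (𝔼-*ʳ u (ι 64 ** later vs) (λ v → ι 64 ** count (anyNear v (toList vs))))) ⟩
          𝔼 (us j) (λ vs → 𝔼 u (λ v → ι 64 ** count (anyNear v (toList vs))) * ι 64 ** later vs)
            ≤⟨ 𝔼-mono (us-isProbability j) (λ vs → *-monoʳ (ι 64 ** later vs) (0≤** (0≤ι 64) (later vs))
                 (𝔼-count (toList vs) (ℕ.≤-trans (ℕ.≤-reflexive (length-toList vs)) (ℕ.<⇒≤ j<k)))) ⟩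
          𝔼 (us j) (λ vs → ι 2 * ι 64 ** later vs)
            ≡⟨ 𝔼-*ˡ (us j) (ι 2) (λ vs → ι 64 ** later vs) ⟩
          ι 2 * 𝔼 (us j) (λ vs → ι 64 ** later vs)
            ≤⟨ *-monoˡ (ι 2) (0≤ι 2) (𝔼-later j (ℕ.<⇒≤ j<k)) ⟩
          ι 2 ** suc j ∎
          where open ≤-Reasoning

        𝔼-earlier : ∀ j seen → j ℕ.+ length seen ℕ.≤ k → 𝔼 (us j) (λ vs → ι 64 ** earlier seen vs) ≤ ι 2 ** j
        𝔼-earlier zero    seen _  = ≤-reflexive (𝔼-pure {A = Vec (Node s) 0} [] (λ _ → 1ℚ))
        𝔼-earlier (suc j) seen ≤k = begin
          𝔼 (us (suc j)) (λ vs → ι 64 ** earlier seen vs)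
            ≡⟨ 𝔼-independent-∷ u (replicate j u) (λ vs → ι 64 ** earlier seen vs) ⟩
          𝔼 u (λ v → 𝔼 (us j) (λ vs → ι 64 ** (count (anyNear v seen) ℕ.+ earlier (v ∷ seen) vs)))
            ≡⟨ 𝔼-cong u (λ v → trans
                 (𝔼-cong (us j) (λ vs → **-+ (ι 64) (count (anyNear v seen)) (earlier (v ∷ seen) vs)))
                 (𝔼-*ˡ (us j) (ι 64 ** count (anyNear v seen)) (λ vs → ι 64 ** earlier (v ∷ seen) vs))) ⟩
          𝔼 u (λ v → ι 64 ** count (anyNear v seen) * 𝔼 (us j) (λ vs → ι 64 ** earlier (v ∷ seen) vs))
            ≤⟨ 𝔼-mono node-isProbability (λ v → *-monoˡ (ι 64 ** count (anyNear v seen)) (0≤** (0≤ι 64) (count (anyNear v seen)))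
                 (𝔼-earlier j (v ∷ seen) (ℕ.≤-trans (ℕ.≤-reflexive (ℕ.+-suc j (length seen))) ≤k))) ⟩
          𝔼 u (λ v → ι 64 ** count (anyNear v seen) * ι 2 ** j)
            ≡⟨ 𝔼-*ʳ u (ι 2 ** j) (λ v → ι 64 ** count (anyNear v seen)) ⟩
          𝔼 u (λ v → ι 64 ** count (anyNear v seen)) * ι 2 ** j
            ≤⟨ *-monoʳ (ι 2 ** j) (0≤** (0≤ι 2) j) (𝔼-count seen (ℕ.m+n≤o⇒n≤o (suc j) ≤k)) ⟩
          ι 2 ** suc j ∎
          where open ≤-Reasoning

        -- If every agent has a neighbour then, in any fixed order of the agents, at least
        -- half of them have a later neighbour or at least half have an earlier one.
        whp-isolated : ∀ t → Whp t (ι 2 * ¼ ** k)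
          (λ ω → ¬ (∀ a → ∃[ b ] (b ≢ a × manhattan (lookup (ω t) b) (lookup (ω t) a) ℕ.≤ m)))
        whp-isolated t = whp-static t score 0≤score total λ c <1 nbrs → <-irrefl refl (≤-<-trans (large c nbrs) <1)
          where
          open ≤-Reasoning
          open +-*-Solver
          0≤w : ∀ n → 0ℚ ≤ ½ ** n
          0≤w = 0≤** (nonNegative⁻¹ ½)
          score : C → ℚ
          score c = (½ ** 3) ** k * (ι 64 ** later c + ι 64 ** earlier [] c)
          0≤64 : ∀ n → 0ℚ ≤ ι 64 ** n
          0≤64 = 0≤** (0≤ι 64)
          0≤score : ∀ c → 0ℚ ≤ score c
          0≤score c = 0≤* ((½ ** 3) ** k) (ι 64 ** later c + ι 64 ** earlier [] c) (0≤** (0≤w 3) k)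
            (0≤+ (0≤64 (later c)) (0≤64 (earlier [] c)))
          total : 𝔼 initial score ≤ ι 2 * ¼ ** k
          total = begin
            𝔼 initial score
              ≡⟨ trans (𝔼-*ˡ initial ((½ ** 3) ** k) (λ c → ι 64 ** later c + ι 64 ** earlier [] c))
                   (cong ((½ ** 3) ** k *_) (𝔼-+ initial (λ c → ι 64 ** later c) (λ c → ι 64 ** earlier [] c))) ⟩
            (½ ** 3) ** k * (𝔼 initial (λ c → ι 64 ** later c) + 𝔼 initial (λ c → ι 64 ** earlier [] c))
              ≤⟨ *-monoˡ ((½ ** 3) ** k) (0≤** (0≤w 3) k) (+-mono-≤ (𝔼-later k ℕ.≤-refl)
                   (𝔼-earlier k [] (ℕ.≤-reflexive (ℕ.+-identityʳ k)))) ⟩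
            (½ ** 3) ** k * (ι 2 ** k + ι 2 ** k)
              ≡⟨ cong (_* (ι 2 ** k + ι 2 ** k)) (*-** ½ ¼ k) ⟩
            ½ ** k * ¼ ** k * (ι 2 ** k + ι 2 ** k)
              ≡⟨ solve 3 (λ h q t → h :* q :* (t :+ t) := (h :* t) :* ((con 1ℚ :+ con 1ℚ) :* q)) refl (½ ** k) (¼ ** k) (ι 2 ** k) ⟩
            ½ ** k * ι 2 ** k * (ι 2 * ¼ ** k)
              ≡⟨ trans (cong (_* (ι 2 * ¼ ** k)) (½2** k)) (*-identityˡ (ι 2 * ¼ ** k)) ⟩
            ι 2 * ¼ ** k ∎
          half : ∀ a → k ℕ.≤ 2 ℕ.* a → ι 8 ** k ≤ ι 64 ** a
          half a k≤2a = begin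
            ι 8 ** k  ≤⟨ **-monoʳ (ι-mono {1} {8} (ℕ.s≤s ℕ.z≤n)) k≤2a ⟩
            ι 8 ** (2 ℕ.* a)     ≡⟨ cong (ι 8 **_) (ℕ.*-comm 2 a) ⟩
            ι 8 ** (a ℕ.* 2)     ≡⟨ **-* (ι 8) a 2 ⟩
            ι 64 ** a  ∎
          halves : ∀ a b → k ℕ.≤ a ℕ.+ b → ι 8 ** k ≤ ι 64 ** a + ι 64 ** b
          halves a b k≤a+b with ℕ.≤-total a b
          ... | inj₂ b≤a = ≤-trans (half a (ℕ.≤-trans k≤a+b (ℕ.≤-trans (ℕ.+-monoʳ-≤ a b≤a)
                             (ℕ.≤-reflexive (cong (a ℕ.+_) (sym (ℕ.+-identityʳ a))))))) (≤-+ʳ (0≤64 b))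
          ... | inj₁ a≤b = ≤-trans (half b (ℕ.≤-trans k≤a+b (ℕ.≤-trans (ℕ.+-monoˡ-≤ b a≤b)
                             (ℕ.≤-reflexive (cong (b ℕ.+_) (sym (ℕ.+-identityʳ b)))))))
                             (≤-trans (≤-+ʳ (0≤64 a)) (≤-reflexive (+-comm (ι 64 ** b) (ι 64 ** a))))
          large : ∀ c → (∀ a → ∃[ b ] (b ≢ a × manhattan (lookup c b) (lookup c a) ℕ.≤ m)) → 1ℚ ≤ score c
          large c nbrs = begin
            1ℚ  ≡⟨ 1**n≡1 k ⟨
            (½ ** 3 * ι 8) ** k       ≡⟨ *-** (½ ** 3) (ι 8) k ⟩
            (½ ** 3) ** k * ι 8 ** k  ≤⟨ *-monoˡ ((½ ** 3) ** k) (0≤** (0≤w 3) k)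
                                           (halves (later c) (earlier [] c) (neighboured⇒count [] c (inj₁ ∘ nbrs))) ⟩
            score c  ∎

  module _ {s k : ℕ} .{{_ : ℕ.NonZero s}} where
    open Process s (suc k)

    -- The pairs formed with `a` make up a star, whose leaves are the other agents; it is a forest
    -- with one pair for each of them.
    whp-distant : ∀ m β (0≤β : 0ℚ ≤ β) (ball : ∀ v → 𝔼 (uniform (nodes s)) (λ w → 𝟙 (manhattan v w ≤ᵇ m)) ≤ β) →
      ∀ a → Whp 0 (β ** k) (λ ω → ¬ (∀ b → manhattan (lookup (ω 0) a) (lookup (ω 0) b) ℕ.≤ m))
    whp-distant m β 0≤β ball a = whp-mono (≤-reflexive (cong (β **_) length-star))
      (λ ω ¬near near → ¬near (universal (ω 0) near (allFin k)))
      (whp-forest m β 0≤β ball 0 (star-forest (allFin⁺ k)))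
      where
      star : List (Fin k) → List (Fin (suc k) × Fin (suc k))
      star = map (λ j → punchIn a j , a)
      universal : ∀ c → (∀ b → manhattan (lookup c a) (lookup c b) ℕ.≤ m) → ∀ js → All (Near m c) (star js)
      universal c near []       = []
      universal c near (j ∷ js) = near (punchIn a j) ∷ universal c near js
      length-star : length (star (allFin k)) ≡ k
      length-star = trans (length-map (λ j → punchIn a j , a) (allFin k)) (length-tabulate {n = k} (λ j → j))
      star-forest : ∀ {js} → Unique js → Forest m β 0≤β ball (star js)
      star-forest []               = []
      star-forest (j∉js ∷ unique) = (Fin.punchInᵢ≢i a _ , fresh j∉js) ∷ star-forest unique
        where
        fresh : ∀ {j js} → All (j ≢_) js → All (λ (a′ , b′) → a′ ≢ punchIn a j × b′ ≢ punchIn a j) (star js)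
        fresh []             = []
        fresh (j≢j′ ∷ j∉js) = (j≢j′ ∘ sym ∘ Fin.punchIn-injective a _ _ , ≢-sym (Fin.punchInᵢ≢i a _)) ∷ fresh j∉js

-- The deterministic part: islands, phases and the reach of the rumor.

module Spread where
  open import Defs
  open Steps using (manhattan-sym; manhattan-refl; manhattan-triangle)
  open Events using (Near; links)
  open import Data.List using (List; []; _∷_; length; take)
  open import Data.List.Membership.Propositional using (_∈_)
  import Data.List.Membership.DecPropositional as DecMembership
  open import Data.List.Properties using (length-take)
  open import Data.List.Relation.Unary.All using (All; []; _∷_)
  open import Data.List.Relation.Unary.All.Properties using (¬Any⇒All¬)
  open import Data.List.Relation.Unary.AllPairs using ([]; _∷_)
  open import Data.List.Relation.Unary.Any using (here; there)
  open import Data.List.Relation.Unary.Unique.Propositional using (Unique)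
  open import Data.List.Relation.Unary.Unique.Propositional.Properties using (take⁺)
  open import Data.Nat
  open import Data.Nat.DivMod using (m≡m%n+[m/n]*n; m%n<n; m<n*o⇒m/o<n)
  open import Data.Nat.Properties
  open import Data.Vec using (lookup)
  open import Relation.Binary.Construct.Closure.ReflexiveTransitive using (Star; ε; _◅_; _◅◅_; gmap; reverse)

  private
    variable
      s k : ℕ

  distance : Config s k → Fin k → Fin k → ℕ
  distance c a b = manhattan (lookup c a) (lookup c b)

  Close : ℕ → Config s k → Fin k → Fin k → Set
  Close γ c a b = distance c a b ≤ γ

  data Chain {A : Set} (R : A → A → Set) (b : A) : A → List A → Set where
    [_] : ∀ a → a ≡ b → Chain R b a (a ∷ [])
    _∷_ : ∀ {a a′ l} → R a a′ → Chain R b a′ l → Chain R b a (a ∷ l)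

  module _ {R : Fin k → Fin k → Set} where
    open DecMembership (Fin._≟_ {k}) using (_∈?_)

    suffix : ∀ {a b c l} → a ∈ l → Chain R b c l → Unique l → ∃[ l′ ] (Chain R b a l′ × Unique l′)
    suffix (here refl) chain@([ _ ] _) unique       = _ , chain , unique
    suffix (here refl) chain@(_ ∷ _)   unique       = _ , chain , unique
    suffix (there a∈l) (_ ∷ chain)     (_ ∷ unique) = suffix a∈l chain unique

    -- If the new starting point already lies on the loop-free chain, everything before it is
    -- discarded.
    loop-erasure : ∀ {a b} → Star R a b → ∃[ l ] (Chain R b a l × Unique l)
    loop-erasure {a} ε          = a ∷ [] , [ a ] refl , [] ∷ []
    loop-erasure {a} (aRa′ ◅ star) with loop-erasure star
    ... | l , chain , unique with a ∈? l
    ...   | yes a∈l = suffix a∈l chain unique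
    ...   | no  a∉l = a ∷ l , aRa′ ∷ chain , ¬Any⇒All¬ l a∉l ∷ unique

  module _ {γ : ℕ} (c : Config s k) where

    -- The list contains vertices, one more than there are links; the summand γ on the left pays for
    -- the difference without subtraction.
    chain-distance : ∀ {a b l} → Chain (Close γ c) b a l → distance c a b + γ ≤ length l * γ
    chain-distance {a} ([ a ] refl) = ≤-trans (≤-reflexive (cong (_+ γ) (manhattan-refl (lookup c a))))
      (≤-reflexive (sym (+-identityʳ γ)))
    chain-distance {a} {b} {_ ∷ l} (_∷_ {a′ = a′} near chain) = begin
      distance c a b + γ  ≤⟨ +-monoˡ-≤ γ (manhattan-triangle (lookup c a) (lookup c a′) (lookup c b)) ⟩
      (distance c a a′ + distance c a′ b) + γ   ≡⟨ +-assoc (distance c a a′) (distance c a′ b) γ ⟩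
      distance c a a′ + (distance c a′ b + γ)   ≤⟨ +-mono-≤ near (chain-distance chain) ⟩
      γ + length l * γ  ∎
      where open ≤-Reasoning

    chain-links : ∀ {a b l} → Chain (Close γ c) b a l → ∀ h → All (Near γ c) (links (take h l))
    chain-links ([ _ ] _)         zero          = []
    chain-links ([ _ ] _)         (suc zero)    = []
    chain-links ([ _ ] _)         (suc (suc h)) = []
    chain-links (_ ∷ chain)       zero          = []
    chain-links (_ ∷ [ _ ] _)     (suc zero)    = []
    chain-links (_ ∷ _ ∷ _)       (suc zero)    = []
    chain-links {a} (_∷_ {a′ = a′} near chain@([ _ ] _)) (suc (suc h)) =
      subst (_≤ γ) (manhattan-sym (lookup c a) (lookup c a′)) near ∷ chain-links chain (suc h)
    chain-links {a} (_∷_ {a′ = a′} near chain@(_ ∷ _)) (suc (suc h)) =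
      subst (_≤ γ) (manhattan-sym (lookup c a) (lookup c a′)) near ∷ chain-links chain (suc h)

    -- A loop-free chain with more than h vertices would contain an initial segment of exactly h + 1
    -- vertices, which is excluded.
    island-diameter : ∀ h → (∀ l → length l ≡ suc h → Unique l → ¬ All (Near γ c) (links l)) →
      ∀ {a b} → Star (Close γ c) a b → distance c a b ≤ h * γ
    island-diameter h no-path star with loop-erasure star
    ... | l , chain , unique with <-≤-connex h (length l)
    ...   | inj₁ h<len = contradiction (chain-links chain (suc h))
            (no-path (take (suc h) l) (trans (length-take (suc h) l) (m≤n⇒m⊓n≡m h<len)) (take⁺ (suc h) unique))
    ...   | inj₂ len≤h = ≤-trans (m≤m+n _ γ) (≤-trans (chain-distance chain) (*-monoˡ-≤ γ len≤h))

  -- Links of length 0 keep a whole chain on one node, however long it is. This is why radius 0 can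
  -- do without an estimate of islands.
  coincident : ∀ (c : Config s k) {a b} → Star (Close 0 c) a b → distance c a b ≤ 0
  coincident c {a} {b} star with loop-erasure star
  ... | l , chain , _ = ≤-trans (m≤m+n (distance c a b) 0)
    (≤-trans (chain-distance c chain) (≤-reflexive (*-zeroʳ (length l))))

  module Phases (r L γ : ℕ) (ω : Path s k) (source : Fin k) (P : ℕ)
    (visible : ∀ p → p < P → ∀ ℓ → ℓ < L → ∀ {a b} → Visible r ω (suc ℓ + p * L) a b → Close γ (ω (suc p * L)) a b)
    where

    Informed : ℕ → Fin k → Set
    Informed t a = rumours r ω (knownBy r ω source) t a tt

    -- Every exchange during the phase runs along links of the same static graph, so the successive
    -- exchanges concatenate to one chain, back to an agent informed when the phase began.
    reach : ∀ p → p < P → ∀ ℓ → ℓ ≤ L → ∀ {a} → Informed (ℓ + p * L) a →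
      ∃[ b ] (Star (Close γ (ω (suc p * L))) a b × Informed (p * L) b)
    reach p p<P zero    _   {a} informed = a , ε , informed
    reach p p<P (suc ℓ) ℓ<L {a} (b , star , informed) with reach p p<P ℓ (<⇒≤ ℓ<L) informed
    ... | b′ , star′ , informed′ = b′ , gmap (λ x → x) (visible p p<P ℓ ℓ<L) star ◅◅ star′ , informed′

    module _ (H μ : ℕ)
      (islands : ∀ p → p < P → ∀ {a b} → Star (Close γ (ω (suc p * L))) a b → distance (ω (suc p * L)) a b ≤ H)
      (moves : ∀ p → p < P → ∀ a → manhattan (lookup (ω (p * L)) a) (lookup (ω (suc p * L)) a) ≤ μ)
      where

      private
        origin : Node s
        origin = lookup (ω 0) source

        at : ℕ → Fin k → Node s
        at p a = lookup (ω (p * L)) a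

      informed-range : ∀ p → p ≤ P → ∀ {a} → Informed (p * L) a → manhattan (at p a) origin ≤ p * (H + μ)

      -- The agent may be informed at any time of the phase, but its position is taken at the end,
      -- where the islands live. The new range is one island plus the move of the agent that brought
      -- the rumor into the phase.
      island-range : ∀ p → p < P → ∀ ℓ → ℓ ≤ L → ∀ {a} → Informed (ℓ + p * L) a →
        manhattan (at (suc p) a) origin ≤ suc p * (H + μ)

      informed-range zero    _   refl     = ≤-reflexive (manhattan-refl origin)
      informed-range (suc p) p<P informed = island-range p p<P L ≤-refl informed

      island-range p p<P ℓ ℓ≤L {a} informed with reach p p<P ℓ ℓ≤L informed
      ... | b , star , informed′ = begin
        manhattan (at (suc p) a) origin
          ≤⟨ manhattan-triangle (at (suc p) a) (at (suc p) b) origin ⟩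
        manhattan (at (suc p) a) (at (suc p) b) + manhattan (at (suc p) b) origin
          ≤⟨ +-mono-≤ (islands p p<P star) (manhattan-triangle (at (suc p) b) (at p b) origin) ⟩
        H + (manhattan (at (suc p) b) (at p b) + manhattan (at p b) origin)
          ≤⟨ +-monoʳ-≤ H (+-mono-≤ (≤-trans (≤-reflexive (manhattan-sym (at (suc p) b) (at p b))) (moves p p<P b))
               (informed-range p (<⇒≤ p<P) informed′)) ⟩
        H + (μ + p * (H + μ))
          ≡⟨ +-assoc H μ (p * (H + μ)) ⟨
        suc p * (H + μ) ∎
        where open ≤-Reasoning

      displacement : ∀ p → p ≤ P → ∀ a → manhattan (at 0 a) (at p a) ≤ p * μ
      displacement zero    _   a = ≤-reflexive (manhattan-refl (at 0 a))
      displacement (suc p) p<P a = begin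
        manhattan (at 0 a) (at (suc p) a)  ≤⟨ manhattan-triangle (at 0 a) (at p a) (at (suc p) a) ⟩
        manhattan (at 0 a) (at p a) + manhattan (at p a) (at (suc p) a)
          ≤⟨ +-mono-≤ (displacement p (<⇒≤ p<P) a) (moves p p<P a) ⟩
        p * μ + μ  ≡⟨ +-comm (p * μ) μ ⟩
        suc p * μ  ∎
        where open ≤-Reasoning

      -- What is known to be far from the source is an initial position, so the agent's own
      -- displacement up to the end of the current phase is added. This accounts for the second μ
      -- per phase.
      allInformed⇒near : .{{_ : NonZero L}} → ∀ t → t < P * L → AllInformed r ω source t →
        ∀ a → manhattan origin (lookup (ω 0) a) ≤ P * (H + (μ + μ))
      allInformed⇒near t t<PL all a = begin
        manhattan origin (at 0 a)
          ≡⟨ manhattan-sym origin (at 0 a) ⟩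
        manhattan (at 0 a) origin
          ≤⟨ manhattan-triangle (at 0 a) (at (suc p) a) origin ⟩
        manhattan (at 0 a) (at (suc p) a) + manhattan (at (suc p) a) origin
          ≤⟨ +-mono-≤ (displacement (suc p) p<P a) (island-range p p<P (t % L) (<⇒≤ (m%n<n t L))
               (subst (λ t → Informed t a) (m≡m%n+[m/n]*n t L) (all a))) ⟩
        suc p * μ + suc p * (H + μ)
          ≡⟨ *-distribˡ-+ (suc p) μ (H + μ) ⟨
        suc p * (μ + (H + μ))
          ≤⟨ *-mono-≤ p<P (≤-reflexive (trans (+-comm μ (H + μ)) (+-assoc H μ μ))) ⟩
        P * (H + (μ + μ)) ∎
        where
        open ≤-Reasoning
        p : ℕ
        p = t / L
        p<P : p < P
        p<P = m<n*o⇒m/o<n t<PL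

    -- Within a single phase the rumor stays in the source's island of the reference graph.
    module _ (2≤k : 2 ≤ k) (0<P : 0 < P) where

      private
        c : Config s k
        c = ω (1 * L)

        step-away : ∀ {a b} → a ≢ b → Star (Close γ c) a b → ∃[ a′ ] (a′ ≢ a × Close γ c a′ a)
        step-away a≢b ε = contradiction refl a≢b
        step-away {a} a≢b (_◅_ {j = a′} near star) with a′ Fin.≟ a
        ... | no  a′≢a = a′ , a′≢a , subst (_≤ γ) (manhattan-sym (lookup c a) (lookup c a′)) near
        ... | yes refl = step-away a≢b star

        another : ∀ {k} → 2 ≤ k → (a : Fin k) → ∃[ b ] b ≢ a
        another (s≤s (s≤s _)) zero    = suc zero , λ ()
        another (s≤s (s≤s _)) (suc a) = zero , λ ()

      allInformed⇒neighboured : ∀ t → t ≤ L → AllInformed r ω source t →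
        ∀ a → ∃[ b ] (b ≢ a × Close γ c b a)
      allInformed⇒neighboured t t≤L all a = neighbour (a Fin.≟ source)
        where
        to-source : ∀ a → Star (Close γ c) a source
        to-source a with reach 0 0<P t t≤L (subst (λ t → Informed t a) (sym (+-identityʳ t)) (all a))
        ... | _ , star , refl = star
        neighbour : Dec (a ≡ source) → ∃[ b ] (b ≢ a × Close γ c b a)
        neighbour (no  a≢source) = step-away a≢source (to-source a)
        -- The chain from the source to itself may be empty, so the chain from another agent is
        -- reversed.
        neighbour (yes refl) with another 2≤k source
        ... | b , b≢source = step-away (b≢source ∘ sym)
          (reverse (λ {i} {j} → subst (_≤ γ) (manhattan-sym (lookup c i) (lookup c j))) (to-source b))

-- Slow broadcast for given phase lengths and scales.

module Outcome where
  open import Defs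
  open Powers
  open Expectation
  open Steps
  open Walks
  open Events
  open Spread
  open import Data.List using (length)
  open import Data.List.Relation.Unary.All using (All)
  open import Data.List.Relation.Unary.Unique.Propositional using (Unique)
  open import Data.Nat using (_≤ᵇ_)
  open import Data.Rational hiding (_≤ᵇ_)
  open import Data.Rational.Properties hiding (≤ᵇ⇒≤)
  open import Data.Vec using (lookup)

  Slow : ∀ {s k} → ℕ → Fin k → ℕ → Pred (Path s k) 0ℓ
  Slow r source T ω = ∀ t → t ℕ.< T → ¬ AllInformed r ω source t

  fraction≤1 : ∀ c a b .{{_ : ℕ.NonZero b}} → c ℕ.* a ℕ.≤ b → ι c * (ℤ.+ a / b) ≤ 1ℚ
  fraction≤1 c a b ca≤b = *-cancelʳ-≤-pos (ι b) {{ι-pos b}} (begin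
    ι c * (ℤ.+ a / b) * ι b       ≡⟨ *-assoc (ι c) (ℤ.+ a / b) (ι b) ⟩
    ι c * ((ℤ.+ a / b) * ι b)     ≡⟨ cong (ι c *_) (/-ι a b) ⟩
    ι c * ι a  ≡⟨ ι-* c a ⟨
    ι (c ℕ.* a)  ≤⟨ ι-mono ca≤b ⟩
    ι b  ≡⟨ *-identityˡ (ι b) ⟨
    1ℚ * ι b  ∎)
    where open ≤-Reasoning

  ballSize : ℕ → ℕ
  ballSize m = (2 ℕ.* m ℕ.+ 1) ℕ.* (2 ℕ.* m ℕ.+ 1)

  module _ (s : ℕ) .{{_ : ℕ.NonZero s}} where

    private instance
      s²≢0 : ℕ.NonZero (s ℕ.* s)
      s²≢0 = ℕ.m*n≢0 s s

    density : ℕ → ℚ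
    density m = ℤ.+ ballSize m / (s ℕ.* s)

    0≤density : ∀ m → 0ℚ ≤ density m
    0≤density m = nonNegative⁻¹ _ {{normalize-nonNeg (ballSize m) (s ℕ.* s)}}

    ball≤density : ∀ m v → 𝔼 (uniform (nodes s)) (λ w → 𝟙 (manhattan v w ≤ᵇ m)) ≤ density m
    ball≤density m v = *-cancelˡ-≤-pos (ι (s ℕ.* s)) {{ι-pos (s ℕ.* s)}} (≤-trans (ball-probability v m)
      (≤-reflexive (trans (sym (/-ι (ballSize m) (s ℕ.* s))) (*-comm (density m) (ι (s ℕ.* s))))))

    density≤¼ : ∀ d → 4 ℕ.* ballSize d ℕ.≤ s ℕ.* s → density d ≤ ¼
    density≤¼ d small = *-cancelˡ-≤-pos (ι 4) (fraction≤1 4 (ballSize d) (s ℕ.* s) small)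

  module Outcomes {s k′ : ℕ} .{{_ : ℕ.NonZero s}} (r : ℕ) (source : Fin (suc k′)) where
    private
      k : ℕ
      k = suc k′
    open Process s k

    module _ (L μ P : ℕ) (ε : ℚ)
      (moves : ∀ a i δ → δ ℕ.≤ L →
        Whp (δ ℕ.+ i) ε (λ ω → manhattan (lookup (ω i) a) (lookup (ω (δ ℕ.+ i)) a) ℕ.≤ μ)) where

      -- Moves are measured from each time of a phase to its end, and δ is the time that remains.
      -- The case δ = L covers the whole phase.
      Calm : Pred (Path s k) 0ℓ
      Calm ω = ∀ p → p ℕ.< P → ∀ δ → δ ℕ.≤ L → ∀ a →
        manhattan (lookup (ω ((L ℕ.∸ δ) ℕ.+ p ℕ.* L)) a) (lookup (ω (suc p ℕ.* L)) a) ℕ.≤ μ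

      whp-calm : Whp (P ℕ.* L) (ι P * (ι (suc L) * (ι k * ε))) Calm
      whp-calm = whp-mono ≤-refl (λ ω q p p<P δ δ≤L a → q p p<P δ (ℕ.s≤s δ≤L) a)
        (whp-∀< P λ p p<P → whp-∀< (suc L) λ { δ (ℕ.s≤s δ≤L) → whp-∀Fin λ a → one p p<P δ δ≤L a })
        where
        one : ∀ p → p ℕ.< P → ∀ δ → δ ℕ.≤ L → ∀ a → Whp (P ℕ.* L) ε
          (λ ω → manhattan (lookup (ω ((L ℕ.∸ δ) ℕ.+ p ℕ.* L)) a) (lookup (ω (suc p ℕ.* L)) a) ℕ.≤ μ)
        one p p<P δ δ≤L a = whp-later (ℕ.≤-trans (ℕ.≤-reflexive end) (ℕ.*-monoˡ-≤ L p<P))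
          (whp-mono ≤-refl (λ ω → subst (λ t → manhattan (lookup (ω ((L ℕ.∸ δ) ℕ.+ p ℕ.* L)) a) (lookup (ω t) a) ℕ.≤ μ) end)
            (moves a ((L ℕ.∸ δ) ℕ.+ p ℕ.* L) δ δ≤L))
          where
          end : δ ℕ.+ ((L ℕ.∸ δ) ℕ.+ p ℕ.* L) ≡ suc p ℕ.* L
          end = trans (sym (ℕ.+-assoc δ (L ℕ.∸ δ) (p ℕ.* L))) (cong (ℕ._+ p ℕ.* L) (ℕ.m+[n∸m]≡n δ≤L))

      calm⇒moves : ∀ ω → Calm ω → ∀ p → p ℕ.< P → ∀ a →
        manhattan (lookup (ω (p ℕ.* L)) a) (lookup (ω (suc p ℕ.* L)) a) ℕ.≤ μ
      calm⇒moves ω calm p p<P a = subst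
        (λ x → manhattan (lookup (ω (x ℕ.+ p ℕ.* L)) a) (lookup (ω (suc p ℕ.* L)) a) ℕ.≤ μ)
        (ℕ.n∸n≡0 L) (calm p p<P L ℕ.≤-refl a)

      calm⇒visible : ∀ γ → r ℕ.+ (μ ℕ.+ μ) ℕ.≤ γ → ∀ ω → Calm ω → ∀ p → p ℕ.< P → ∀ ℓ → ℓ ℕ.< L →
        ∀ {a b} → Visible r ω (suc ℓ ℕ.+ p ℕ.* L) a b → Close γ (ω (suc p ℕ.* L)) a b
      calm⇒visible γ r+2μ≤γ ω calm p p<P ℓ ℓ<L {a} {b} seen = begin
        manhattan (y a) (y b)
          ≤⟨ manhattan-triangle (y a) (x a) (y b) ⟩
        manhattan (y a) (x a) ℕ.+ manhattan (x a) (y b)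
          ≤⟨ ℕ.+-mono-≤ (ℕ.≤-trans (ℕ.≤-reflexive (manhattan-sym (y a) (x a))) (moved a))
               (manhattan-triangle (x a) (x b) (y b)) ⟩
        μ ℕ.+ (manhattan (x a) (x b) ℕ.+ manhattan (x b) (y b))
          ≤⟨ ℕ.+-monoʳ-≤ μ (ℕ.+-mono-≤ seen (moved b)) ⟩
        μ ℕ.+ (r ℕ.+ μ)
          ≡⟨ trans (sym (ℕ.+-assoc μ r μ)) (trans (cong (ℕ._+ μ) (ℕ.+-comm μ r)) (ℕ.+-assoc r μ μ)) ⟩
        r ℕ.+ (μ ℕ.+ μ)
          ≤⟨ r+2μ≤γ ⟩
        γ ∎
        where
        open ℕ.≤-Reasoning
        x y : Fin k → Node s
        x a = lookup (ω (suc ℓ ℕ.+ p ℕ.* L)) a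
        y a = lookup (ω (suc p ℕ.* L)) a
        moved : ∀ a → manhattan (x a) (y a) ℕ.≤ μ
        moved a = subst (λ z → manhattan (lookup (ω (z ℕ.+ p ℕ.* L)) a) (y a) ℕ.≤ μ)
          (ℕ.m∸[m∸n]≡n ℓ<L) (calm p p<P (L ℕ.∸ suc ℓ) (ℕ.m∸n≤m L (suc ℓ)) a)

      module _ .{{_ : ℕ.NonZero L}} (d : ℕ) (4ball≤n : 4 ℕ.* ballSize d ℕ.≤ s ℕ.* s) where

        private
          Scattered : Pred (Path s k) 0ℓ
          Scattered ω = ¬ (∀ b → manhattan (lookup (ω 0) source) (lookup (ω 0) b) ℕ.≤ d)

          whp-scattered : Whp (P ℕ.* L) (¼ ** k′) Scattered
          whp-scattered = whp-later ℕ.z≤n (whp-mono (**-monoˡ (0≤density s d) (density≤¼ s d 4ball≤n) k′) (λ _ q → q)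
            (whp-distant d (density s d) (0≤density s d) (ball≤density s d) source))

        -- If all agents were informed early, `allInformed⇒near` would place all of them within d of
        -- the source at time 0, against `Scattered`.
        slow-islands : ∀ γ h → r ℕ.+ (μ ℕ.+ μ) ℕ.≤ γ → P ℕ.* (h ℕ.* γ ℕ.+ (μ ℕ.+ μ)) ℕ.≤ d →
          Whp (P ℕ.* L) (¼ ** k′ + (ι P * (ι (suc L) * (ι k * ε)) + ι P * (ι k * (ι k * density s γ) ** h)))
            (Slow r source (P ℕ.* L))
        slow-islands γ h r+2μ≤γ range≤d = whp-mono ≤-refl slow (whp-× whp-scattered (whp-× whp-calm whp-paths))
          where
          NoPath : Pred (Path s k) 0ℓ
          NoPath ω = ∀ p → p ℕ.< P → ∀ l → length l ≡ suc h → Unique l → ¬ All (Near γ (ω (suc p ℕ.* L))) (links l)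
          whp-paths : Whp (P ℕ.* L) (ι P * (ι k * (ι k * density s γ) ** h)) NoPath
          whp-paths = whp-∀< P λ p p<P → whp-later (ℕ.*-monoˡ-≤ L p<P)
            (whp-no-long-path γ (density s γ) (0≤density s γ) (ball≤density s γ) (suc p ℕ.* L) h)
          slow : ∀ ω → Scattered ω × Calm ω × NoPath ω → Slow r source (P ℕ.* L) ω
          slow ω (scattered , calm , noPath) t t<T all = scattered λ a → ℕ.≤-trans
            (allInformed⇒near (h ℕ.* γ) μ (λ p p<P → island-diameter (ω (suc p ℕ.* L)) h (noPath p p<P))
              (calm⇒moves ω calm) t t<T all a)
            range≤d
            where open Phases r L γ ω source P (calm⇒visible γ r+2μ≤γ ω calm)

        -- In a phase of one step the only exchange takes place at its end, so visibility there
        -- coincides with being linked at distance 0 and nothing is lost to moves.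
        slow-coincident : r ≡ 0 → L ≡ 1 → P ℕ.* (μ ℕ.+ μ) ℕ.≤ d →
          Whp (P ℕ.* L) (¼ ** k′ + ι P * (ι (suc L) * (ι k * ε))) (Slow r source (P ℕ.* L))
        slow-coincident refl refl range≤d = whp-mono ≤-refl slow (whp-× whp-scattered whp-calm)
          where
          slow : ∀ ω → Scattered ω × Calm ω → Slow r source (P ℕ.* L) ω
          slow ω (scattered , calm) t t<T all = scattered λ a → ℕ.≤-trans
            (allInformed⇒near 0 μ (λ p p<P → coincident (ω (suc p ℕ.* L))) (calm⇒moves ω calm) t t<T all a)
            range≤d
            where
            visible : ∀ p → p ℕ.< P → ∀ ℓ → ℓ ℕ.< 1 → ∀ {a b} → Visible 0 ω (suc ℓ ℕ.+ p ℕ.* 1) a b →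
              Close 0 (ω (suc p ℕ.* 1)) a b
            visible p _ zero _ seen = seen
            visible p _ (suc ℓ) (ℕ.s≤s ()) seen
            open Phases r L 0 ω source P visible

    slow-isolated : ∀ L μ ε
      (moves : ∀ a i δ → δ ℕ.≤ L →
        Whp (δ ℕ.+ i) ε (λ ω → manhattan (lookup (ω i) a) (lookup (ω (δ ℕ.+ i)) a) ℕ.≤ μ)) →
      ∀ γ → r ℕ.+ (μ ℕ.+ μ) ℕ.≤ γ → 2 ℕ.≤ k → ι 64 * (ι k * density s γ) ≤ 1ℚ →
      Whp (1 ℕ.* L) (ι 2 * ¼ ** k + ι 1 * (ι (suc L) * (ι k * ε))) (Slow r source (1 ℕ.* L))
    slow-isolated L μ ε moves γ r+2μ≤γ 2≤k sparse = whp-mono ≤-refl slow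
      (whp-× (whp-isolated γ (density s γ) (0≤density s γ) (ball≤density s γ) sparse (1 ℕ.* L)) (whp-calm L μ 1 ε moves))
      where
      slow : ∀ ω → ¬ (∀ a → ∃[ b ] (b ≢ a × manhattan (lookup (ω (1 ℕ.* L)) b) (lookup (ω (1 ℕ.* L)) a) ℕ.≤ γ)) ×
        Calm L μ 1 ε moves ω → Slow r source (1 ℕ.* L) ω
      slow ω (isolated , calm) t t<T all = isolated (allInformed⇒neighboured 2≤k (ℕ.s≤s ℕ.z≤n) t
        (ℕ.≤-trans (ℕ.<⇒≤ t<T) (ℕ.≤-reflexive (ℕ.*-identityˡ L))) all)
        where open Phases r L γ ω source 1 (calm⇒visible L μ 1 ε moves γ r+2μ≤γ ω calm)

-- From the real radius and the real rate to inequalities between natural numbers.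

module Reals where
  open import Defs
  open Powers
  open import Data.Nat using (NonTrivial; s≤s; z≤n)
  open import Data.Rational
  open import Data.Rational.Properties
  open import Data.Rational.Solver using (module +-*-Solver)

  ι-cancel-≤ : ∀ {m n} → ι m ≤ ι n → m ℕ.≤ n
  ι-cancel-≤ {m} {n} ιm≤ιn = ℕ.≮⇒≥ λ n<m → <⇒≱ (ι< n) (≤-trans (ι-mono n<m) ιm≤ιn)
    where
    ι< : ∀ n → ι n < ι (suc n)
    ι< n = subst (ι n <_) (sym (ι-suc n)) (subst (_< 1ℚ + ι n) (+-identityˡ (ι n)) (+-monoˡ-< (ι n) (positive⁻¹ 1ℚ)))

  -- The partial sum through degree 7 is just above 300, and (15/16)² · 64 · 300 still exceeds 128²
  -- = 16384.
  300≤exp6 : ∀ i → 7 ℕ.≤ i → ι 300 ≤ approx (real (exp 6)) i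
  300≤exp6 i 7≤i = go (ℕ.≤⇒≤′ 7≤i)
    where
    go : ∀ {i} → 7 ℕ.≤′ i → ι 300 ≤ sum≤ (exp-term 6) i
    go (ℕ.≤′-reflexive refl)   = ≤ᵇ⇒≤ _
    go (ℕ.≤′-step {n = i} 7≤i) = ≤-trans (go 7≤i) (≤-+ʳ (exp-term-nonNeg 6 (suc i)))

  -- The comparison of reals and the bisection interval lose 1/32 each. Since r ≥ 1, the total 1/16
  -- is at most r/16 and is absorbed by the factor 15/16.
  √-lower : ∀ (x : ℝ⁺) r → 1 ℕ.≤ r → fromℕ r ≤ᴿ real (√ x) → ∀ N →
    ∃[ i ] (N ℕ.≤ i × (1ℚ - ½ ** 4) * ι r * ((1ℚ - ½ ** 4) * ι r) ≤ approx (real x) i)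
  √-lower x r 1≤r r≤√x N = i , ℕ.≤-trans (ℕ.m≤m⊔n N N₁) (ℕ.m≤m⊔n (N ℕ.⊔ N₁) N₂) , ≤-trans
    (*-mono-≤-nonNeg 0≤ρr (≤-trans 0≤ρr ρr≤lo) ρr≤lo ρr≤lo) (proj₁ (proj₂ bounds))
    where
    open ≤-Reasoning
    open +-*-Solver
    q : Seq
    q = approx (real x)
    e ρ : ℚ
    e = ½ ** 5
    ρ = 1ℚ - ½ ** 4
    0<e : 0ℚ < e
    0<e = positive⁻¹ e
    0≤ρr : 0ℚ ≤ ρ * ι r
    0≤ρr = 0≤* ρ (ι r) (nonNegative⁻¹ ρ) (0≤ι r)
    N₁ N₂ i : ℕ
    N₁ = proj₁ (r≤√x e 0<e)
    N₂ = proj₁ (width→0 q (cauchy (real x)) e 0<e)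
    i = (N ℕ.⊔ N₁) ℕ.⊔ N₂
    lo : ℚ
    lo = √lo (q i) i
    bounds : 0ℚ ≤ lo × lo * lo ≤ q i × q i ≤ √hi (q i) i * √hi (q i) i
    bounds = √-bounds (<⇒≤ (positive-approx x i)) i
    r≤ : ι r ≤ lo + width (q i) i + e
    r≤ = proj₂ (r≤√x e 0<e) i (ℕ.≤-trans (ℕ.m≤n⊔m N N₁) (ℕ.m≤m⊔n (N ℕ.⊔ N₁) N₂))
    w≤ : width (q i) i ≤ e
    w≤ = proj₂ (width→0 q (cauchy (real x)) e 0<e) i (ℕ.m≤n⊔m (N ℕ.⊔ N₁) N₂)
    ρr≤lo : ρ * ι r ≤ lo
    ρr≤lo = begin
      (1ℚ - ½ ** 4) * ι r  ≡⟨ solve 2 (λ h r → (con 1ℚ :- h) :* r := r :- h :* r) refl (½ ** 4) (ι r) ⟩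
      ι r - ½ ** 4 * ι r  ≤⟨ +-mono-≤ r≤ (neg-antimono-≤ (*-monoˡ (½ ** 4) (nonNegative⁻¹ (½ ** 4)) (ι-mono 1≤r))) ⟩
      lo + width (q i) i + e - ½ ** 4 * 1ℚ ≤⟨ +-monoˡ-≤ (- (½ ** 4 * 1ℚ)) (+-monoˡ-≤ e (+-monoʳ-≤ lo w≤)) ⟩
      lo + e + e - ½ ** 4 * 1ℚ  ≡⟨ trans (+-assoc (lo + e) e (- (½ ** 4 * 1ℚ))) (trans (+-assoc lo e (e - ½ ** 4 * 1ℚ)) (+-identityʳ lo)) ⟩
      lo  ∎

  maxRadius-bound : ∀ n k (2≤k : 2 ℕ.≤ k) (2k≤n : 2 ℕ.* k ℕ.≤ n) r →
    fromℕ r ≤ᴿ real (maxRadius n k 2≤k 2k≤n) → 16384 ℕ.* (r ℕ.* r ℕ.* k) ℕ.≤ n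
  maxRadius-bound n k 2≤k 2k≤n zero r≤ = ℕ.≤-trans (ℕ.≤-reflexive (ℕ.*-zeroʳ 16384)) z≤n
  maxRadius-bound n k 2≤k 2k≤n r@(suc _) r≤ = ι-cancel-≤ (begin
    ι (16384 ℕ.* (r ℕ.* r ℕ.* k))
      ≡⟨ trans (ι-* 16384 (r ℕ.* r ℕ.* k)) (cong (ι 16384 *_) (trans (ι-* (r ℕ.* r) k) (cong (_* ι k) (ι-* r r)))) ⟩
    ι 16384 * (ι r * ι r * ι k)
      ≤⟨ *-monoʳ (ι r * ι r * ι k) (0≤* (ι r * ι r) (ι k) (0≤* (ι r) (ι r) (0≤ι r) (0≤ι r)) (0≤ι k)) (≤ᵇ⇒≤ {ι 16384} {ρ * ρ * (ι 64 * ι 300)} _) ⟩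
    ρ * ρ * (ι 64 * ι 300) * (ι r * ι r * ι k)
      ≡⟨ solve 5 (λ p a b r k → p :* p :* (a :* b) :* (r :* r :* k) := (p :* r :* (p :* r)) :* (a :* b :* k))
           refl ρ (ι 64) (ι 300) (ι r) (ι k) ⟩
    (ρ * ι r * (ρ * ι r)) * (ι 64 * ι 300 * ι k)
      ≤⟨ *-mono-≤-nonNeg (0≤* (ρ * ι r) (ρ * ι r) 0≤ρr 0≤ρr) (<⇒≤ (positive-approx D i)) (proj₂ (proj₂ found))
           (*-monoʳ (ι k) (0≤ι k) (*-monoˡ (ι 64) (0≤ι 64) (300≤exp6 i (proj₁ (proj₂ found))))) ⟩
    approx (real x) i * d
      ≡⟨ solve 3 (λ n r d → n :* r :* d := n :* (d :* r)) refl (ι n) (recip d (positive-approx D i)) d ⟩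
    ι n * (d * recip d (positive-approx D i))
      ≡⟨ cong (ι n *_) (recip-inverseʳ d (positive-approx D i)) ⟩
    ι n * 1ℚ
      ≡⟨ *-identityʳ (ι n) ⟩
    ι n ∎)
    where
    open ≤-Reasoning
    open +-*-Solver
    instance
      k≢0 : ℕ.NonZero k
      k≢0 = ℕ.>-nonZero (ℕ.≤-trans (s≤s z≤n) 2≤k)
      n≢0 : ℕ.NonZero n
      n≢0 = ℕ.>-nonZero (ℕ.≤-trans (s≤s z≤n) (ℕ.≤-trans 2≤k (ℕ.≤-trans (ℕ.m≤n*m k 2) 2k≤n)))
    D x : ℝ⁺
    D = fromℕ⁺ 64 · exp 6 · fromℕ⁺ k
    x = fromℕ⁺ n ∕ D
    ρ : ℚ
    ρ = 1ℚ - ½ ** 4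
    0≤ρr : 0ℚ ≤ ρ * ι r
    0≤ρr = 0≤* ρ (ι r) (nonNegative⁻¹ ρ) (0≤ι r)
    found : ∃[ i ] (7 ℕ.≤ i × ρ * ι r * (ρ * ι r) ≤ approx (real x) i)
    found = √-lower x r (s≤s z≤n) r≤ 7
    i : ℕ
    i = proj₁ found
    d : ℚ
    d = approx (real D) i

  harmonic-+ : ∀ m l l′ → harmonic m (l ℕ.+ l′) ≡ harmonic m l + harmonic (m ℕ.+ l) l′
  harmonic-+ m l zero     = trans (cong (harmonic m) (ℕ.+-identityʳ l)) (sym (+-identityʳ (harmonic m l)))
  harmonic-+ m l (suc l′) = begin
    harmonic m (l ℕ.+ suc l′)  ≡⟨ cong (harmonic m) (ℕ.+-suc l l′) ⟩
    harmonic m (l ℕ.+ l′) + unit (m ℕ.+ (l ℕ.+ l′))  ≡⟨ cong₂ (λ a b → a + unit b) (harmonic-+ m l l′) (sym (ℕ.+-assoc m l l′)) ⟩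
    harmonic m l + harmonic (m ℕ.+ l) l′ + unit (m ℕ.+ l ℕ.+ l′) ≡⟨ +-assoc (harmonic m l) (harmonic (m ℕ.+ l) l′) (unit (m ℕ.+ l ℕ.+ l′)) ⟩
    harmonic m l + harmonic (m ℕ.+ l) (suc l′)  ∎
    where open ≡-Reasoning

  harmonic-lower : ∀ m l {b} → m ℕ.+ l ℕ.≤ suc b → ι l * unit b ≤ harmonic m l
  harmonic-lower m zero    {b} _ = ≤-reflexive (*-zeroˡ (unit b))
  harmonic-lower m (suc l) {b} m+l≤ = begin
    ι (suc l) * unit b  ≡⟨ cong (_* unit b) (ι-suc l) ⟩
    (1ℚ + ι l) * unit b  ≡⟨ solve 2 (λ a b → (con 1ℚ :+ a) :* b := a :* b :+ b) refl (ι l) (unit b) ⟩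
    ι l * unit b + unit b         ≤⟨ +-mono-≤ (harmonic-lower m l (ℕ.m≤n⇒m≤1+n m+l≤b)) (unit-anti m+l≤b) ⟩
    harmonic m l + unit (m ℕ.+ l) ∎
    where
    open ≤-Reasoning
    open +-*-Solver
    m+l≤b : m ℕ.+ l ℕ.≤ b
    m+l≤b = ℕ.s≤s⁻¹ (ℕ.≤-trans (ℕ.≤-reflexive (sym (ℕ.+-suc m l))) m+l≤)

  harmonic-mono : ∀ m {l l′} → l ℕ.≤ l′ → harmonic m l ≤ harmonic m l′
  harmonic-mono m {l} l≤l′ = go (ℕ.≤⇒≤′ l≤l′)
    where
    go : ∀ {l′} → l ℕ.≤′ l′ → harmonic m l ≤ harmonic m l′
    go (ℕ.≤′-reflexive refl)       = ≤-refl
    go (ℕ.≤′-step {n = l′} l≤′l′) = ≤-trans (go l≤′l′) (≤-+ʳ (unit-nonNeg (m ℕ.+ l′)))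

  -- Each block of 2^Λ consecutive reciprocals contributes at least ½.
  ½Λ≤harmonic : ∀ Λ l → 2 ℕ.^ Λ ℕ.≤ suc l → ½ * ι Λ ≤ harmonic 1 l
  ½Λ≤harmonic zero    l _  = ≤-trans (≤-reflexive (*-zeroʳ ½)) (harmonic-mono 1 {0} {l} z≤n)
  ½Λ≤harmonic (suc Λ) l 2^Λ≤ with 2 ℕ.^ Λ | ℕ.m^n≢0 2 Λ | ½Λ≤harmonic Λ
  ... | suc p | _ | ih = begin
    ½ * ι (suc Λ)  ≡⟨ trans (cong (½ *_) (trans (ι-suc Λ) (+-comm 1ℚ (ι Λ)))) (*-distribˡ-+ ½ (ι Λ) 1ℚ) ⟩
    ½ * ι Λ + ½ * 1ℚ  ≤⟨ +-mono-≤ (ih p ℕ.≤-refl) (≤-trans (≤-reflexive block)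
                                                        (harmonic-lower (suc p) (suc p) (ℕ.≤-reflexive (cong suc (ℕ.+-suc p p))))) ⟩
    harmonic 1 p + harmonic (1 ℕ.+ p) (suc p)      ≡⟨ harmonic-+ 1 p (suc p) ⟨
    harmonic 1 (p ℕ.+ suc p)  ≤⟨ harmonic-mono 1 (ℕ.s≤s⁻¹ (subst (λ z → suc p ℕ.+ z ℕ.≤ suc l) (ℕ.+-identityʳ (suc p)) 2^Λ≤)) ⟩
    harmonic 1 l  ∎
    where
    open ≤-Reasoning
    v : ℚ
    v = unit (suc (p ℕ.+ p))
    block : ½ * 1ℚ ≡ ι (suc p) * v
    block = begin-equality
      ½ * 1ℚ  ≡⟨ cong (½ *_) (trans (sym (/-ι 1 (suc p))) (*-comm (unit p) (ι (suc p)))) ⟩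
      ½ * (ι (suc p) * unit p)  ≡⟨ cong (λ z → ½ * (ι (suc p) * z)) (unit-double p) ⟨
      ½ * (ι (suc p) * (v + v))  ≡⟨ solve 3 (λ h a v → h :* (a :* (v :+ v)) := h :* (a :* v) :+ h :* (a :* v)) refl ½ (ι (suc p)) v ⟩
      ½ * (ι (suc p) * v) + ½ * (ι (suc p) * v)  ≡⟨ ½+½ (ι (suc p) * v) ⟩
      ι (suc p) * v  ∎
      where open +-*-Solver

  ½Λ≤log : ∀ n Λ → 1 ℕ.≤ n → 2 ℕ.^ Λ ℕ.≤ n → ∀ j → ½ * ι Λ ≤ log-approx n j
  ½Λ≤log n Λ 1≤n 2^Λ≤n zero    = ½Λ≤harmonic Λ ((n ℕ.∸ 1) ℕ.* 1)
    (ℕ.≤-trans 2^Λ≤n (ℕ.≤-reflexive (trans (sym (ℕ.m+[n∸m]≡n 1≤n)) (cong suc (sym (ℕ.*-identityʳ (n ℕ.∸ 1)))))))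
  ½Λ≤log n Λ 1≤n 2^Λ≤n (suc j) = ≤-trans (½Λ≤log n Λ 1≤n 2^Λ≤n j) (log-approx-up n j)

  ≤√hi : ∀ K k → K ℕ.* K ℕ.≤ k → ∀ i → ι K ≤ √hi (ι k) i
  ≤√hi K k K²≤k i = ≮⇒≥ λ hi<K → <⇒≱ (sq-< 0≤hi hi<K)
    (≤-trans (≤-trans (≤-reflexive (sym (ι-* K K))) (ι-mono K²≤k)) (proj₂ (proj₂ (√-bounds (0≤ι k) i))))
    where
    0≤hi : 0ℚ ≤ √hi (ι k) i
    0≤hi = 0≤+ (proj₁ (√-bounds (0≤ι k) i)) (width-nonNeg (0≤ι k) i)

  -- With √k ≥ K and log n ≥ Λ/2 the rate is at most 4n/(KΛ²), which is the origin of the 4. The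
  -- estimate holds for every single approximation.
  rate-bound : ∀ N .{{_ : ℕ.NonZero N}} n k (2≤k : 2 ℕ.≤ k) (2k≤n : 2 ℕ.* k ℕ.≤ n) K Λ t →
    K ℕ.* K ℕ.≤ k → 2 ℕ.^ Λ ℕ.≤ n → 4 ℕ.* n ℕ.≤ t ℕ.* N ℕ.* (K ℕ.* (Λ ℕ.* Λ)) →
    real (fromℕ⁺ N ⁻¹ · rate n k 2≤k 2k≤n) ≤ᴿ fromℕ t
  rate-bound N n k 2≤k 2k≤n K Λ t K²≤k 2^Λ≤n 4n≤ ε 0<ε = 0 , λ i _ → ≤-trans (bound i) (≤-+ʳ (<⇒≤ 0<ε))
    where
    open ≤-Reasoning
    open +-*-Solver
    1≤n : 1 ℕ.≤ n
    1≤n = ℕ.≤-trans (s≤s z≤n) (ℕ.≤-trans 2≤k (ℕ.≤-trans (ℕ.m≤n*m k 2) 2k≤n))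
    instance
      k≢0 : ℕ.NonZero k
      k≢0 = ℕ.>-nonZero (ℕ.≤-trans (s≤s z≤n) 2≤k)
      n>1 : NonTrivial n
      n>1 = ℕ.n>1⇒nonTrivial (ℕ.≤-trans 2≤k (ℕ.≤-trans (ℕ.m≤n*m k 2) 2k≤n))
    D : ℝ⁺
    D = (√ fromℕ⁺ k) · (log n · log n)
    W : ℕ → ℚ
    W i = approx (real D) i
    0<W : ∀ i → 0ℚ < W i
    0<W = positive-approx D
    0<N : 0ℚ < ι N
    0<N = positive⁻¹ (ι N) {{ι-pos N}}
    0≤½Λ : 0ℚ ≤ ½ * ι Λ
    0≤½Λ = 0≤* ½ (ι Λ) (nonNegative⁻¹ ½) (0≤ι Λ)
    W≥ : ∀ i → ι K * (½ * ι Λ * (½ * ι Λ)) ≤ W i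
    W≥ i = *-mono-≤-nonNeg (0≤ι K) (≤-trans (0≤* (½ * ι Λ) (½ * ι Λ) 0≤½Λ 0≤½Λ) logs) (≤√hi K k K²≤k i) logs
      where
      logs : ½ * ι Λ * (½ * ι Λ) ≤ log-approx n i * log-approx n i
      logs = *-mono-≤-nonNeg 0≤½Λ (≤-trans 0≤½Λ (½Λ≤log n Λ 1≤n 2^Λ≤n i)) (½Λ≤log n Λ 1≤n 2^Λ≤n i) (½Λ≤log n Λ 1≤n 2^Λ≤n i)
    n≤ : ∀ i → ι n ≤ ι t * (ι N * W i)
    n≤ i = *-cancelˡ-≤-pos (ι 4) (begin
      ι 4 * ι n  ≡⟨ ι-* 4 n ⟨
      ι (4 ℕ.* n)  ≤⟨ ι-mono 4n≤ ⟩
      ι (t ℕ.* N ℕ.* (K ℕ.* (Λ ℕ.* Λ)))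
        ≡⟨ trans (ι-* (t ℕ.* N) (K ℕ.* (Λ ℕ.* Λ))) (cong₂ _*_ (ι-* t N) (trans (ι-* K (Λ ℕ.* Λ)) (cong (ι K *_) (ι-* Λ Λ)))) ⟩
      ι t * ι N * (ι K * (ι Λ * ι Λ))
        ≡⟨ solve 4 (λ t n k l → t :* n :* (k :* (l :* l)) := con (ι 4) :* (t :* (n :* (k :* (con ½ :* l :* (con ½ :* l))))))
             refl (ι t) (ι N) (ι K) (ι Λ) ⟩
      ι 4 * (ι t * (ι N * (ι K * (½ * ι Λ * (½ * ι Λ)))))
        ≤⟨ *-monoˡ (ι 4) (0≤ι 4) (*-monoˡ (ι t) (0≤ι t) (*-monoˡ (ι N) (0≤ι N) (W≥ i))) ⟩
      ι 4 * (ι t * (ι N * W i)) ∎)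
    bound : ∀ i → approx (real (fromℕ⁺ N ⁻¹ · rate n k 2≤k 2k≤n)) i ≤ ι t
    bound i = *-cancelʳ-≤-pos (ι N * W i) {{positive (*-pos 0<N (0<W i))}} (begin
      recip (ι N) 0<N * (ι n * recip (W i) (0<W i)) * (ι N * W i)
        ≡⟨ solve 5 (λ a n b c d → a :* (n :* b) :* (c :* d) := n :* ((c :* a) :* (d :* b))) refl
             (recip (ι N) 0<N) (ι n) (recip (W i) (0<W i)) (ι N) (W i) ⟩
      ι n * ((ι N * recip (ι N) 0<N) * (W i * recip (W i) (0<W i)))
        ≡⟨ cong (ι n *_) (cong₂ _*_ (recip-inverseʳ (ι N) 0<N) (recip-inverseʳ (W i) (0<W i))) ⟩
      ι n * (1ℚ * 1ℚ)
        ≡⟨ *-identityʳ (ι n) ⟩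
      ι n
        ≤⟨ n≤ i ⟩
      ι t * (ι N * W i) ∎)

-- Integer scales and the arithmetic of the rate.

module Parameters where
  open import Data.Nat
  open import Data.Nat.DivMod using (_/_; m≡m%n+[m/n]*n; m%n<n; m/n*n≤m; /-monoˡ-≤; m*n/n≡m)
  open import Data.Nat.Properties
  open import Data.Nat.Solver using (module +-*-Solver)

  ⌈√⌉ : ∀ k → 1 ≤ k → ∃[ K ] (K * K < k × k ≤ suc K * suc K)
  ⌈√⌉ (suc zero)    _ = 0 , s≤s z≤n , s≤s z≤n
  ⌈√⌉ (suc (suc k)) _ with ⌈√⌉ (suc k) (s≤s z≤n)
  ... | K , K²<k , k≤K′² with m≤n⇒m<n∨m≡n k≤K′²
  ...   | inj₁ k<K′² = K , m≤n⇒m≤1+n K²<k , k<K′²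
  ...   | inj₂ k≡K′² = suc K , s≤s (≤-reflexive (sym k≡K′²)) , (begin
    suc (suc k)  ≡⟨ cong suc k≡K′² ⟩
    suc (suc K * suc K)  ≤⟨ s≤s (m≤m+n (suc K * suc K) (suc K + suc K)) ⟩
    suc (suc K * suc K + (suc K + suc K))
      ≡⟨ solve 1 (λ x → con 1 :+ (x :* x :+ (x :+ x)) := (con 1 :+ x) :* (con 1 :+ x)) refl (suc K) ⟩
    suc (suc K) * suc (suc K)  ∎)
    where
    open ≤-Reasoning
    open +-*-Solver

  ⌊log₂⌋ : ∀ n → 1 ≤ n → ∃[ Λ ] (2 ^ Λ ≤ n × n < 2 ^ suc Λ)
  ⌊log₂⌋ (suc zero)    _ = 0 , s≤s z≤n , s≤s (s≤s z≤n)
  ⌊log₂⌋ (suc (suc n)) _ with ⌊log₂⌋ (suc n) (s≤s z≤n)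
  ... | Λ , 2^Λ≤n , n<2^Λ′ with m≤n⇒m<n∨m≡n n<2^Λ′
  ...   | inj₁ 1+n<2^Λ′ = Λ , m≤n⇒m≤1+n 2^Λ≤n , 1+n<2^Λ′
  ...   | inj₂ 1+n≡2^Λ′ = suc Λ , ≤-reflexive (sym 1+n≡2^Λ′) , (begin-strict
    suc (suc n)  ≡⟨ 1+n≡2^Λ′ ⟩
    2 ^ suc Λ  <⟨ ^-monoʳ-< 2 (s≤s (s≤s z≤n)) (n<1+n (suc Λ)) ⟩
    2 ^ suc (suc Λ)  ∎)
    where open ≤-Reasoning

  square-cancel-≤ : ∀ {a b} → a * a ≤ b * b → a ≤ b
  square-cancel-≤ a²≤b² = ≮⇒≥ λ b<a → <⇒≱ (*-mono-< b<a b<a) a²≤b²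

  ^2-cancel-≤ : ∀ {a b} → 2 ^ a < 2 ^ b → a < b
  ^2-cancel-≤ {a} {b} <2^b = ≰⇒> λ b≤a → <⇒≱ <2^b (^-monoʳ-≤ 2 b≤a)

  -- For x ≥ 10 one has (1 + 1/x)⁴ ≤ 1.1⁴ < 2.
  fourth-power-step : ∀ x → 10 ≤ x → (suc x * suc x) * (suc x * suc x) ≤ 2 * ((x * x) * (x * x))
  fourth-power-step x 10≤x = *-cancelˡ-≤ 10000 (begin
    10000 * ((suc x * suc x) * (suc x * suc x))
      ≡⟨ scale 10 (suc x) ⟩
    ((10 * suc x) * (10 * suc x)) * ((10 * suc x) * (10 * suc x))
      ≤⟨ *-mono-≤ (*-mono-≤ tenfold tenfold) (*-mono-≤ tenfold tenfold) ⟩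
    ((11 * x) * (11 * x)) * ((11 * x) * (11 * x))
      ≡⟨ scale 11 x ⟨
    14641 * ((x * x) * (x * x))
      ≤⟨ *-monoˡ-≤ ((x * x) * (x * x)) {14641} {20000} (≤ᵇ⇒≤ 14641 20000 _) ⟩
    20000 * ((x * x) * (x * x))
      ≡⟨ *-assoc 10000 2 ((x * x) * (x * x)) ⟩
    10000 * (2 * ((x * x) * (x * x))) ∎)
    where
    open ≤-Reasoning
    open +-*-Solver
    scale : ∀ c y → ((c * c) * (c * c)) * ((y * y) * (y * y)) ≡ ((c * y) * (c * y)) * ((c * y) * (c * y))
    scale = solve 2 (λ c y → ((c :* c) :* (c :* c)) :* ((y :* y) :* (y :* y)) :=
                             ((c :* y) :* (c :* y)) :* ((c :* y) :* (c :* y))) refl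
    tenfold : 10 * suc x ≤ 11 * x
    tenfold = ≤-trans (≤-reflexive (*-suc 10 x)) (+-monoˡ-≤ (10 * x) 10≤x)

  Λ₀ : ℕ
  Λ₀ = 50

  -- With 2^Λ ≤ s² this gives 1024 (Λ + 2)² ≤ s after taking roots. Raising Λ by one at most doubles
  -- the fourth power on the left; the induction starts at `Λ₀`.
  exponential-growth : ∀ d → (1024 * ((2 + (d + Λ₀)) * (2 + (d + Λ₀)))) * (1024 * ((2 + (d + Λ₀)) * (2 + (d + Λ₀)))) ≤ 2 ^ (d + Λ₀)
  exponential-growth zero    = ≤ᵇ⇒≤ ((1024 * (52 * 52)) * (1024 * (52 * 52))) (2 ^ 50) _
  exponential-growth (suc d) = begin
    (1024 * (suc x * suc x)) * (1024 * (suc x * suc x))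
      ≡⟨ pull 1024 (suc x) ⟩
    (1024 * 1024) * ((suc x * suc x) * (suc x * suc x))
      ≤⟨ *-monoʳ-≤ (1024 * 1024) (fourth-power-step x (≤-trans (≤ᵇ⇒≤ 10 52 _) (m≤n+m 52 d |> λ p → ≤-trans p (≤-reflexive shift)))) ⟩
    (1024 * 1024) * (2 * ((x * x) * (x * x)))
      ≡⟨ solve 2 (λ c y → c :* (con 2 :* y) := con 2 :* (c :* y)) refl (1024 * 1024) ((x * x) * (x * x)) ⟩
    2 * ((1024 * 1024) * ((x * x) * (x * x)))
      ≡⟨ cong (2 *_) (pull 1024 x) ⟨
    2 * ((1024 * (x * x)) * (1024 * (x * x)))
      ≤⟨ *-monoʳ-≤ 2 (exponential-growth d) ⟩
    2 ^ (suc d + Λ₀) ∎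
    where
    open ≤-Reasoning
    open +-*-Solver
    x : ℕ
    x = 2 + (d + Λ₀)
    shift : d + 52 ≡ x
    shift = trans (+-comm d 52) (cong (2 +_) (+-comm 50 d))
    pull : ∀ c y → (c * (y * y)) * (c * (y * y)) ≡ (c * c) * ((y * y) * (y * y))
    pull = solve 2 (λ c y → (c :* (y :* y)) :* (c :* (y :* y)) := (c :* c) :* ((y :* y) :* (y :* y))) refl

  m<[1+m/n]*n : ∀ m n .{{_ : NonZero n}} → m < suc (m / n) * n
  m<[1+m/n]*n m n = subst (_< suc (m / n) * n) (sym (m≡m%n+[m/n]*n m n)) (+-monoˡ-< (m / n * n) (m%n<n m n))

  -- If the quotient is at least 1, rounding it down loses at most a factor of 2.
  m≤2[m/n*n] : ∀ {m n} .{{_ : NonZero n}} → n ≤ m → m ≤ 2 * (m / n * n)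
  m≤2[m/n*n] {m} {n} n≤m = ≤-trans (<⇒≤ (m<[1+m/n]*n m n))
    (+-mono-≤ (n≤q*n (m / n) refl) (≤-reflexive (sym (+-identityʳ (m / n * n)))))
    where
    n≤q*n : ∀ q → q ≡ m / n → n ≤ q * n
    n≤q*n zero    eq = contradiction n≤m (<⇒≱ (subst (m <_) (trans (cong (λ q → suc q * n) (sym eq)) (+-identityʳ n)) (m<[1+m/n]*n m n)))
    n≤q*n (suc q) eq = m≤m+n n (q * n)

  ≤/ : ∀ {a m n} .{{_ : NonZero n}} → a * n ≤ m → a ≤ m / n
  ≤/ {a} {m} {n} an≤m = subst (_≤ m / n) (m*n/n≡m a n) (/-monoˡ-≤ n an≤m)

  -- In the application n = s², K + 1 = ⌈√k⌉ and Λ = ⌊log₂ n⌋. Agents within γ = Θ(√(n/k)) of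
  -- each other are linked, μ bounds their moves during a phase, and d is the distance that the
  -- rumor has to cover; q = 0 means that γ is only of order log n.
  module Scales (s k r K Λ : ℕ) (2≤k : 2 ≤ k) (K²<k : K * K < k) (k≤[1+K]² : k ≤ suc K * suc K)
    (large : 1024 * ((2 + Λ) * (2 + Λ)) ≤ s) (radius : 16384 * (r * r * k) ≤ s * s)
    where

    private
      module Solver = +-*-Solver

    g G γ q μ d : ℕ
    -- `g` is the number of links that an island path may not reach, and `G * γ` covers
    -- `g * γ + (μ + μ)`. The 21 makes 8(2γ + 1) ≤ 21γ for γ ≥ 2, hence density at most 1/(64k). The
    -- 36 fits three typical displacements 6Iq with I = 2G into γ. The 5 makes 4d + 2 ≤ s, so a ball
    -- of radius d has density at most 1/4.
    g = suc Λ
    G = suc g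
    γ = s / (21 * suc K)
    q = γ / (36 * G)
    μ = γ / 3
    d = s / 5

    1≤K : 1 ≤ K
    1≤K = n≢0⇒n>0 λ { refl → <⇒≱ 2≤k k≤[1+K]² }

    1+K≤2K : suc K ≤ 2 * K
    1+K≤2K = ≤-trans (+-monoˡ-≤ K 1≤K) (≤-reflexive (cong (K +_) (sym (+-identityʳ K))))

    1024G≤s : 1024 * G ≤ s
    1024G≤s = ≤-trans (*-monoʳ-≤ 1024 (m≤m*n G G)) large

    1000≤s : 1000 ≤ s
    1000≤s = ≤-trans (≤ᵇ⇒≤ 1000 1024 _) (≤-trans (m≤m*n 1024 G) 1024G≤s)

    γ[21+21K]≤s : γ * (21 * suc K) ≤ s
    γ[21+21K]≤s = m/n*n≤m s (21 * suc K)

    γ≤s : γ ≤ s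
    γ≤s = ≤-trans (m≤m*n γ (21 * suc K)) γ[21+21K]≤s

    3r≤γ : 3 * r ≤ γ
    3r≤γ = ≤/ (begin
      3 * r * (21 * suc K)     ≡⟨ solve 2 (λ r x → con 3 :* r :* (con 21 :* x) := con 63 :* (r :* x)) refl r (suc K) ⟩
      -- The constant 16384 in `radius` is 128², and 64 · 2K = 128K.
      63 * (r * suc K)         ≤⟨ *-mono-≤ (≤ᵇ⇒≤ 63 64 _) (*-monoʳ-≤ r 1+K≤2K) ⟩
      64 * (r * (2 * K))       ≡⟨ solve 2 (λ r x → con 64 :* (r :* (con 2 :* x)) := con 128 :* (r :* x)) refl r K ⟩
      128 * (r * K)  ≤⟨ square-cancel-≤ squares ⟩
      s  ∎)
      where
      open ≤-Reasoning
      open Solver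
      squares : (128 * (r * K)) * (128 * (r * K)) ≤ s * s
      squares = begin
        (128 * (r * K)) * (128 * (r * K))
          ≡⟨ solve 3 (λ c r x → (c :* (r :* x)) :* (c :* (r :* x)) := (c :* c) :* (r :* r :* (x :* x))) refl 128 r K ⟩
        16384 * (r * r * (K * K))
          ≤⟨ *-monoʳ-≤ 16384 (*-monoʳ-≤ (r * r) (<⇒≤ K²<k)) ⟩
        16384 * (r * r * k)
          ≤⟨ radius ⟩
        s * s ∎

    3μ≤γ : μ * 3 ≤ γ
    3μ≤γ = m/n*n≤m γ 3

    r+2μ≤γ : r + (μ + μ) ≤ γ
    r+2μ≤γ = *-cancelˡ-≤ 3 (begin
      3 * (r + (μ + μ))        ≡⟨ solve 2 (λ r m → con 3 :* (r :+ (m :+ m)) := con 3 :* r :+ (m :* con 3 :+ m :* con 3)) refl r μ ⟩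
      3 * r + (μ * 3 + μ * 3)  ≤⟨ +-mono-≤ 3r≤γ (+-mono-≤ 3μ≤γ 3μ≤γ) ⟩
      γ + (γ + γ)  ≡⟨ solve 1 (λ x → x :+ (x :+ x) := con 3 :* x) refl γ ⟩
      3 * γ  ∎)
      where
      open ≤-Reasoning
      open Solver

    2μ≤γ : μ + μ ≤ γ
    2μ≤γ = ≤-trans (m≤n+m (μ + μ) r) r+2μ≤γ

    sparse : 2 ≤ γ → 64 * k * ((2 * γ + 1) * (2 * γ + 1)) ≤ s * s
    sparse 2≤γ = begin
      64 * k * ((2 * γ + 1) * (2 * γ + 1))
        ≤⟨ *-monoˡ-≤ ((2 * γ + 1) * (2 * γ + 1)) (*-monoʳ-≤ 64 k≤[1+K]²) ⟩
      64 * (suc K * suc K) * ((2 * γ + 1) * (2 * γ + 1))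
        ≡⟨ solve 2 (λ x y → con 64 :* (x :* x) :* (y :* y) := (con 8 :* y :* x) :* (con 8 :* y :* x)) refl (suc K) (2 * γ + 1) ⟩
      (8 * (2 * γ + 1) * suc K) * (8 * (2 * γ + 1) * suc K)
        ≤⟨ *-mono-≤ side side ⟩
      s * s ∎
      where
      open ≤-Reasoning
      open Solver
      side : 8 * (2 * γ + 1) * suc K ≤ s
      side = begin
        8 * (2 * γ + 1) * suc K      ≤⟨ *-monoˡ-≤ (suc K) (begin
          8 * (2 * γ + 1)  ≡⟨ solve 1 (λ x → con 8 :* (con 2 :* x :+ con 1) := con 16 :* x :+ con 8) refl γ ⟩
          16 * γ + 8  ≤⟨ +-monoʳ-≤ (16 * γ) (≤-trans (≤ᵇ⇒≤ 8 10 _) (*-monoʳ-≤ 5 2≤γ)) ⟩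
          16 * γ + 5 * γ  ≡⟨ solve 1 (λ x → con 16 :* x :+ con 5 :* x := x :* con 21) refl γ ⟩
          γ * 21  ∎) ⟩
        γ * 21 * suc K  ≡⟨ *-assoc γ 21 (suc K) ⟩
        γ * (21 * suc K)  ≤⟨ γ[21+21K]≤s ⟩
        s  ∎

    5d≤s : d * 5 ≤ s
    5d≤s = m/n*n≤m s 5

    d≤s : d ≤ s
    d≤s = ≤-trans (m≤m*n d 5) 5d≤s

    2≤d : 2 ≤ d
    2≤d = ≤/ (≤-trans (≤ᵇ⇒≤ 10 1000 _) 1000≤s)

    quarter : 4 * ((2 * d + 1) * (2 * d + 1)) ≤ s * s
    quarter = begin
      4 * ((2 * d + 1) * (2 * d + 1))
        ≡⟨ solve 1 (λ x → con 4 :* ((con 2 :* x :+ con 1) :* (con 2 :* x :+ con 1)) :=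
                          (x :* con 4 :+ con 2) :* (x :* con 4 :+ con 2)) refl d ⟩
      (d * 4 + 2) * (d * 4 + 2)
        ≤⟨ *-mono-≤ side side ⟩
      s * s ∎
      where
      open ≤-Reasoning
      open Solver
      side : d * 4 + 2 ≤ s
      side = ≤-trans (+-monoʳ-≤ (d * 4) 2≤d) (≤-trans (≤-reflexive (trans (+-comm (d * 4) d) (sym (*-suc d 4)))) 5d≤s)

    s≤10d : s ≤ 10 * d
    s≤10d = ≤-trans (m≤2[m/n*n] (≤-trans (≤ᵇ⇒≤ 5 1000 _) 1000≤s))
      (≤-reflexive (solve 1 (λ x → con 2 :* (x :* con 5) := con 10 :* x) refl d))
      where open Solver

    s≤84Kγ : 1 ≤ γ → s ≤ 84 * (K * γ)
    s≤84Kγ 1≤γ = begin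
      s  ≤⟨ m≤2[m/n*n] (≤-trans (m≤n*m (21 * suc K) γ {{>-nonZero 1≤γ}}) γ[21+21K]≤s) ⟩
      2 * (γ * (21 * suc K))        ≤⟨ *-monoʳ-≤ 2 (*-monoʳ-≤ γ (*-monoʳ-≤ 21 1+K≤2K)) ⟩
      2 * (γ * (21 * (2 * K)))      ≡⟨ solve 2 (λ k x → con 2 :* (x :* (con 21 :* (con 2 :* k))) := con 84 :* (k :* x)) refl K γ ⟩
      84 * (K * γ)  ∎
      where
      open ≤-Reasoning
      open Solver

    G≤2Λ : 2 ≤ Λ → G ≤ 2 * Λ
    G≤2Λ 2≤Λ = ≤-trans (+-monoˡ-≤ Λ 2≤Λ) (≤-reflexive (cong (Λ +_) (sym (+-identityʳ Λ))))

    36Gq≤γ : q * (36 * G) ≤ γ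
    36Gq≤γ = m/n*n≤m γ (36 * G)

    module Diffusive (1≤q : 1 ≤ q) where

      I L : ℕ
      I = 2 * G
      L = I * (q * q)

      36G≤γ : 36 * G ≤ γ
      36G≤γ = ≤-trans (m≤n*m (36 * G) q {{>-nonZero 1≤q}}) 36Gq≤γ

      36≤γ : 36 ≤ γ
      36≤γ = ≤-trans (m≤m*n 36 G) 36G≤γ

      γ≤72Gq : γ ≤ 72 * (G * q)
      γ≤72Gq = ≤-trans (m≤2[m/n*n] 36G≤γ)
        (≤-reflexive (solve 2 (λ g x → con 2 :* (x :* (con 36 :* g)) := con 72 :* (g :* x)) refl G q))
        where open Solver

      typical≤μ : (3 * I) * q + (3 * I) * q ≤ μ
      typical≤μ = ≤/ (≤-trans (≤-reflexive
        (solve 2 (λ g x → ((con 3 :* (con 2 :* g)) :* x :+ (con 3 :* (con 2 :* g)) :* x) :* con 3 := x :* (con 36 :* g)) refl G q))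
        36Gq≤γ)
        where open Solver

      1≤L : 1 ≤ L
      1≤L = *-mono-≤ {1} {I} {1} {q * q} (s≤s z≤n) (*-mono-≤ 1≤q 1≤q)

      L≤γ² : L ≤ γ * γ
      L≤γ² = begin
        (2 * G) * (q * q)    ≡⟨ solve 2 (λ g x → (con 2 :* g) :* (x :* x) := (x :* (con 2 :* g)) :* x) refl G q ⟩
        (q * (2 * G)) * q    ≤⟨ *-mono-≤ (≤-trans (*-monoʳ-≤ q (*-monoˡ-≤ G {2} {36} (≤ᵇ⇒≤ 2 36 _))) 36Gq≤γ)
                                  (≤-trans (m≤m*n q (36 * G)) 36Gq≤γ) ⟩
        γ * γ  ∎
        where
        open ≤-Reasoning
        open Solver

    module Phased (G≤1+K : G ≤ suc K) (1≤γ : 1 ≤ γ) where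

      private instance
        γ≢0 : NonZero γ
        γ≢0 = >-nonZero 1≤γ
        Gγ≢0 : NonZero (G * γ)
        Gγ≢0 = m*n≢0 G γ

      P : ℕ
      P = d / (G * γ)

      PGγ≤d : P * (G * γ) ≤ d
      PGγ≤d = m/n*n≤m d (G * γ)

      -- Here √k has to be at least of order log n: this ensures that at least one phase fits, so
      -- that rounding in `P` costs only a factor of 2.
      Gγ≤d : G * γ ≤ d
      Gγ≤d = ≤/ (begin
        G * γ * 5  ≤⟨ *-mono-≤ (*-monoˡ-≤ γ G≤1+K) (≤ᵇ⇒≤ 5 21 _) ⟩
        suc K * γ * 21  ≡⟨ solve 2 (λ k x → k :* x :* con 21 := x :* (con 21 :* k)) refl (suc K) γ ⟩
        γ * (21 * suc K)         ≤⟨ γ[21+21K]≤s ⟩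
        s  ∎)
        where
        open ≤-Reasoning
        open Solver

      d≤2PGγ : d ≤ 2 * (P * (G * γ))
      d≤2PGγ = m≤2[m/n*n] Gγ≤d

      range≤d : P * (g * γ + (μ + μ)) ≤ d
      range≤d = ≤-trans (*-monoʳ-≤ P (≤-trans (+-monoʳ-≤ (g * γ) 2μ≤γ) (≤-reflexive (+-comm (g * γ) γ)))) PGγ≤d

      Pγ≤s : P * γ ≤ s
      Pγ≤s = ≤-trans (*-monoʳ-≤ P (m≤n*m γ G)) (≤-trans PGγ≤d d≤s)

      P≤s : P ≤ s
      P≤s = ≤-trans (m≤m*n P (G * γ)) (≤-trans PGγ≤d d≤s)

  -- 16 = 4 · 2²: the 4 of `rate-bound` and one 2 for each `G` replaced by 2Λ.
  finish : ∀ {s T K G Λ N} c → s * s ≤ c * (T * (K * (G * G))) → G ≤ 2 * Λ → 16 * c ≤ N →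
    4 * (s * s) ≤ T * N * (K * (Λ * Λ))
  finish {s} {T} {K} {G} {Λ} {N} c s²≤ G≤2Λ 16c≤N = begin
    4 * (s * s)  ≤⟨ *-monoʳ-≤ 4 s²≤ ⟩
    4 * (c * (T * (K * (G * G))))  ≤⟨ *-monoʳ-≤ 4 (*-monoʳ-≤ c (*-monoʳ-≤ T (*-monoʳ-≤ K (*-mono-≤ G≤2Λ G≤2Λ)))) ⟩
    4 * (c * (T * (K * ((2 * Λ) * (2 * Λ)))))
      ≡⟨ solve 4 (λ c t k l → con 4 :* (c :* (t :* (k :* ((con 2 :* l) :* (con 2 :* l))))) := (con 16 :* c) :* (t :* (k :* (l :* l)))) refl c T K Λ ⟩
    (16 * c) * (T * (K * (Λ * Λ)))  ≤⟨ *-monoˡ-≤ (T * (K * (Λ * Λ))) 16c≤N ⟩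
    N * (T * (K * (Λ * Λ)))
      ≡⟨ solve 3 (λ n t x → n :* (t :* x) := t :* n :* x) refl N T (K * (Λ * Λ)) ⟩
    T * N * (K * (Λ * Λ))  ∎
    where
    open ≤-Reasoning
    open +-*-Solver

  -- One factor s is estimated by the distance that P phases cover, the other by γ = Θ(s/√k). Each
  -- leaves one γ; replaced by a multiple of Gq, the two give the q² of the phase length.
  phased-diffusive-rate : ∀ a b c e {C s d K γ P G q} → a * b * e * (c * c) ≤ C →
    s ≤ a * d → s ≤ b * (K * γ) → d ≤ e * (P * (G * γ)) → γ ≤ c * (G * q) →
    s * s ≤ C * (P * ((2 * G) * (q * q)) * (K * (G * G)))
  phased-diffusive-rate a b c e {C} {s} {d} {K} {γ} {P} {G} {q} ≤C s≤ad s≤bKγ d≤ePGγ γ≤cGq = begin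
    s * s
      ≤⟨ *-mono-≤ (≤-trans s≤ad (*-monoʳ-≤ a (≤-trans d≤ePGγ (*-monoʳ-≤ e (*-monoʳ-≤ P (*-monoʳ-≤ G γ≤cGq))))))
           (≤-trans s≤bKγ (*-monoʳ-≤ b (*-monoʳ-≤ K γ≤cGq))) ⟩
    (a * (e * (P * (G * (c * (G * q)))))) * (b * (K * (c * (G * q))))
      ≡⟨ solve 8 (λ a b c e p g q k → (a :* (e :* (p :* (g :* (c :* (g :* q)))))) :* (b :* (k :* (c :* (g :* q)))) :=
                   (a :* b :* e :* (c :* c)) :* (p :* (g :* (q :* q)) :* (k :* (g :* g)))) refl a b c e P G q K ⟩
    (a * b * e * (c * c)) * (P * (G * (q * q)) * (K * (G * G)))
      ≤⟨ *-mono-≤ ≤C (*-monoˡ-≤ (K * (G * G)) (*-monoʳ-≤ P (*-monoˡ-≤ (q * q) (m≤n*m G 2)))) ⟩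
    C * (P * ((2 * G) * (q * q)) * (K * (G * G))) ∎
    where
    open ≤-Reasoning
    open +-*-Solver

  -- Both factors s come from γ, which yields K²; one K is traded for a logarithm.
  single-phase-rate : ∀ b c {C s K γ G q} → b * b * (c * c) ≤ C → s ≤ b * (K * γ) → γ ≤ c * (G * q) → K ≤ G →
    s * s ≤ C * (1 * ((2 * G) * (q * q)) * (K * (G * G)))
  single-phase-rate b c {C} {s} {K} {γ} {G} {q} ≤C s≤bKγ γ≤cGq K≤G = begin
    s * s
      ≤⟨ *-mono-≤ (≤-trans s≤bKγ (*-monoʳ-≤ b (*-mono-≤ K≤G γ≤cGq))) (≤-trans s≤bKγ (*-monoʳ-≤ b (*-monoʳ-≤ K γ≤cGq))) ⟩
    (b * (G * (c * (G * q)))) * (b * (K * (c * (G * q))))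
      ≡⟨ solve 5 (λ b c g q k → (b :* (g :* (c :* (g :* q)))) :* (b :* (k :* (c :* (g :* q)))) :=
                   (b :* b :* (c :* c)) :* (g :* (q :* q) :* (k :* (g :* g)))) refl b c G q K ⟩
    (b * b * (c * c)) * (G * (q * q) * (K * (G * G)))
      ≤⟨ *-mono-≤ ≤C (*-monoˡ-≤ (K * (G * G))
           (≤-trans (*-monoˡ-≤ (q * q) (m≤n*m G 2)) (≤-reflexive (sym (*-identityˡ ((2 * G) * (q * q))))))) ⟩
    C * (1 * ((2 * G) * (q * q)) * (K * (G * G))) ∎
    where
    open ≤-Reasoning
    open +-*-Solver

  phased-ballistic-rate : ∀ a b c e f {C s d K γ P G L} → a * b * e * (c * f) ≤ C →
    s ≤ a * d → s ≤ b * (K * γ) → d ≤ e * (P * (G * γ)) → γ ≤ c * G → γ ≤ f * L →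
    s * s ≤ C * (P * L * (K * (G * G)))
  phased-ballistic-rate a b c e f {C} {s} {d} {K} {γ} {P} {G} {L} ≤C s≤ad s≤bKγ d≤ePGγ γ≤cG γ≤fL = begin
    s * s
      ≤⟨ *-mono-≤ (≤-trans s≤ad (*-monoʳ-≤ a (≤-trans d≤ePGγ (*-monoʳ-≤ e (*-monoʳ-≤ P (*-monoʳ-≤ G γ≤fL))))))
           (≤-trans s≤bKγ (*-monoʳ-≤ b (*-monoʳ-≤ K γ≤cG))) ⟩
    (a * (e * (P * (G * (f * L))))) * (b * (K * (c * G)))
      ≡⟨ solve 9 (λ a b c e f p g l k → (a :* (e :* (p :* (g :* (f :* l))))) :* (b :* (k :* (c :* g))) :=
                   (a :* b :* e :* (c :* f)) :* (p :* l :* (k :* (g :* g)))) refl a b c e f P G L K ⟩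
    (a * b * e * (c * f)) * (P * L * (K * (G * G)))
      ≤⟨ *-monoˡ-≤ (P * L * (K * (G * G))) ≤C ⟩
    C * (P * L * (K * (G * G))) ∎
    where
    open ≤-Reasoning
    open +-*-Solver

  unphased-rate : ∀ a b {C s K P G} → a * b ≤ C → 1 ≤ G → s ≤ a * P → s ≤ b * (K * G) →
    s * s ≤ C * (P * 1 * (K * (G * G)))
  unphased-rate a b {C} {s} {K} {P} {G} ≤C 1≤G s≤aP s≤bKG = begin
    s * s  ≤⟨ *-mono-≤ s≤aP s≤bKG ⟩
    (a * P) * (b * (K * G))  ≤⟨ *-monoʳ-≤ (a * P) (*-monoʳ-≤ b (*-monoʳ-≤ K (m≤m*n G G {{>-nonZero 1≤G}}))) ⟩
    (a * P) * (b * (K * (G * G)))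
      ≡⟨ solve 5 (λ a b p k g → (a :* p) :* (b :* (k :* (g :* g))) := (a :* b) :* (p :* con 1 :* (k :* (g :* g)))) refl a b P K G ⟩
    (a * b) * (P * 1 * (K * (G * G)))      ≤⟨ *-monoˡ-≤ (P * 1 * (K * (G * G))) ≤C ⟩
    C * (P * 1 * (K * (G * G)))  ∎
    where
    open ≤-Reasoning
    open +-*-Solver

-- Error terms, the case distinction and the final estimate.

module Bounds where
  open import Defs
  open Powers
  open Expectation
  open Steps
  open Walks
  open Events
  open Outcome
  open Reals
  open Parameters
  open import Data.Nat using (s≤s; z≤n)
  open import Data.Nat.DivMod using (m/n*n≤m)
  import Data.Nat.Solver as ℕ
  open import Data.Rational
  open import Data.Rational.Properties
  open import Data.Rational.Solver using (module +-*-Solver)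
  open import Data.Vec using (lookup)

  ι*¼**≤½ : ∀ a I → 2 ℕ.* a ℕ.≤ 4 ℕ.^ I → ι a * ¼ ** I ≤ ½
  ι*¼**≤½ a I 2a≤4^I = begin
    ι a * ¼ ** I  ≡⟨ solve 2 (λ a b → a :* b := con ½ :* (con (ι 2) :* a :* b)) refl (ι a) (¼ ** I) ⟩
    ½ * (ι 2 * ι a * ¼ ** I)         ≤⟨ *-monoˡ ½ (nonNegative⁻¹ ½) (*-monoʳ (¼ ** I) (0≤** (nonNegative⁻¹ ¼) I)
                                         (≤-trans (≤-reflexive (sym (ι-* 2 a))) (ι-mono 2a≤4^I))) ⟩
    ½ * (ι (4 ℕ.^ I) * ¼ ** I)       ≡⟨ cong (½ *_) (trans (cong (_* ¼ ** I) (ι-^ 4 I)) (trans (sym (*-** (ι 4) ¼ I)) (1**n≡1 I))) ⟩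
    ½ * 1ℚ  ≡⟨ *-identityʳ ½ ⟩
    ½  ∎
    where
    open ≤-Reasoning
    open +-*-Solver

  ¼**≤½½^ : ∀ j → 1 ℕ.≤ j → ¼ ** j ≤ ½ * ½^ j
  ¼**≤½½^ j 1≤j = begin
    ¼ ** j  ≡⟨ *-** ½ ½ j ⟩
    ½ ** j * ½ ** j    ≤⟨ *-monoʳ (½ ** j) (0≤** 0≤½ j) (small j 1≤j) ⟩
    ½ * ½ ** j         ≡⟨ cong (½ *_) (½**≡½^ j) ⟩
    ½ * ½^ j  ∎
    where
    open ≤-Reasoning
    0≤½ : 0ℚ ≤ ½
    0≤½ = nonNegative⁻¹ ½
    small : ∀ j → 1 ℕ.≤ j → ½ ** j ≤ ½
    small (suc j) _ = ≤-trans (*-monoˡ ½ 0≤½ (**≤1 0≤½ (≤ᵇ⇒≤ _) j)) (≤-reflexive (*-identityʳ ½))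

  average≤⊔ : ∀ p q → ½ * p + ½ * q ≤ p ⊔ q
  average≤⊔ p q = ≤-trans
    (+-mono-≤ (*-monoˡ ½ (nonNegative⁻¹ ½) (p≤p⊔q p q)) (*-monoˡ ½ (nonNegative⁻¹ ½) (p≤q⊔p p q)))
    (≤-reflexive (½+½ (p ⊔ q)))

  ≤failure : ∀ n k (2≤k : 2 ℕ.≤ k) (2k≤n : 2 ℕ.* k ℕ.≤ n) e → ι (n ℕ.^ 2) * e ≤ 1ℚ →
    ¼ ** (k ℕ.∸ 1) + e ≤ failure n k 2≤k 2k≤n
  ≤failure n k 2≤k 2k≤n e n²e≤1 = ≤-trans
    (+-mono-≤ (¼**≤½½^ (k ℕ.∸ 1) (ℕ.∸-monoˡ-≤ 1 2≤k)) e≤½x) (average≤⊔ (½^ (k ℕ.∸ 1)) x)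
    where
    open ≤-Reasoning
    instance
      n²≢0 : ℕ.NonZero (n ℕ.^ 2)
      n²≢0 = ℕ.m^n≢0 n 2 {{ℕ.>-nonZero (ℕ.≤-trans (s≤s z≤n) (ℕ.≤-trans 2≤k (ℕ.≤-trans (ℕ.m≤n*m k 2) 2k≤n)))}}
    x : ℚ
    x = ℤ.+ 2 / n ℕ.^ 2
    e≤½x : e ≤ ½ * x
    e≤½x = *-cancelˡ-≤-pos (ι (n ℕ.^ 2)) {{ι-pos (n ℕ.^ 2)}} (begin
      ι (n ℕ.^ 2) * e  ≤⟨ n²e≤1 ⟩
      1ℚ  ≡⟨⟩
      ½ * ι 2  ≡⟨ cong (½ *_) (/-ι 2 (n ℕ.^ 2)) ⟨
      ½ * (x * ι (n ℕ.^ 2))     ≡⟨ solve 3 (λ h x y → h :* (x :* y) := y :* (h :* x)) refl ½ x (ι (n ℕ.^ 2)) ⟩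
      ι (n ℕ.^ 2) * (½ * x)     ∎)
      where open +-*-Solver

  module _ {n g : ℕ} (n<2^g : n ℕ.< 2 ℕ.^ g) where
    private
      y : ℕ
      y = 2 ℕ.^ g
      n≤y : n ℕ.≤ y
      n≤y = ℕ.<⇒≤ n<2^g

      power : ∀ m → (2 ℕ.^ m) ℕ.^ g ≡ y ℕ.^ m
      power m = trans (ℕ.^-*-assoc 2 m g) (trans (cong (2 ℕ.^_) (ℕ.*-comm m g)) (sym (ℕ.^-*-assoc 2 g m)))

      n⁴≤y⁴ : n ℕ.^ 2 ℕ.* (n ℕ.* n) ℕ.≤ y ℕ.^ 4
      n⁴≤y⁴ = ℕ.≤-trans (ℕ.≤-reflexive (solve 1 (λ n → n :^ 2 :* (n :* n) := n :^ 4) refl n)) (ℕ.^-monoˡ-≤ 4 n≤y)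
        where open ℕ.+-*-Solver

    -- The union bound has P (L+1) k ≤ 2n² terms, each 4 · 4^-I. Multiplied by n² and doubled, the
    -- coefficients amount to at most 16n⁴ ≤ 16^(g+1) = 4^(2(g+1)), which dictates I = 2(g+1).
    move-error : ∀ P L k → P ℕ.* suc L ℕ.≤ 2 ℕ.* n → k ℕ.≤ n →
      ι (n ℕ.^ 2) * (ι P * (ι (suc L) * (ι k * (ι 4 * ¼ ** (2 ℕ.* suc g))))) ≤ ½
    move-error P L k PL≤2n k≤n = ≤-trans (≤-reflexive product) (ι*¼**≤½ N (2 ℕ.* suc g) (begin
      2 ℕ.* (n ℕ.^ 2 ℕ.* (P ℕ.* (suc L ℕ.* (k ℕ.* 4))))
        ≡⟨ solve 4 (λ m p l k → con 2 :* (m :* (p :* (l :* (k :* con 4)))) := con 8 :* (m :* ((p :* l) :* k))) refl (n ℕ.^ 2) P (suc L) k ⟩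
      8 ℕ.* (n ℕ.^ 2 ℕ.* ((P ℕ.* suc L) ℕ.* k))
        ≤⟨ ℕ.*-monoʳ-≤ 8 (ℕ.*-monoʳ-≤ (n ℕ.^ 2) (ℕ.*-mono-≤ PL≤2n k≤n)) ⟩
      8 ℕ.* (n ℕ.^ 2 ℕ.* ((2 ℕ.* n) ℕ.* n))
        ≡⟨ solve 2 (λ m n → con 8 :* (m :* ((con 2 :* n) :* n)) := con 16 :* (m :* (n :* n))) refl (n ℕ.^ 2) n ⟩
      16 ℕ.* (n ℕ.^ 2 ℕ.* (n ℕ.* n))
        ≤⟨ ℕ.*-monoʳ-≤ 16 n⁴≤y⁴ ⟩
      16 ℕ.* y ℕ.^ 4
        ≡⟨ cong (16 ℕ.*_) (power 4) ⟨
      16 ℕ.^ suc g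
        ≡⟨ ℕ.^-*-assoc 4 2 (suc g) ⟩
      4 ℕ.^ (2 ℕ.* suc g) ∎))
      where
      open ℕ.≤-Reasoning
      open ℕ.+-*-Solver
      N : ℕ
      N = n ℕ.^ 2 ℕ.* (P ℕ.* (suc L ℕ.* (k ℕ.* 4)))
      product : ι (n ℕ.^ 2) * (ι P * (ι (suc L) * (ι k * (ι 4 * ¼ ** (2 ℕ.* suc g))))) ≡ ι N * ¼ ** (2 ℕ.* suc g)
      product = trans
        (Ring.solve 6 (λ a b c d e f → a Ring.:* (b Ring.:* (c Ring.:* (d Ring.:* (e Ring.:* f)))) Ring.:= (a Ring.:* (b Ring.:* (c Ring.:* (d Ring.:* e)))) Ring.:* f)
          refl (ι (n ℕ.^ 2)) (ι P) (ι (suc L)) (ι k) (ι 4) (¼ ** (2 ℕ.* suc g)))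
        (cong (_* ¼ ** (2 ℕ.* suc g)) (sym (trans (ι-* (n ℕ.^ 2) (P ℕ.* (suc L ℕ.* (k ℕ.* 4))))
          (cong (ι (n ℕ.^ 2) *_) (trans (ι-* P (suc L ℕ.* (k ℕ.* 4)))
            (cong (ι P *_) (trans (ι-* (suc L) (k ℕ.* 4)) (cong (ι (suc L) *_) (ι-* k 4)))))))))
        where module Ring = +-*-Solver

    -- x^g ≤ 64^-g = (2^g)^-6. Four of the six factors 2^g absorb n² P k ≤ n⁴; the other two leave
    -- room for the factor 2.
    path-error : ∀ P k x → 1 ℕ.≤ g → P ℕ.≤ n → k ℕ.≤ n → 0ℚ ≤ x → ι 64 * x ≤ 1ℚ →
      ι (n ℕ.^ 2) * (ι P * (ι k * x ** g)) ≤ ½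
    path-error P k x 1≤g P≤n k≤n 0≤x 64x≤1 = ≤-trans decay (ι*¼**≤½ N (3 ℕ.* g) (begin
      2 ℕ.* (n ℕ.^ 2 ℕ.* (P ℕ.* k))
        ≤⟨ ℕ.*-mono-≤ 2≤y² (ℕ.≤-trans (ℕ.*-monoʳ-≤ (n ℕ.^ 2) (ℕ.*-mono-≤ P≤n k≤n)) n⁴≤y⁴) ⟩
      y ℕ.^ 2 ℕ.* y ℕ.^ 4
        ≡⟨ ℕ.^-distribˡ-+-* y 2 4 ⟨
      y ℕ.^ 6
        ≡⟨ power 6 ⟨
      64 ℕ.^ g
        ≡⟨ ℕ.^-*-assoc 4 3 g ⟩
      4 ℕ.^ (3 ℕ.* g) ∎))
      where
      open ℕ.≤-Reasoning
      N : ℕ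
      N = n ℕ.^ 2 ℕ.* (P ℕ.* k)
      2≤y² : 2 ℕ.≤ y ℕ.^ 2
      2≤y² = ℕ.≤-trans (ℕ.^-monoʳ-≤ 2 1≤g) (ℕ.≤-trans (ℕ.m≤m*n y y {{ℕ.m^n≢0 2 g}})
        (ℕ.≤-reflexive (cong (y ℕ.*_) (sym (ℕ.*-identityʳ y)))))
      x≤¼³ : x ≤ ¼ ** 3
      x≤¼³ = *-cancelˡ-≤-pos (ι 64) 64x≤1
      decay : ι (n ℕ.^ 2) * (ι P * (ι k * x ** g)) ≤ ι N * ¼ ** (3 ℕ.* g)
      decay = ≤-trans
        (*-monoˡ (ι (n ℕ.^ 2)) (0≤ι (n ℕ.^ 2)) (*-monoˡ (ι P) (0≤ι P) (*-monoˡ (ι k) (0≤ι k)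
          (≤-trans (**-monoˡ 0≤x x≤¼³ g) (≤-reflexive (trans (sym (**-* ¼ g 3)) (cong (¼ **_) (ℕ.*-comm g 3))))))))
        (≤-reflexive (trans
          (solve 4 (λ a b c d → a :* (b :* (c :* d)) := (a :* (b :* c)) :* d) refl (ι (n ℕ.^ 2)) (ι P) (ι k) (¼ ** (3 ℕ.* g)))
          (cong (_* ¼ ** (3 ℕ.* g)) (sym (trans (ι-* (n ℕ.^ 2) (P ℕ.* k)) (cong (ι (n ℕ.^ 2) *_) (ι-* P k)))))))
        where open +-*-Solver

  module Conclusion (s k′ r : ℕ) .{{_ : ℕ.NonZero s}} (source : Fin (suc k′)) (N : ℕ) .{{_ : ℕ.NonZero N}}
    (2≤k : 2 ℕ.≤ suc k′) (2k≤n : 2 ℕ.* suc k′ ℕ.≤ s ℕ.* s)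
    (K Λ : ℕ) (K²<k : K ℕ.* K ℕ.< suc k′) (k≤[1+K]² : suc k′ ℕ.≤ suc K ℕ.* suc K)
    (2^Λ≤n : 2 ℕ.^ Λ ℕ.≤ s ℕ.* s) (n<2^g : s ℕ.* s ℕ.< 2 ℕ.^ suc Λ) (2≤Λ : 2 ℕ.≤ Λ)
    (large : 1024 ℕ.* ((2 ℕ.+ Λ) ℕ.* (2 ℕ.+ Λ)) ℕ.≤ s)
    (radius : 16384 ℕ.* (r ℕ.* r ℕ.* suc k′) ℕ.≤ s ℕ.* s)
    (c : ℕ) (c-large : 40000000 ℕ.≤ c) (16c≤N : 16 ℕ.* c ℕ.≤ N)
    where

    private
      n k : ℕ
      n = s ℕ.* s
      k = suc k′

    open Process s k
    open Outcomes {s} {k′} r source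
    open Scales s k r K Λ 2≤k K²<k k≤[1+K]² large radius

    Goal : Set
    Goal = HasProbability≥ s k (λ ω → BroadcastTime≥ r ω source (real (fromℕ⁺ N ⁻¹ · rate n k 2≤k 2k≤n)))
      (1ℚ - failure n k 2≤k 2k≤n)

    private
      -- 40000000 exceeds the constant factors of all the rate estimates below.
      constant : ∀ a → T (a ℕ.≤ᵇ 40000000) → a ℕ.≤ c
      constant a a≤ = ℕ.≤-trans (ℕ.≤ᵇ⇒≤ a 40000000 a≤) c-large

      k≤n : k ℕ.≤ n
      k≤n = ℕ.≤-trans (ℕ.m≤n*m k 2) 2k≤n

      s≤n : s ℕ.≤ n
      s≤n = ℕ.m≤m*n s s

      conclude : ∀ {t} τ e → Whp t (¼ ** k′ + e) (Slow r source τ) → ι (n ℕ.^ 2) * e ≤ 1ℚ →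
        n ℕ.≤ c ℕ.* (τ ℕ.* (K ℕ.* (G ℕ.* G))) → Goal
      conclude τ e whp n²e≤1 n≤ = Whp⇒HasProbability≥
        (whp-mono ≤-refl (λ ω slow t → late ω slow t) whp)
        (1-anti (≤failure n k 2≤k 2k≤n e n²e≤1))
        where
        late : ∀ ω → Slow r source τ ω → BroadcastTime≥ r ω source (real (fromℕ⁺ N ⁻¹ · rate n k 2≤k 2k≤n))
        late ω slow t (all , _) = rate-bound N n k 2≤k 2k≤n K Λ t (ℕ.<⇒≤ K²<k) 2^Λ≤n
          (ℕ.≤-trans (finish {s} {τ} {K} {G} {Λ} {N} c n≤ (G≤2Λ 2≤Λ) 16c≤N)
            (ℕ.*-monoˡ-≤ (K ℕ.* (Λ ℕ.* Λ)) (ℕ.*-monoˡ-≤ N (ℕ.≮⇒≥ λ t<τ → slow t t<τ all))))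

      density-sparse : 2 ℕ.≤ γ → ι 64 * (ι k * density s γ) ≤ 1ℚ
      density-sparse 2≤γ = ≤-trans
        (≤-reflexive (trans (sym (*-assoc (ι 64) (ι k) (density s γ))) (cong (_* density s γ) (sym (ι-* 64 k)))))
        (fraction≤1 (64 ℕ.* k) (ballSize γ) (s ℕ.* s) {{ℕ.m*n≢0 s s}} (sparse 2≤γ))

      0≤kdensity : 0ℚ ≤ ι k * density s γ
      0≤kdensity = 0≤* (ι k) (density s γ) (0≤ι k) (0≤density s γ)

      paths≤½ : 2 ℕ.≤ γ → ∀ P → P ℕ.≤ s → ι (n ℕ.^ 2) * (ι P * (ι k * (ι k * density s γ) ** g)) ≤ ½
      paths≤½ 2≤γ P P≤s = path-error {n} {g} n<2^g P k (ι k * density s γ) (s≤s z≤n) (ℕ.≤-trans P≤s s≤n) k≤n 0≤kdensity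
        (density-sparse 2≤γ)

      typical : ∀ q → 1 ℕ.≤ q → ∀ I a i δ → δ ℕ.≤ I ℕ.* (q ℕ.* q) → ∀ {μ} → (3 ℕ.* I) ℕ.* q ℕ.+ (3 ℕ.* I) ℕ.* q ℕ.≤ μ →
        Whp (δ ℕ.+ i) (ι 4 * ¼ ** I) (λ ω → manhattan (lookup (ω i) a) (lookup (ω (δ ℕ.+ i)) a) ℕ.≤ μ)
      typical (suc p) _ I a i δ δ≤ ≤μ = whp-mono ≤-refl (λ ω m → ℕ.≤-trans m ≤μ) (whp-typical-moves p I a i δ δ≤)

      bounded-moves : ∀ L μ → L ℕ.≤ μ → ∀ a i δ → δ ℕ.≤ L →
        Whp (δ ℕ.+ i) 0ℚ (λ ω → manhattan (lookup (ω i) a) (lookup (ω (δ ℕ.+ i)) a) ℕ.≤ μ)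
      bounded-moves L μ L≤μ a i δ δ≤L = whp-mono ≤-refl (λ ω m → ℕ.≤-trans m (ℕ.≤-trans δ≤L L≤μ)) (whp-bounded-moves a i δ)

      no-moves-error : ∀ P L → ι P * (ι (suc L) * (ι k * 0ℚ)) ≡ 0ℚ
      no-moves-error P L = trans (cong (λ z → ι P * (ι (suc L) * z)) (*-zeroʳ (ι k)))
        (trans (cong (ι P *_) (*-zeroʳ (ι (suc L)))) (*-zeroʳ (ι P)))

      P[1+L]≤2n : ∀ P L → 1 ℕ.≤ L → P ℕ.* L ℕ.≤ n → P ℕ.* suc L ℕ.≤ 2 ℕ.* n
      P[1+L]≤2n P L 1≤L PL≤n = begin
        P ℕ.* suc L  ≤⟨ ℕ.*-monoʳ-≤ P (ℕ.+-monoˡ-≤ L 1≤L) ⟩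
        P ℕ.* (L ℕ.+ L)        ≡⟨ ℕ.*-distribˡ-+ P L L ⟩
        P ℕ.* L ℕ.+ P ℕ.* L    ≤⟨ ℕ.+-mono-≤ PL≤n PL≤n ⟩
        n ℕ.+ n  ≡⟨ cong (n ℕ.+_) (ℕ.+-identityʳ n) ⟨
        2 ℕ.* n  ∎
        where open ℕ.≤-Reasoning

      module _ (1≤q : 1 ℕ.≤ q) where
        open Diffusive 1≤q

        2≤γ : 2 ℕ.≤ γ
        2≤γ = ℕ.≤-trans (s≤s (s≤s z≤n)) 36≤γ

        1≤γ : 1 ℕ.≤ γ
        1≤γ = ℕ.<⇒≤ 2≤γ

        moves : ∀ a i δ → δ ℕ.≤ L →
          Whp (δ ℕ.+ i) (ι 4 * ¼ ** I) (λ ω → manhattan (lookup (ω i) a) (lookup (ω (δ ℕ.+ i)) a) ℕ.≤ μ)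
        moves a i δ δ≤L = typical q 1≤q I a i δ δ≤L typical≤μ

        few-agents : K ℕ.≤ G → Goal
        few-agents K≤G = conclude (1 ℕ.* L) e
          (whp-mono (+-monoˡ-≤ e ¼-drop) (λ _ slow → slow)
            (slow-isolated L μ (ι 4 * ¼ ** I) moves γ r+2μ≤γ 2≤k (density-sparse 2≤γ)))
          (≤-trans (move-error {n} {g} n<2^g 1 L k (P[1+L]≤2n 1 L 1≤L L≤n) k≤n) (≤ᵇ⇒≤ _))
          (single-phase-rate 84 72 {c} {s} {K} {γ} {G} {q} (constant 36578304 _) (s≤84Kγ 1≤γ) γ≤72Gq K≤G)
          where
          e : ℚ
          e = ι 1 * (ι (suc L) * (ι k * (ι 4 * ¼ ** I)))
          L≤n : 1 ℕ.* L ℕ.≤ n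
          L≤n = ℕ.≤-trans (ℕ.≤-reflexive (ℕ.*-identityˡ L)) (ℕ.≤-trans L≤γ² (ℕ.*-mono-≤ γ≤s γ≤s))
          ¼-drop : ι 2 * ¼ ** k ≤ ¼ ** k′
          ¼-drop = begin
            ι 2 * (¼ * ¼ ** k′)     ≡⟨ *-assoc (ι 2) ¼ (¼ ** k′) ⟨
            ι 2 * ¼ * ¼ ** k′       ≤⟨ *-monoʳ (¼ ** k′) (0≤** (nonNegative⁻¹ ¼) k′) (≤ᵇ⇒≤ {ι 2 * ¼} {1ℚ} _) ⟩
            1ℚ * ¼ ** k′  ≡⟨ *-identityˡ (¼ ** k′) ⟩
            ¼ ** k′  ∎
            where open ≤-Reasoning

        many-agents : G ℕ.≤ suc K → Goal
        many-agents G≤1+K = conclude (P ℕ.* L) e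
          (slow-islands L μ P (ι 4 * ¼ ** I) moves {{ℕ.>-nonZero 1≤L}} d quarter γ g r+2μ≤γ range≤d)
          (≤-trans (≤-reflexive (*-distribˡ-+ (ι (n ℕ.^ 2)) _ _))
            (+-mono-≤ (move-error {n} {g} n<2^g P L k (P[1+L]≤2n P L 1≤L PL≤n) k≤n) (paths≤½ 2≤γ P P≤s)))
          (phased-diffusive-rate 10 84 72 2 {c} {s} {d} {K} {γ} {P} {G} {q} (constant 8709120 _) s≤10d (s≤84Kγ 1≤γ) d≤2PGγ γ≤72Gq)
          where
          open Phased G≤1+K 1≤γ
          e : ℚ
          e = ι P * (ι (suc L) * (ι k * (ι 4 * ¼ ** I))) + ι P * (ι k * (ι k * density s γ) ** g)
          PL≤n : P ℕ.* L ℕ.≤ n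
          PL≤n = ℕ.≤-trans (ℕ.*-monoʳ-≤ P L≤γ²) (ℕ.≤-trans (ℕ.≤-reflexive (sym (ℕ.*-assoc P γ γ))) (ℕ.*-mono-≤ Pγ≤s γ≤s))

      small-γ : q ≡ 0 → γ ℕ.< 36 ℕ.* G
      small-γ q≡0 = ℕ.≤-trans (m<[1+m/n]*n γ (36 ℕ.* G))
        (ℕ.≤-reflexive (trans (cong (λ q → suc q ℕ.* (36 ℕ.* G)) q≡0) (ℕ.*-identityˡ (36 ℕ.* G))))

      -- If q = 0 then s = O(KG), so a time of order √n already exceeds the claimed rate, and agents
      -- moving one node per step need that long.
      zero-radius : q ≡ 0 → r ≡ 0 → Goal
      zero-radius q≡0 r≡0 = conclude (P ℕ.* 1) e
        (slow-coincident 1 1 P 0ℚ (bounded-moves 1 1 ℕ.≤-refl) d quarter r≡0 refl (m/n*n≤m d 2))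
        (≤-trans (≤-reflexive (trans (cong (ι (n ℕ.^ 2) *_) (no-moves-error P 1)) (*-zeroʳ (ι (n ℕ.^ 2))))) 0≤1)
        (unphased-rate 40 1512 {c} {s} {K} {P} {G} (constant 60480 _) (s≤s z≤n) s≤40P s≤1512KG)
        where
        P : ℕ
        -- Each phase of one step with μ = 1 extends the range by 2.
        P = d ℕ./ 2
        e : ℚ
        e = ι P * (ι 2 * (ι k * 0ℚ))
        s≤40P : s ℕ.≤ 40 ℕ.* P
        s≤40P = ℕ.≤-trans s≤10d (ℕ.≤-trans (ℕ.*-monoʳ-≤ 10 (m≤2[m/n*n] 2≤d))
          (ℕ.≤-reflexive (solve 1 (λ p → con 10 :* (con 2 :* (p :* con 2)) := con 40 :* p) refl P)))
          where open ℕ.+-*-Solver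
        s≤1512KG : s ℕ.≤ 1512 ℕ.* (K ℕ.* G)
        s≤1512KG = begin
          s  ≤⟨ ℕ.<⇒≤ (m<[1+m/n]*n s (21 ℕ.* suc K)) ⟩
          suc γ ℕ.* (21 ℕ.* suc K)  ≤⟨ ℕ.*-mono-≤ (small-γ q≡0) (ℕ.*-monoʳ-≤ 21 1+K≤2K) ⟩
          (36 ℕ.* G) ℕ.* (21 ℕ.* (2 ℕ.* K))
            ≡⟨ solve 2 (λ g k → (con 36 :* g) :* (con 21 :* (con 2 :* k)) := con 1512 :* (k :* g)) refl G K ⟩
          1512 ℕ.* (K ℕ.* G)  ∎
          where
          open ℕ.≤-Reasoning
          open ℕ.+-*-Solver

      -- A positive radius forces γ ≥ 3, so the sparsity estimate is available, and phases of μ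
      -- steps need no deviation bound.
      positive-radius : q ≡ 0 → 1 ℕ.≤ r → G ℕ.≤ suc K → Goal
      positive-radius q≡0 1≤r G≤1+K = conclude (P ℕ.* μ) e
        (slow-islands μ μ P 0ℚ (bounded-moves μ μ ℕ.≤-refl) {{ℕ.>-nonZero 1≤μ}} d quarter γ g r+2μ≤γ range≤d)
        (≤-trans (≤-reflexive (trans (cong (λ z → ι (n ℕ.^ 2) * (z + paths)) (no-moves-error P μ))
            (cong (ι (n ℕ.^ 2) *_) (+-identityˡ paths))))
          (≤-trans (paths≤½ (ℕ.≤-trans (s≤s (s≤s z≤n)) 3≤γ) P P≤s) (≤ᵇ⇒≤ _)))
        (phased-ballistic-rate 10 84 36 2 6 {c} {s} {d} {K} {γ} {P} {G} {μ} (constant 362880 _) s≤10d (s≤84Kγ γ-pos) d≤2PGγ (ℕ.<⇒≤ (small-γ q≡0)) γ≤6μ)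
        where
        3≤γ : 3 ℕ.≤ γ
        3≤γ = ℕ.≤-trans (ℕ.*-monoʳ-≤ 3 1≤r) 3r≤γ
        γ-pos : 1 ℕ.≤ γ
        γ-pos = ℕ.≤-trans (s≤s z≤n) 3≤γ
        1≤μ : 1 ℕ.≤ μ
        1≤μ = ≤/ 3≤γ
        open Phased G≤1+K γ-pos
        paths e : ℚ
        paths = ι P * (ι k * (ι k * density s γ) ** g)
        e = ι P * (ι (suc μ) * (ι k * 0ℚ)) + paths
        γ≤6μ : γ ℕ.≤ 6 ℕ.* μ
        γ≤6μ = ℕ.≤-trans (m≤2[m/n*n] 3≤γ) (ℕ.≤-reflexive (solve 1 (λ m → con 2 :* (m :* con 3) := con 6 :* m) refl μ))
          where open ℕ.+-*-Solver

      -- This rules out q = 0 when there are few agents: 36 · 21 = 756 is covered by the 1024 of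
      -- `large`.
      few⇒36G≤γ : K ℕ.< g → 36 ℕ.* G ℕ.≤ γ
      few⇒36G≤γ K<g = ≤/ (begin
        36 ℕ.* G ℕ.* (21 ℕ.* suc K)      ≤⟨ ℕ.*-monoʳ-≤ (36 ℕ.* G) (ℕ.*-monoʳ-≤ 21 (ℕ.m≤n⇒m≤1+n K<g)) ⟩
        36 ℕ.* G ℕ.* (21 ℕ.* G)  ≡⟨ solve 1 (λ g → con 36 :* g :* (con 21 :* g) := con 756 :* (g :* g)) refl G ⟩
        756 ℕ.* (G ℕ.* G)  ≤⟨ ℕ.*-monoˡ-≤ (G ℕ.* G) {756} {1024} (ℕ.≤ᵇ⇒≤ 756 1024 _) ⟩
        1024 ℕ.* (G ℕ.* G)  ≤⟨ large ⟩
        s  ∎)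
        where
        open ℕ.≤-Reasoning
        open ℕ.+-*-Solver

      zero⊎positive : ∀ m → m ≡ 0 ⊎ 1 ℕ.≤ m
      zero⊎positive zero    = inj₁ refl
      zero⊎positive (suc m) = inj₂ (s≤s z≤n)

      many : G ℕ.≤ suc K → q ≡ 0 ⊎ 1 ℕ.≤ q → r ≡ 0 ⊎ 1 ℕ.≤ r → Goal
      many G≤1+K (inj₂ 1≤q) _          = many-agents 1≤q G≤1+K
      many G≤1+K (inj₁ q≡0) (inj₁ r≡0) = zero-radius q≡0 r≡0
      many G≤1+K (inj₁ q≡0) (inj₂ 1≤r) = positive-radius q≡0 1≤r G≤1+K

      compare : K ℕ.< g ⊎ g ℕ.≤ K → Goal
      compare (inj₁ K<g) = few-agents (≤/ (ℕ.≤-trans (ℕ.≤-reflexive (ℕ.*-identityˡ (36 ℕ.* G))) (few⇒36G≤γ K<g)))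
        (ℕ.≤-trans (ℕ.<⇒≤ K<g) (ℕ.n≤1+n g))
      compare (inj₂ g≤K) = many (s≤s g≤K) (zero⊎positive q) (zero⊎positive r)

    broadcast-time : Goal
    broadcast-time = compare (ℕ.<-≤-connex K g)

  slow-broadcast : ∀ N c .{{_ : ℕ.NonZero N}} → 40000000 ℕ.≤ c → 16 ℕ.* c ℕ.≤ N → ∀ (s k r : ℕ) (source : Fin k) →
    2 ℕ.^ Λ₀ ℕ.≤ s ℕ.* s → (2≤k : 2 ℕ.≤ k) (2k≤n : 2 ℕ.* k ℕ.≤ s ℕ.* s) →
    fromℕ r ≤ᴿ real (maxRadius (s ℕ.* s) k 2≤k 2k≤n) →
    HasProbability≥ s k (λ ω → BroadcastTime≥ r ω source (real (fromℕ⁺ N ⁻¹ · rate (s ℕ.* s) k 2≤k 2k≤n)))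
      (1ℚ - failure (s ℕ.* s) k 2≤k 2k≤n)
  slow-broadcast N c c-large 16c≤N s@(suc _) k@(suc k′) r source n₀≤n 2≤k 2k≤n r≤ = broadcast-time
    where
    n : ℕ
    n = s ℕ.* s
    root = ⌈√⌉ k (s≤s z≤n)
    logarithm = ⌊log₂⌋ n (ℕ.*-mono-≤ {1} {s} {1} {s} (s≤s z≤n) (s≤s z≤n))
    Λ : ℕ
    Λ = proj₁ logarithm
    2^Λ≤n : 2 ℕ.^ Λ ℕ.≤ n
    2^Λ≤n = proj₁ (proj₂ logarithm)
    n<2^1+Λ : n ℕ.< 2 ℕ.^ suc Λ
    n<2^1+Λ = proj₂ (proj₂ logarithm)
    Λ₀≤Λ : Λ₀ ℕ.≤ Λ
    Λ₀≤Λ = ℕ.s≤s⁻¹ (^2-cancel-≤ {Λ₀} {suc Λ} (ℕ.≤-<-trans n₀≤n n<2^1+Λ))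
    large : 1024 ℕ.* ((2 ℕ.+ Λ) ℕ.* (2 ℕ.+ Λ)) ℕ.≤ s
    large = square-cancel-≤ (ℕ.≤-trans (subst
      (λ Λ → (1024 ℕ.* ((2 ℕ.+ Λ) ℕ.* (2 ℕ.+ Λ))) ℕ.* (1024 ℕ.* ((2 ℕ.+ Λ) ℕ.* (2 ℕ.+ Λ))) ℕ.≤ 2 ℕ.^ Λ)
      (ℕ.m∸n+n≡m Λ₀≤Λ) (exponential-growth (Λ ℕ.∸ Λ₀))) 2^Λ≤n)
    open Conclusion s k′ r source N 2≤k 2k≤n (proj₁ root) Λ (proj₁ (proj₂ root)) (proj₂ (proj₂ root))
      2^Λ≤n n<2^1+Λ (ℕ.≤-trans (ℕ.≤ᵇ⇒≤ 2 Λ₀ _) Λ₀≤Λ) large (maxRadius-bound n k 2≤k 2k≤n r r≤) c c-large 16c≤N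

open import Defs
open import Data.Nat using (ℕ; _≤_; _*_; _^_)
open import Data.Nat.Properties using (≤-refl; ≤ᵇ⇒≤)
open import Data.Rational using (1ℚ; _-_)
open Bounds using (slow-broadcast)
open Parameters using (Λ₀)

theorem2 : ∃[ C ] ∃[ n₀ ]
    (∀ (s k r : ℕ) (source : Fin k) →
    let n = s * s in
    n₀ ≤ n → (2≤k : 2 ≤ k) (2k≤n : 2 * k ≤ n) →
    fromℕ r ≤ᴿ real (maxRadius n k 2≤k 2k≤n) →
    HasProbability≥ s k
    (λ ω → BroadcastTime≥ r ω source (real (C · rate n k 2≤k 2k≤n)))
    (1ℚ - failure n k 2≤k 2k≤n))
-- 640000000 = 16 · 40000000, with the 16 of `finish`; the largest rate constant is 84² · 72² =
-- 36578304, from the single phase.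
theorem2 = fromℕ⁺ 640000000 ⁻¹ , 2 ^ Λ₀ , slow-broadcast 640000000 40000000 ≤-refl (≤ᵇ⇒≤ 640000000 640000000 _)
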